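{- Let $\mathcal{A}$ be a hyperplane arrangement in $\mathbb{P}^3(\mathbb{R})$ consisting of $n$ hyperplanes. Write $h:=\sum_{i \geq 2} (i-1) h^\mathcal{A}_i$ and $g^\mathcal{A}_1:=\sum_{i \geq 2} h^\mathcal{A}_i$. Then: (i) The characteristic polynomial of $\mathcal{A}$ is $$\chi(\mathcal{A},t)=(t-1)\left( t^3+(1-n)t^2+(h+1-n)t+ h + 1 -f^\mathcal{A}_3 \right).$$ (ii) All roots of $\chi(\mathcal{A},t)$ are real if and only if the following three relations hold: $$h=\sum_{i \geq 2} (i-1) h^\mathcal{A}_i= \sum_{H \in \mathcal{A}} |\mathcal{A}^H| -g^\mathcal{A}_1\leq \left \lfloor \frac{(n+2)(n-1)}{3} \right \rfloor , \tag{1}$$ $$f^\mathcal{A}_3 \leq \left \lfloor\frac{(9n+18)h + 20 + 12n + 2 \sqrt{(n^2+n-2-3h )^3}-2n^3-3n^2 }{27} \right \rfloor, \tag{2}$$ $$f^\mathcal{A}_3 \geq \left \lceil \frac{(9n+18)h + 20 + 12n - 2 \sqrt{(n^2+n-2-3h )^3}-2n^3-3n^2 }{27} \right \rceil. \tag{3}$$ Moreover, the estimates (1), (2), (3) are tight: there exists an arrangement in $\mathbb{P}^3(\mathbb{R})$ for which equality holds in each of (1), (2) and (3).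
   Context: An arrangement in $\mathbb{P}^3=\mathbb{P}^3(\mathbb{R})$ is a finite set $\mathcal{A}$ of projective hyperplanes (images of linear hyperplanes of $\mathbb{R}^4$) with empty common intersection; $n=|\mathcal{A}|$. $\mathcal{A}$ induces a cell decomposition of $\mathbb{P}^3$; $f^\mathcal{A}_i$ is the number of its $i$-dimensional cells, so $f^\mathcal{A}_3$ is the number of chambers. The intersection lattice $L$ consists of all subspaces of $\mathbb{R}^4$ that are intersections of the corresponding linear hyperplanes, ordered by reverse inclusion, with Möbius function $\mu$; the characteristic polynomial is $\chi(\mathcal{A},t)=\sum_{X\in L}\mu(\mathbb{R}^4,X)t^{\dim X}$. A line of $\mathcal{A}$ is an element of $L$ of dimension $2$; its weight is the number of hyperplanes of $\mathcal{A}$ containing it, and $h^\mathcal{A}_i$ denotes the number of lines of weight $i$ ($i\ge 2$). For $H\in\mathcal{A}$, the restriction $\mathcal{A}^H$ is the arrangement in $\mathbb{P}^2$ formed by the codimension-two elements of $L$ contained in $H$, and $|\mathcal{A}^H|$ is its number of lines. -}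

module Defs where

open import Algebra.Bundles using (CommutativeRing)
open import Axiom.ExcludedMiddle using (ExcludedMiddle)
open import Data.Fin.Base using (Fin)
open import Data.Fin.Subset using (Subset; inside; outside; _∈_; _⊆_; _⊂_; ∣_∣)
open import Data.Fin.Subset.Induction using (⊂-wellFounded)
open import Data.Fin.Subset.Properties using (_∈?_; _⊂?_; nonempty?)
open import Data.Integer.Base as ℤ using (ℤ; +_; -[1+_]; 0ℤ; 1ℤ)
open import Data.List.Base using (List; []; _∷_; _++_; map; filter; length; foldr; applyUpTo; allFin)
open import Data.Nat.Base as ℕ using (ℕ; zero; suc)
open import Data.Nat.ListAction using (sum)
import Data.Nat.Properties as ℕ
open import Data.Product.Base using (Σ; ∃; _×_; _,_; proj₁; proj₂)
open import Data.Sum.Base using (_⊎_; inj₁; inj₂)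
open import Data.Vec.Base as Vec using ()
open import Data.Vec.Functional using (Vector)
open import Function.Bundles using (_⇔_; Equivalence; Bijection)
open import Function.Construct.Composition using (_⇔-∘_)
open import Function.Construct.Identity using (⇔-id)
open import Function.Construct.Symmetry using (⇔-sym)
open import Induction.WellFounded using (module All)
open import Level using (0ℓ)
open import Relation.Binary.Bundles using (Setoid)
open import Relation.Binary.Core using (Rel)
open import Relation.Binary.PropositionalEquality as ≡ using (_≡_; _≢_)
open import Relation.Binary.Structures using (IsTotalOrder)
open import Relation.Nullary using (¬_; yes; no)
open import Relation.Unary using (Pred; Satisfiable; _≐_) renaming (_⊆_ to _⊆ₚ_)

-- The real numbers, as a Dedekind-complete ordered field; such a field is
-- unique up to isomorphism.  The value of 0# ⁻¹ is unspecified.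
record RealNumbers : Set₁ where
  infix 8 _⁻¹
  infix 4 _≤_ _<_
  field
    commutativeRing : CommutativeRing 0ℓ 0ℓ
  open CommutativeRing commutativeRing public
  field
    1≉0          : 1# ≉ 0#
    _⁻¹          : Carrier → Carrier
    ⁻¹-inverse   : ∀ {x} → x ≉ 0# → x * x ⁻¹ ≈ 1#
    _≤_          : Rel Carrier 0ℓ
    isTotalOrder : IsTotalOrder _≈_ _≤_
    +-monoˡ-≤    : ∀ z {x y} → x ≤ y → x + z ≤ y + z
    *-nonneg     : ∀ {x y} → 0# ≤ x → 0# ≤ y → 0# ≤ x * y

  _<_ : Rel Carrier 0ℓ
  x < y = x ≤ y × x ≉ y

  UpperBound : Pred Carrier 0ℓ → Pred Carrier 0ℓ
  UpperBound P b = ∀ x → P x → x ≤ b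

  field
    supremum : (P : Pred Carrier 0ℓ) → Satisfiable P → Satisfiable (UpperBound P) →
               ∃ λ s → UpperBound P s × (∀ b → UpperBound P b → s ≤ b)

-- Integer polynomials, by lists of coefficients with the constant one first.
-- Trailing zeros are allowed, so equality is coefficientwise.
Poly : Set
Poly = List ℤ

coeff : Poly → ℕ → ℤ
coeff []      _       = 0ℤ
coeff (a ∷ _) zero    = a
coeff (_ ∷ p) (suc k) = coeff p k

infix  4 _≋_
infixl 6 _⊕_
infixl 7 _⊗_

_≋_ : Rel Poly 0ℓ
p ≋ q = ∀ k → coeff p k ≡ coeff q k

_⊕_ : Poly → Poly → Poly
[]      ⊕ q       = q
(a ∷ p) ⊕ []      = a ∷ p
(a ∷ p) ⊕ (b ∷ q) = a ℤ.+ b ∷ p ⊕ q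

_⊗_ : Poly → Poly → Poly
[]      ⊗ q = []
(a ∷ p) ⊗ q = map (a ℤ.*_) q ⊕ (0ℤ ∷ p ⊗ q)

monomial : ℤ → ℕ → Poly
monomial a zero    = a ∷ []
monomial a (suc k) = 0ℤ ∷ monomial a k

subsets : ∀ n → List (Subset n)
subsets zero    = Vec.[] ∷ []
subsets (suc n) = map (inside Vec.∷_) (subsets n) ++ map (outside Vec.∷_) (subsets n)

module Reals (ℝ : RealNumbers) where
  open RealNumbers ℝ
  open import Algebra.Definitions.RawMonoid +-rawMonoid using ()
    renaming (_×_ to _times_; sum to ∑) public

  fromℤ : ℤ → Carrier
  fromℤ (+ n)    = n times 1#
  fromℤ -[1+ n ] = - (suc n times 1#)

  IsSqrt : Carrier → Carrier → Set
  IsSqrt x s = 0# ≤ s × s * s ≈ x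

  IsFloor : Carrier → ℤ → Set
  IsFloor x z = fromℤ z ≤ x × x < fromℤ (z ℤ.+ 1ℤ)

  IsCeiling : Carrier → ℤ → Set
  IsCeiling x z = fromℤ (z ℤ.- 1ℤ) < x × x ≤ fromℤ z

  infix 4 _≤⌊_⌋ _≥⌈_⌉

  _≤⌊_⌋ : ℤ → Carrier → Set
  m ≤⌊ x ⌋ = ∃ λ z → IsFloor x z × m ℤ.≤ z

  _≥⌈_⌉ : ℤ → Carrier → Set
  m ≥⌈ x ⌉ = ∃ λ z → IsCeiling x z × m ℤ.≥ z

  -- The complex number (a , b) is a + b i.
  ℂ : Set
  ℂ = Carrier × Carrier

  evalℂ : Poly → ℂ → ℂ
  evalℂ []      z         = 0# , 0#
  evalℂ (c ∷ p) z@(x , y) =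
    let (u , v) = evalℂ p z in fromℤ c + (x * u - y * v) , x * v + y * u

  AllRootsReal : Poly → Set
  AllRootsReal p = ∀ ((x , y) : ℂ) →
    let (u , v) = evalℂ p (x , y) in u ≈ 0# × v ≈ 0# → y ≈ 0#

  infixl 7 _∙_

  _∙_ : ∀ {d} → Vector Carrier d → Vector Carrier d → Carrier
  a ∙ x = ∑ λ i → a i * x i

  IsZero : ∀ {d} → Pred (Vector Carrier d) 0ℓ
  IsZero x = ∀ i → x i ≈ 0#

  LinearlyIndependent : ∀ {k d} → Vector (Vector Carrier d) k → Set
  LinearlyIndependent v = ∀ c → IsZero (λ j → ∑ λ i → c i * v i j) → IsZero c

  -- A set of n distinct hyperplanes in ℙᵈ⁻¹ with empty common intersection,
  -- each hyperplane being given by a normal vector in ℝᵈ.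
  record Arrangement (d n : ℕ) : Set where
    field
      normal   : Fin n → Vector Carrier d
      nonzero  : ∀ i → ¬ IsZero (normal i)

    H : Fin n → Pred (Vector Carrier d) 0ℓ
    H i x = normal i ∙ x ≈ 0#

    field
      distinct  : ∀ {i j} → i ≢ j → ¬ (H i ≐ H j)
      essential : ∀ x → (∀ i → H i x) → IsZero x

    ⋂ : Subset n → Pred (Vector Carrier d) 0ℓ
    ⋂ S x = ∀ i → i ∈ S → H i x

    -- An element X of the intersection lattice is represented by the set of
    -- all i with X ⊆ H i.  Each X has exactly one such closed index set.
    Closed : Pred (Subset n) 0ℓ
    Closed S = ∀ i → ⋂ S ⊆ₚ H i → i ∈ S

    ∈⇔⊆H : ∀ {S} i → Closed S → i ∈ S ⇔ (⋂ S ⊆ₚ H i)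
    ∈⇔⊆H i closed .Equivalence.to   i∈S x∈⋂S = x∈⋂S i i∈S
    ∈⇔⊆H i closed .Equivalence.from ⋂S⊆H     = closed i ⋂S⊆H
    ∈⇔⊆H i closed .Equivalence.to-cong   ≡.refl = ≡.refl
    ∈⇔⊆H i closed .Equivalence.from-cong ≡.refl = ≡.refl

    -- Hence the order of the lattice is inclusion of index sets.
    ⊆⇔⊇ : ∀ {S T} → Closed T → S ⊆ T ⇔ (⋂ T ⊆ₚ ⋂ S)
    ⊆⇔⊇ closed .Equivalence.to   S⊆T x∈⋂T i i∈S = x∈⋂T i (S⊆T i∈S)
    ⊆⇔⊇ closed .Equivalence.from ⋂T⊆⋂S {i} i∈S  = closed i λ x∈⋂T → ⋂T⊆⋂S x∈⋂T i i∈S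
    ⊆⇔⊇ closed .Equivalence.to-cong   ≡.refl = ≡.refl
    ⊆⇔⊇ closed .Equivalence.from-cong ≡.refl = ≡.refl

    Positive Negative : Vector Carrier d → Pred (Fin n) 0ℓ
    Positive x i = 0# < normal i ∙ x
    Negative x i = normal i ∙ x < 0#

    -- Points of ℙᵈ⁻¹ have representatives only up to scaling, so their signs
    -- with respect to all hyperplanes matter only up to a simultaneous change.
    SameSigns OppositeSigns SameCell : Rel (Vector Carrier d) 0ℓ
    SameSigns     x y = ∀ i → Positive x i ⇔ Positive y i × Negative x i ⇔ Negative y i
    OppositeSigns x y = ∀ i → Positive x i ⇔ Negative y i × Negative x i ⇔ Positive y i
    SameCell      x y = SameSigns x y ⊎ OppositeSigns x y

    -- The intersection of all hyperplanes through x, which is the linear span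
    -- of the cell of x.
    support : Vector Carrier d → Pred (Vector Carrier d) 0ℓ
    support x y = ∀ i → H i x → H i y

    private
      same-sym : ∀ {x y} → SameCell x y → SameCell y x
      same-sym (inj₁ s) = inj₁ λ i → ⇔-sym (proj₁ (s i)) , ⇔-sym (proj₂ (s i))
      same-sym (inj₂ o) = inj₂ λ i → ⇔-sym (proj₂ (o i)) , ⇔-sym (proj₁ (o i))

      same-trans : ∀ {x y z} → SameCell x y → SameCell y z → SameCell x z
      same-trans (inj₁ s) (inj₁ t) = inj₁ λ i → proj₁ (t i) ⇔-∘ proj₁ (s i) , proj₂ (t i) ⇔-∘ proj₂ (s i)
      same-trans (inj₁ s) (inj₂ t) = inj₂ λ i → proj₁ (t i) ⇔-∘ proj₁ (s i) , proj₂ (t i) ⇔-∘ proj₂ (s i)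
      same-trans (inj₂ s) (inj₁ t) = inj₂ λ i → proj₂ (t i) ⇔-∘ proj₁ (s i) , proj₁ (t i) ⇔-∘ proj₂ (s i)
      same-trans (inj₂ s) (inj₂ t) = inj₁ λ i → proj₂ (t i) ⇔-∘ proj₁ (s i) , proj₁ (t i) ⇔-∘ proj₂ (s i)

    cellSetoid : Pred (Vector Carrier d) 0ℓ → Setoid 0ℓ 0ℓ
    cellSetoid P = record
      { Carrier       = Σ (Vector Carrier d) λ x → ¬ IsZero x × P x
      ; _≈_           = λ (x , _) (y , _) → SameCell x y
      ; isEquivalence = record
        { refl  = inj₁ λ _ → ⇔-id _ , ⇔-id _
        ; sym   = same-sym
        ; trans = same-trans
        }
      }

  -- ((9n + 18)h + 20 + 12n + 2r − 2n³ − 3n²) / 27.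
  estimate : (n h : ℤ) → Carrier → Carrier
  estimate n h r =
    (fromℤ ((+ 9 ℤ.* n ℤ.+ + 18) ℤ.* h ℤ.+ + 20 ℤ.+ + 12 ℤ.* n)
      + fromℤ (+ 2) * r
      - fromℤ (+ 2 ℤ.* n ℤ.^ 3)
      - fromℤ (+ 3 ℤ.* n ℤ.^ 2))
    * fromℤ (+ 27) ⁻¹

-- Excluded middle is what makes dimensions, the lattice and χ functions of 𝒜.
module Combinatorics (em : ExcludedMiddle 0ℓ) (ℝ : RealNumbers) where
  open RealNumbers ℝ using (Carrier)
  open Reals ℝ

  -- The largest m ≤ k such that P contains m linearly independent vectors.
  maxIndependent : ∀ {d} → ℕ → Pred (Vector Carrier d) 0ℓ → ℕ
  maxIndependent zero    P = 0
  maxIndependent (suc k) P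
    with em {∃ λ (v : Vector (Vector Carrier _) (suc k)) → (∀ i → P (v i)) × LinearlyIndependent v}
  ... | yes _ = suc k
  ... | no  _ = maxIndependent k P

  dim : ∀ {d} → Pred (Vector Carrier d) 0ℓ → ℕ
  dim {d} = maxIndependent d

  module _ {d n : ℕ} (A : Arrangement d n) where
    open Arrangement A

    -- k-dimensional cells in ℙᵈ⁻¹ span linear subspaces of dimension k + 1.
    HasCells : (k f : ℕ) → Set
    HasCells k f = Bijection (≡.setoid (Fin f)) (cellSetoid λ x → dim (support x) ≡ suc k)

    lattice : List (Subset n)
    lattice = filter (λ S → em {Closed S}) (subsets n)

    -- The Möbius function μ(ℝᵈ, X), by the recursion Σ_{Y ≤ X} μ(ℝᵈ, Y) = 0
    -- for X ≠ ℝᵈ.  As normal vectors are nonzero, ℝᵈ is the empty index set.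
    μ : Subset n → ℤ
    μ = All.wfRec ⊂-wellFounded 0ℓ (λ _ → ℤ) step
      where
      step : ∀ X → (∀ {Y} → Y ⊂ X → ℤ) → ℤ
      step X rec with nonempty? X
      ... | no  _ = 1ℤ
      ... | yes _ = ℤ.- foldr ℤ._+_ 0ℤ (map term lattice)
        where
        term : Subset n → ℤ
        term Y with Y ⊂? X
        ... | yes Y⊂X = rec Y⊂X
        ... | no  _   = 0ℤ

    χ : Poly
    χ = foldr _⊕_ [] (map (λ X → monomial (μ X) (dim (⋂ X))) lattice)

    linesOfWeight : ℕ → ℕ
    linesOfWeight i =
      length (filter (λ X → ∣ X ∣ ℕ.≟ i) (filter (λ X → dim (⋂ X) ℕ.≟ 2) lattice))

    codimTwo : List (Subset n)
    codimTwo = filter (λ X → dim (⋂ X) ℕ.+ 2 ℕ.≟ d) lattice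

    -- |𝒜ᴴ| for H = H i.
    restrictionSize : Fin n → ℕ
    restrictionSize i = length (filter (i ∈?_) codimTwo)

    -- Σ_{i ≥ 2} a i (h i), where the sum may stop at n + 1 because weights
    -- are at most n.
    sumOverLines : (ℕ → ℕ) → ℕ
    sumOverLines a = sum (applyUpTo (λ k → a (2 ℕ.+ k) ℕ.* linesOfWeight (2 ℕ.+ k)) n)

    h : ℕ
    h = sumOverLines (ℕ._∸ 1)

    g₁ : ℕ
    g₁ = sumOverLines (λ _ → 1)

    restrictionSum : ℕ
    restrictionSum = sum (map restrictionSize (allFin n))

{-# OPTIONS --safe #-}

-- For closed X the Möbius value μ(X) is the sum of (−1)^|S| over the S with closure X, so χ is
-- Whitney's alternating sum of (−1)^|S| t^(dim ⋂S) over all sets S of hyperplanes.  At t = −1 this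
-- sum and the number of realisable sign vectors obey the same deletion–restriction recursion,
-- hence χ(−1) = 2 f₃; χ(1) = 0 because the lattice has a top element; and the coefficients of
-- t⁴, t³ and t² are read off from μ on flats of codimension at most two, where μ(X) = |X| − 1 on
-- lines.  These five relations determine χ.
--
-- For the cubic factor t³ + a t² + b t + c, put D = a² − 3b = n² + n − 2 − 3h and
-- Q = 2a³ − 9ab + 27c, which is the numerator of (2) without its square root, minus 27 f₃.  The
-- bounds (2) and (3) together say Q² ≤ 4D³, i.e. that the discriminant is nonnegative.
-- A pair of nonreal roots makes it negative; conversely a real root exists by the intermediate
-- value theorem, and the remaining quadratic factor must have nonnegative discriminant E, of which
-- 4D³ − Q² is a square multiple.  The bound (1) is D ≥ 0.
--
-- The four coordinate hyperplanes have h = 6 and f₃ = 8, so D = Q = 0 and all bounds are attained.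
module Submission where

open import Defs
open import Axiom.ExcludedMiddle using (ExcludedMiddle)
open import Level using (0ℓ)


-- Deletion and restriction lead out of the class of arrangements: on a hyperplane, distinct normals
-- may become proportional or vanish. Hence both quantities in the recursion are formed for an
-- arbitrary finite family of vectors on a subspace `V` of a fixed ℝᵈ, and Whitney's sum runs over
-- index sets instead of flats, so that restriction merely replaces `V` by `V ∩ a ^⊥`. Dimension
-- being the maximal size of an independent family, the linear algebra reduces to one fact: an
-- equation that fails somewhere on `V` lowers the dimension by exactly one. The quantities D and Q
-- come from completing the cube: t = (u - a)/3 turns 27 (t³ + a t² + b t + c) into u³ - 3 D u + Q.
-- For D ≥ 0 the function u³ - 3 D u has the local extreme values ±2 √(D³), and the two bounds on f₃
-- say that -Q lies between them. The proof replaces this picture by polynomial identities that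
-- write the relevant differences as products of squares and nonnegative factors; analysis enters
-- only through suprema, for the intermediate value theorem and for floors.

-- Integer sums over all subsets, and their sign cancellations.

module SubsetSums (em : ExcludedMiddle 0ℓ) where
  open import Data.Bool.Base using (if_then_else_)
  open import Data.Fin.Base using (zero; suc)
  open import Data.Fin.Subset using (Subset; inside; outside; _⊆_; ∣_∣; Nonempty; ⊥)
  open import Data.Fin.Subset.Properties using (out⊆; s⊆s; drop-∷-⊆)
  open import Data.Integer.Base using (ℤ; +_; 0ℤ; 1ℤ; -1ℤ; _+_; _*_; _^_)
  import Data.Integer.Properties as ℤ
  open import Data.Integer.Tactic.RingSolver using (solve-∀)
  open import Data.List.Base using (List; []; _∷_; _++_; map; filter; foldr)
  open import Data.List.Properties using (map-∘)
  open import Data.Nat.Base using (zero; suc)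
  open import Data.Product using (_,_)
  open import Data.Vec.Base using ([]; _∷_; here; there)
  open import Data.Vec.Properties using (∷-injectiveʳ)
  open import Function.Base using (_∘_)
  open import Relation.Binary.PropositionalEquality
    using (_≡_; refl; cong; cong₂; sym; trans; module ≡-Reasoning)
  open import Relation.Nullary using (¬_; Dec; does; yes; no; contradiction)
  open import Relation.Unary using (Decidable)
  open ≡-Reasoning

  𝟙 : ∀ {P : Set} → Dec P → ℤ
  𝟙 d = if does d then 1ℤ else 0ℤ

  ind : Set → ℤ
  ind P = 𝟙 (em {P})

  ind-yes : ∀ {P} → P → ind P ≡ 1ℤ
  ind-yes {P} p with em {P}
  ... | yes _ = refl
  ... | no ¬p = contradiction p ¬p

  ind-no : ∀ {P} → ¬ P → ind P ≡ 0ℤ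
  ind-no {P} ¬p with em {P}
  ... | yes p = contradiction p ¬p
  ... | no  _ = refl

  ind-cong : ∀ {P Q} → (P → Q) → (Q → P) → ind P ≡ ind Q
  ind-cong {P} {Q} f g with em {P}
  ... | yes p = sym (ind-yes (f p))
  ... | no ¬p = sym (ind-no (¬p ∘ g))

  𝟙≡ind : ∀ {P} (d : Dec P) → 𝟙 d ≡ ind P
  𝟙≡ind (yes p) = sym (ind-yes p)
  𝟙≡ind (no ¬p) = sym (ind-no ¬p)

  -- The equation may use `P`, since where `P` fails the factor kills both sides; this lets facts
  -- about flats be applied under a sum over all index sets.
  ind-*-cong : ∀ P {x y} → (P → x ≡ y) → ind P * x ≡ ind P * y
  ind-*-cong P f with em {P}
  ... | yes p = cong (1ℤ *_) (f p)
  ... | no  _ = refl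

  ind-*-yes : ∀ {P} x → P → ind P * x ≡ x
  ind-*-yes x p = trans (cong (_* x) (ind-yes p)) (ℤ.*-identityˡ x)

  ind-*-no : ∀ {P} x → ¬ P → ind P * x ≡ 0ℤ
  ind-*-no x ¬p = cong (_* x) (ind-no ¬p)

  -- Recursion on the ground set, rather than a fold over the list `subsets n`, turns the identities
  -- below into inductions that split on whether the first index belongs.
  Σₛ : ∀ {n} → (Subset n → ℤ) → ℤ
  Σₛ {zero}  f = f []
  Σₛ {suc n} f = Σₛ (f ∘ (inside ∷_)) + Σₛ (f ∘ (outside ∷_))

  Σₗ : ∀ {A : Set} → (A → ℤ) → List A → ℤ
  Σₗ f xs = foldr _+_ 0ℤ (map f xs)

  Σₗ-++ : ∀ {A : Set} (f : A → ℤ) xs ys → Σₗ f (xs ++ ys) ≡ Σₗ f xs + Σₗ f ys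
  Σₗ-++ f []       ys = sym (ℤ.+-identityˡ _)
  Σₗ-++ f (x ∷ xs) ys = trans (cong (_+_ (f x)) (Σₗ-++ f xs ys)) (sym (ℤ.+-assoc (f x) _ _))

  Σₗ-cong : ∀ {A : Set} {f g : A → ℤ} → (∀ x → f x ≡ g x) → ∀ xs → Σₗ f xs ≡ Σₗ g xs
  Σₗ-cong f≗g []       = refl
  Σₗ-cong f≗g (x ∷ xs) = cong₂ _+_ (f≗g x) (Σₗ-cong f≗g xs)

  Σₗ-filter : ∀ {A : Set} {P : A → Set} (P? : Decidable P) (f : A → ℤ) xs →
              Σₗ f (filter P? xs) ≡ Σₗ (λ x → ind (P x) * f x) xs
  Σₗ-filter P? f [] = refl
  Σₗ-filter P? f (x ∷ xs) with P? x
  ... | yes p = cong₂ _+_ (sym (ind-*-yes (f x) p)) (Σₗ-filter P? f xs)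
  ... | no ¬p = trans (Σₗ-filter P? f xs) (sym (trans (cong (_+ _) (ind-*-no (f x) ¬p)) (ℤ.+-identityˡ _)))

  Σₗ-subsets : ∀ {n} (f : Subset n → ℤ) → Σₗ f (subsets n) ≡ Σₛ f
  Σₗ-subsets {zero}  f = ℤ.+-identityʳ _
  Σₗ-subsets {suc n} f = begin
    Σₗ f (map (inside ∷_) (subsets n) ++ map (outside ∷_) (subsets n))
        ≡⟨ Σₗ-++ f (map (inside ∷_) (subsets n)) _ ⟩
    Σₗ f (map (inside ∷_) (subsets n)) + Σₗ f (map (outside ∷_) (subsets n))
        ≡⟨ cong₂ _+_ (half inside) (half outside) ⟩
    Σₛ f ∎
    where
    half : ∀ s → Σₗ f (map (s ∷_) (subsets n)) ≡ Σₛ (f ∘ (s ∷_))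
    half s = trans (cong (foldr _+_ 0ℤ) (sym (map-∘ (subsets n)))) (Σₗ-subsets (f ∘ (s ∷_)))

  Σₛ-cong : ∀ {n} {f g : Subset n → ℤ} → (∀ S → f S ≡ g S) → Σₛ f ≡ Σₛ g
  Σₛ-cong {zero}  e = e []
  Σₛ-cong {suc n} e = cong₂ _+_ (Σₛ-cong (e ∘ (inside ∷_))) (Σₛ-cong (e ∘ (outside ∷_)))

  Σₛ-0 : ∀ {n} {f : Subset n → ℤ} → (∀ S → f S ≡ 0ℤ) → Σₛ f ≡ 0ℤ
  Σₛ-0 {zero}  e = e []
  Σₛ-0 {suc n} e = cong₂ _+_ (Σₛ-0 (e ∘ (inside ∷_))) (Σₛ-0 (e ∘ (outside ∷_)))

  interchange : ∀ a b c d → a + b + (c + d) ≡ a + c + (b + d)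
  interchange = solve-∀

  Σₛ-+ : ∀ {n} (f g : Subset n → ℤ) → Σₛ (λ S → f S + g S) ≡ Σₛ f + Σₛ g
  Σₛ-+ {zero}  f g = refl
  Σₛ-+ {suc n} f g = trans
    (cong₂ _+_ (Σₛ-+ (f ∘ (inside ∷_)) (g ∘ (inside ∷_))) (Σₛ-+ (f ∘ (outside ∷_)) (g ∘ (outside ∷_))))
    (interchange (Σₛ (f ∘ (inside ∷_))) _ _ _)

  Σₛ-* : ∀ {n} c (f : Subset n → ℤ) → Σₛ (λ S → c * f S) ≡ c * Σₛ f
  Σₛ-* {zero}  c f = refl
  Σₛ-* {suc n} c f = trans
    (cong₂ _+_ (Σₛ-* c (f ∘ (inside ∷_))) (Σₛ-* c (f ∘ (outside ∷_))))
    (sym (ℤ.*-distribˡ-+ c _ _))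

  Σₛ-comm : ∀ {m n} (f : Subset m → Subset n → ℤ) → Σₛ (λ S → Σₛ (f S)) ≡ Σₛ (λ T → Σₛ (λ S → f S T))
  Σₛ-comm {zero}  f = refl
  Σₛ-comm {suc m} f = trans
    (cong₂ _+_ (Σₛ-comm (f ∘ (inside ∷_))) (Σₛ-comm (f ∘ (outside ∷_))))
    (sym (Σₛ-+ (λ T → Σₛ (λ S → f (inside ∷ S) T)) _))

  Σₛ-≡ : ∀ {n} T (f : Subset n → ℤ) → Σₛ (λ S → ind (T ≡ S) * f S) ≡ f T
  Σₛ-≡ [] f = ind-*-yes (f []) refl
  Σₛ-≡ (inside ∷ T) f = trans
    (cong₂ _+_
      (trans (Σₛ-cong λ S → cong (_* f (inside ∷ S)) (ind-cong ∷-injectiveʳ (cong (inside ∷_))))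
          (Σₛ-≡ T (f ∘ (inside ∷_))))
      (Σₛ-0 λ S → ind-*-no (f (outside ∷ S)) λ ()))
    (ℤ.+-identityʳ _)
  Σₛ-≡ (outside ∷ T) f = trans
    (cong₂ _+_
      (Σₛ-0 λ S → ind-*-no (f (inside ∷ S)) λ ())
      (trans (Σₛ-cong λ S → cong (_* f (outside ∷ S)) (ind-cong ∷-injectiveʳ (cong (outside ∷_))))
          (Σₛ-≡ T (f ∘ (outside ∷_)))))
    (ℤ.+-identityˡ _)

  Σ⊆-inside : ∀ {n} X (f : Subset (suc n) → ℤ) →
    Σₛ (λ S → ind (S ⊆ inside ∷ X) * f S) ≡
    Σₛ (λ S → ind (S ⊆ X) * f (inside ∷ S)) + Σₛ (λ S → ind (S ⊆ X) * f (outside ∷ S))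
  Σ⊆-inside X f = cong₂ _+_
    (Σₛ-cong λ S → cong (_* f (inside ∷ S)) (ind-cong drop-∷-⊆ s⊆s))
    (Σₛ-cong λ S → cong (_* f (outside ∷ S)) (ind-cong drop-∷-⊆ out⊆))

  Σ⊆-outside : ∀ {n} X (f : Subset (suc n) → ℤ) →
    Σₛ (λ S → ind (S ⊆ outside ∷ X) * f S) ≡ Σₛ (λ S → ind (S ⊆ X) * f (outside ∷ S))
  Σ⊆-outside X f = trans
    (cong₂ _+_
      (Σₛ-0 λ S → ind-*-no {P = inside ∷ S ⊆ outside ∷ X} (f (inside ∷ S)) λ S⊆X → contradiction
          (S⊆X here) λ ())
      (Σₛ-cong λ S → cong (_* f (outside ∷ S)) (ind-cong drop-∷-⊆ out⊆)))
    (ℤ.+-identityˡ _)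

  sgn : ∀ {n} → Subset n → ℤ
  sgn S = -1ℤ ^ ∣ S ∣

  -- Toggling the first element of `X` pairs off the subsets of `X` with opposite signs.
  Σ⊆-sgn-nonempty : ∀ {n} {X : Subset n} → Nonempty X → Σₛ (λ S → ind (S ⊆ X) * sgn S) ≡ 0ℤ
  Σ⊆-sgn-nonempty {X = inside ∷ X} _ = begin
    Σₛ (λ S → ind (S ⊆ inside ∷ X) * sgn S)
      ≡⟨ Σ⊆-inside X sgn ⟩
    Σₛ (λ S → ind (S ⊆ X) * (-1ℤ * sgn S)) + s
      ≡⟨ cong (_+ s) (trans (Σₛ-cong λ S → swap (ind (S ⊆ X)) (sgn S))
          (Σₛ-* -1ℤ (λ S → ind (S ⊆ X) * sgn S))) ⟩
    -1ℤ * s + s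
      ≡⟨ cancel s ⟩
    0ℤ ∎
    where
    s = Σₛ (λ S → ind (S ⊆ X) * sgn S)
    swap : ∀ a b → a * (-1ℤ * b) ≡ -1ℤ * (a * b)
    swap = solve-∀
    cancel : ∀ a → -1ℤ * a + a ≡ 0ℤ
    cancel = solve-∀
  Σ⊆-sgn-nonempty {X = outside ∷ X} (suc i , there i∈X) = trans (Σ⊆-outside X sgn) (Σ⊆-sgn-nonempty (i , i∈X))

  Σ⊆⊥ : ∀ {n} (f : Subset n → ℤ) → Σₛ (λ S → ind (S ⊆ ⊥) * f S) ≡ f ⊥
  Σ⊆⊥ {zero}  f = ind-*-yes (f []) (λ ())
  Σ⊆⊥ {suc n} f = trans (Σ⊆-outside ⊥ f) (Σ⊆⊥ (f ∘ (outside ∷_)))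

-- Counting lines by weight and by incidence.

module Weights where
  open import Data.Fin.Base using (Fin; zero; suc)
  open import Data.Fin.Subset using (Subset; inside; outside; ∣_∣)
  open import Data.Fin.Subset.Properties using (_∈?_)
  open import Data.List.Base using (List; []; _∷_; map; filter; length; applyUpTo; allFin; tabulate)
  open import Data.List.Properties using (map-tabulate; tabulate-cong)
  open import Data.List.Relation.Unary.All using (All; []; _∷_)
  open import Data.Nat.Base using (ℕ; zero; suc; _+_; _*_; _∸_; _≤_; _<_; s≤s; z≤n)
  open import Data.Nat.ListAction using (sum)
  open import Data.Nat.Properties
  open import Data.Nat.Tactic.RingSolver using (solve-∀)
  open import Data.Bool.Base using (if_then_else_)
  open import Data.Product using (_×_; _,_)
  open import Data.Vec.Base using ([]; _∷_)
  open import Function.Base using (_∘_; id)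
  open import Relation.Binary.PropositionalEquality
    using (_≡_; refl; cong; cong₂; sym; trans; module ≡-Reasoning)
  open import Relation.Nullary using (Dec; does; yes; no)
  open import Relation.Unary using (Decidable)
  open ≡-Reasoning

  private variable
    A : Set
    n : ℕ

  interchange : ∀ a b c d → a + b + (c + d) ≡ a + c + (b + d)
  interchange = solve-∀

  [_] : {P : Set} → Dec P → ℕ
  [ d ] = if does d then 1 else 0

  length-filter-∷ : {P : A → Set} (P? : Decidable P) → ∀ x xs → length (filter P? (x ∷ xs)) ≡ [ P? x ] +
      length (filter P? xs)
  length-filter-∷ P? x xs with P? x
  ... | yes _ = refl
  ... | no  _ = refl

  sum-applyUpTo-+ : ∀ (f g : ℕ → ℕ) n → sum (applyUpTo (λ k → f k + g k) n) ≡ sum (applyUpTo f n) + sum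
      (applyUpTo g n)
  sum-applyUpTo-+ f g zero    = refl
  sum-applyUpTo-+ f g (suc n) = trans (cong (f 0 + g 0 +_) (sum-applyUpTo-+ (f ∘ suc) (g ∘ suc) n))
      (interchange (f 0) (g 0) _ _)

  sum-applyUpTo-cong : ∀ {f g : ℕ → ℕ} → (∀ k → f k ≡ g k) → ∀ n → sum (applyUpTo f n) ≡ sum (applyUpTo g n)
  sum-applyUpTo-cong e zero    = refl
  sum-applyUpTo-cong e (suc n) = cong₂ _+_ (e 0) (sum-applyUpTo-cong (e ∘ suc) n)

  sum-applyUpTo-0 : ∀ {f : ℕ → ℕ} → (∀ k → f k ≡ 0) → ∀ n → sum (applyUpTo f n) ≡ 0
  sum-applyUpTo-0 e zero    = refl
  sum-applyUpTo-0 e (suc n) = cong₂ _+_ (e 0) (sum-applyUpTo-0 (e ∘ suc) n)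

  sum-applyUpTo-≟ : ∀ (a : ℕ → ℕ) {j n} → j < n → sum (applyUpTo (λ k → a k * [ j ≟ k ]) n) ≡ a j
  sum-applyUpTo-≟ a {zero} {suc n} _ = trans
    (cong₂ _+_ (*-identityʳ (a 0)) (sum-applyUpTo-0 (λ k → *-zeroʳ (a (suc k))) n)) (+-identityʳ _)
  sum-applyUpTo-≟ a {suc j} {suc n} (s≤s j<n) = trans
    (cong (_+ sum (applyUpTo (λ k → a (suc k) * [ j ≟ k ]) n)) (*-zeroʳ (a 0)))
        (sum-applyUpTo-≟ (a ∘ suc) j<n)

  -- Each element of the list falls into exactly one weight class, and the bounds on `w` place that
  -- class within the truncated range of summation.
  sum-by-weight : ∀ (w : A → ℕ) (a : ℕ → ℕ) xs → All (λ x → 2 ≤ w x × w x < 2 + n) xs →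
    sum (applyUpTo (λ k → a (2 + k) * length (filter (λ x → w x ≟ 2 + k) xs)) n) ≡ sum (map (a ∘ w) xs)
  sum-by-weight {n = n} w a [] [] = sum-applyUpTo-0 (λ k → *-zeroʳ (a (2 + k))) n
  sum-by-weight {n = n} w a (x ∷ xs) ((2≤w , w<) ∷ bounds) = begin
    sum (applyUpTo (λ k → a (2 + k) * length (filter (λ y → w y ≟ 2 + k) (x ∷ xs))) n)
      ≡⟨ sum-applyUpTo-cong (λ k → trans (cong (a (2 + k) *_)
          (length-filter-∷ (λ y → w y ≟ 2 + k) x xs)) (*-distribˡ-+ (a (2 + k)) _ _)) n ⟩
    sum (applyUpTo (λ k → a (2 + k) * [ w x ≟ 2 + k ] + a (2 + k) * length (filter (λ y → w y ≟ 2 + k) xs)) n)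
      ≡⟨ sum-applyUpTo-+ (λ k → a (2 + k) * [ w x ≟ 2 + k ]) _ n ⟩
    sum (applyUpTo (λ k → a (2 + k) * [ w x ≟ 2 + k ]) n) + sum
        (applyUpTo (λ k → a (2 + k) * length (filter (λ y → w y ≟ 2 + k) xs)) n)
      ≡⟨ cong₂ _+_ (head (w x) 2≤w w<) (sum-by-weight w a xs bounds) ⟩
    a (w x) + sum (map (a ∘ w) xs) ∎
    where
    head : ∀ v → 2 ≤ v → v < 2 + n → sum (applyUpTo (λ k → a (2 + k) * [ v ≟ 2 + k ]) n) ≡ a v
    head (suc zero) (s≤s ()) _
    head (suc (suc v)) _ (s≤s (s≤s v<n)) = sum-applyUpTo-≟ (a ∘ (2 +_)) v<n

  sum-tabulate-+ : ∀ (f g : Fin n → ℕ) → sum (tabulate (λ i → f i + g i)) ≡ sum (tabulate f) + sum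
      (tabulate g)
  sum-tabulate-+ {zero}  f g = refl
  sum-tabulate-+ {suc n} f g = trans (cong (f zero + g zero +_) (sum-tabulate-+ (f ∘ suc) (g ∘ suc)))
      (interchange (f zero) (g zero) _ _)

  sum-tabulate-0 : ∀ n → sum (tabulate {n = n} (λ _ → 0)) ≡ 0
  sum-tabulate-0 zero    = refl
  sum-tabulate-0 (suc n) = sum-tabulate-0 n

  sum-∈? : ∀ (X : Subset n) → sum (tabulate (λ i → [ i ∈? X ])) ≡ ∣ X ∣
  sum-∈? []            = refl
  sum-∈? (inside  ∷ X) = cong suc (trans (cong sum (tabulate-cong λ i → step i)) (sum-∈? X))
    where
    step : ∀ i → [ suc i ∈? inside ∷ X ] ≡ [ i ∈? X ]
    step i with i ∈? X
    ... | yes _ = refl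
    ... | no  _ = refl
  sum-∈? (outside ∷ X) = trans (cong sum (tabulate-cong λ i → step i)) (sum-∈? X)
    where
    step : ∀ i → [ suc i ∈? outside ∷ X ] ≡ [ i ∈? X ]
    step i with i ∈? X
    ... | yes _ = refl
    ... | no  _ = refl

  -- Double counting of the pairs of an index and a listed set containing it. For the list of lines
  -- it turns the restriction sizes into a sum of weights.
  sum-incidences : ∀ (xs : List (Subset n)) → sum (map (λ i → length (filter (i ∈?_) xs)) (allFin n)) ≡
      sum (map ∣_∣ xs)
  sum-incidences {n} [] = trans (cong sum (map-tabulate {n = n} id (λ i → 0))) (sum-tabulate-0 n)
  sum-incidences {n} (X ∷ xs) = begin
    sum (map (λ i → length (filter (i ∈?_) (X ∷ xs))) (allFin n))
      ≡⟨ cong sum (trans (map-tabulate id _) (tabulate-cong λ i → length-filter-∷ (i ∈?_) X xs)) ⟩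
    sum (tabulate (λ i → [ i ∈? X ] + length (filter (i ∈?_) xs)))
      ≡⟨ sum-tabulate-+ (λ i → [ i ∈? X ]) (λ i → length (filter (i ∈?_) xs)) ⟩
    sum (tabulate (λ i → [ i ∈? X ])) + sum (tabulate (λ i → length (filter (i ∈?_) xs)))
      ≡⟨ cong₂ _+_ (sum-∈? X) (trans (cong sum (sym (map-tabulate {n = n} id
          (λ i → length (filter (i ∈?_) xs))))) (sum-incidences xs)) ⟩
    ∣ X ∣ + sum (map ∣_∣ xs) ∎

  -- Weights are at least 2, so the truncated subtraction is exact. For lines the two summands
  -- become `h` and `g₁`.
  sum-pred : ∀ (w : A → ℕ) xs → All (λ x → 2 ≤ w x × w x < 2 + n) xs →
             sum (map ((_∸ 1) ∘ w) xs) + sum (map (λ _ → 1) xs) ≡ sum (map w xs)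
  sum-pred w [] [] = refl
  sum-pred w (x ∷ xs) ((2≤w , _) ∷ bounds) = trans
    (interchange (w x ∸ 1) (sum (map ((_∸ 1) ∘ w) xs)) 1 _)
    (cong₂ _+_ (m∸n+n≡m (≤-trans (s≤s z≤n) 2≤w)) (sum-pred w xs bounds))

-- Ordered field arithmetic and the embedding of the integers.

module OrderedField (em : ExcludedMiddle 0ℓ) (ℝ : RealNumbers) where
  open import Data.Integer.Base as ℤ using (ℤ; +_; -[1+_]; 1ℤ)
  import Data.Integer.Properties as ℤ
  open import Data.Nat.Base as ℕ using (ℕ; zero; suc)
  import Data.Nat.Properties as ℕ
  open import Data.Product using (_,_; proj₁)
  open import Data.Sum using (_⊎_; inj₁; inj₂)
  open import Data.Maybe as Maybe using (Maybe)
  open import Algebra.Bundles using (CommutativeRing)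
  import Relation.Binary.PropositionalEquality as ≡
  open import Relation.Nullary using (¬_; Dec; yes; no; contradiction)
  open import Relation.Nullary.Decidable using (dec⇒maybe)
  open import Relation.Binary.Structures using (IsTotalOrder)
  import Algebra.Solver.Ring as RingSolver
  open import Algebra.Solver.Ring.AlmostCommutativeRing
    using (fromCommutativeRing; _-Raw-AlmostCommutative⟶_)
  open RealNumbers ℝ
  open Reals ℝ
  open import Algebra.Properties.Ring ring
  open import Algebra.Properties.Semiring.Mult semiring using (×1-homo-*; ×-homo-+)
  open import Relation.Binary.Reasoning.Setoid setoid
  open IsTotalOrder isTotalOrder public
    using () renaming ( refl to ≤-refl; trans to ≤-trans; antisym to ≤-antisym; total to ≤-total ;
      reflexive to ≤-reflexive; ≤-respʳ-≈ to ≤-respʳ; ≤-respˡ-≈ to ≤-respˡ)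

  fromℤ-⊖ : ∀ m n → fromℤ (m ℤ.⊖ n) ≈ m times 1# - n times 1#
  fromℤ-⊖ m zero = sym (trans (+-congˡ -0#≈0#) (+-identityʳ _))
  fromℤ-⊖ zero (suc n) = sym (+-identityˡ _)
  fromℤ-⊖ (suc m) (suc n) = begin
    fromℤ (suc m ℤ.⊖ suc n)                   ≡⟨ ≡.cong fromℤ (ℤ.[1+m]⊖[1+n]≡m⊖n m n) ⟩
    fromℤ (m ℤ.⊖ n)                           ≈⟨ fromℤ-⊖ m n ⟩
    a - b                                     ≈⟨ +-congʳ (sym (+-identityˡ a)) ⟩
    0# + a - b                                ≈⟨ +-congʳ (+-congʳ (sym (-‿inverseʳ 1#))) ⟩
    1# - 1# + a - b                           ≈⟨ +-congʳ
        (trans (+-assoc _ _ _) (trans (+-congˡ (+-comm _ _)) (sym (+-assoc _ _ _)))) ⟩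
    1# + a + - 1# - b                         ≈⟨ +-assoc _ _ _ ⟩
    1# + a + (- 1# - b)                       ≈⟨ +-congˡ (-‿+-comm 1# b) ⟩
    suc m times 1# - suc n times 1#           ∎
    where
    a = m times 1#
    b = n times 1#

  fromℤ-neg : ∀ i → fromℤ (ℤ.- i) ≈ - fromℤ i
  fromℤ-neg (+ zero)  = sym -0#≈0#
  fromℤ-neg (+ suc n) = refl
  fromℤ-neg -[1+ n ]  = sym (-‿involutive _)

  fromℤ-+ : ∀ i j → fromℤ (i ℤ.+ j) ≈ fromℤ i + fromℤ j
  fromℤ-+ (+ m)    (+ n)    = ×-homo-+ 1# m n
  fromℤ-+ (+ m)    -[1+ n ] = fromℤ-⊖ m (suc n)
  fromℤ-+ -[1+ m ] (+ n)    = trans (fromℤ-⊖ n (suc m)) (+-comm _ _)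
  fromℤ-+ -[1+ m ] -[1+ n ] = begin
    - (suc (suc (m ℕ.+ n)) times 1#)        ≡⟨ ≡.cong (λ k → - (k times 1#)) (≡.sym (ℕ.+-suc (suc m) n)) ⟩
    - ((suc m ℕ.+ suc n) times 1#)          ≈⟨ -‿cong (×-homo-+ 1# (suc m) (suc n)) ⟩
    - (suc m times 1# + suc n times 1#)     ≈⟨ -‿+-comm _ _ ⟨
    - (suc m times 1#) - suc n times 1#     ∎

  fromℤ-pos* : ∀ m j → fromℤ (+ m ℤ.* j) ≈ fromℤ (+ m) * fromℤ j
  fromℤ-pos* m (+ n) = trans (reflexive (≡.cong fromℤ (≡.sym (ℤ.pos-* m n)))) (×1-homo-* m n)
  fromℤ-pos* m -[1+ n ] = begin
    fromℤ (+ m ℤ.* -[1+ n ])            ≡⟨ ≡.cong fromℤ (ℤ.neg-distribʳ-* (+ m) (+ suc n)) ⟨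
    fromℤ (ℤ.- (+ m ℤ.* + suc n))       ≈⟨ fromℤ-neg (+ m ℤ.* + suc n) ⟩
    - fromℤ (+ m ℤ.* + suc n)           ≈⟨ -‿cong (fromℤ-pos* m (+ suc n)) ⟩
    - (fromℤ (+ m) * fromℤ (+ suc n))   ≈⟨ -‿distribʳ-* _ _ ⟩
    fromℤ (+ m) * fromℤ -[1+ n ]        ∎

  fromℤ-* : ∀ i j → fromℤ (i ℤ.* j) ≈ fromℤ i * fromℤ j
  fromℤ-* (+ m) j = fromℤ-pos* m j
  fromℤ-* -[1+ m ] j = begin
    fromℤ (-[1+ m ] ℤ.* j)              ≡⟨ ≡.cong fromℤ (ℤ.neg-distribˡ-* (+ suc m) j) ⟨
    fromℤ (ℤ.- (+ suc m ℤ.* j))         ≈⟨ fromℤ-neg (+ suc m ℤ.* j) ⟩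
    - fromℤ (+ suc m ℤ.* j)             ≈⟨ -‿cong (fromℤ-pos* (suc m) j) ⟩
    - (fromℤ (+ suc m) * fromℤ j)       ≈⟨ -‿distribˡ-* _ _ ⟩
    fromℤ -[1+ m ] * fromℤ j            ∎

  -- Gives the ring solver integer coefficients, so that the numerals in the cubic identities are
  -- computed in ℤ, where equality is decidable, and not in the field.
  fromℤ-homomorphism : CommutativeRing.rawRing ℤ.+-*-commutativeRing -Raw-AlmostCommutative⟶
      fromCommutativeRing commutativeRing
  fromℤ-homomorphism = record
    { ⟦_⟧    = fromℤ
    ; +-homo = fromℤ-+
    ; *-homo = fromℤ-*
    ; -‿homo = fromℤ-neg
    ; 0-homo = refl
    ; 1-homo = +-identityʳ 1#
    }

  fromℤ-≟ : ∀ i j → Maybe (fromℤ i ≈ fromℤ j)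
  fromℤ-≟ i j = Maybe.map (λ i≡j → reflexive (≡.cong fromℤ i≡j)) (dec⇒maybe (i ℤ.≟ j))

  module Solver = RingSolver (CommutativeRing.rawRing ℤ.+-*-commutativeRing) (fromCommutativeRing commutativeRing)
    fromℤ-homomorphism fromℤ-≟
  open Solver using (solve; _:=_; _:+_; _:*_; _:-_; :-_; con)

  fromℤ-1 : fromℤ 1ℤ ≈ 1#
  fromℤ-1 = +-identityʳ 1#

  _≟0 : ∀ x → Dec (x ≈ 0#)
  x ≟0 = em

  0≤⇒≤ : ∀ {x y} → 0# ≤ y - x → x ≤ y
  0≤⇒≤ {x} {y} p = ≤-respˡ (+-identityˡ x) (≤-respʳ (solve 2 (λ x y → y :- x :+ x := y) refl x y)
      (+-monoˡ-≤ x p))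

  ≤⇒0≤ : ∀ {x y} → x ≤ y → 0# ≤ y - x
  ≤⇒0≤ {x} {y} p = ≤-respˡ (-‿inverseʳ x) (+-monoˡ-≤ (- x) p)

  -- The usual form of a polynomial inequality below: the difference is exhibited as a visibly
  -- nonnegative `e`, and the equation is left to the ring solver.
  ≤-by : ∀ {x y e} → 0# ≤ e → e ≈ y - x → x ≤ y
  ≤-by p eq = 0≤⇒≤ (≤-respʳ eq p)

  +-nonneg : ∀ {x y} → 0# ≤ x → 0# ≤ y → 0# ≤ x + y
  +-nonneg {x} {y} p q = ≤-trans q (≤-respˡ (+-identityˡ y) (+-monoˡ-≤ y p))

  neg-nonneg : ∀ {x} → x ≤ 0# → 0# ≤ - x
  neg-nonneg {x} p = ≤-respʳ (+-identityˡ _) (≤⇒0≤ p)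

  sq-nonneg : ∀ x → 0# ≤ x * x
  sq-nonneg x with ≤-total 0# x
  ... | inj₁ p = *-nonneg p p
  ... | inj₂ p = ≤-respʳ (solve 1 (λ x → (:- x) :* (:- x) := x :* x) refl x)
        (*-nonneg (neg-nonneg p) (neg-nonneg p))

  ≰⇒> : ∀ {x y} → ¬ (x ≤ y) → y < x
  ≰⇒> {x} {y} ¬p with ≤-total x y
  ... | inj₁ p = contradiction p ¬p
  ... | inj₂ p = p , λ y≈x → ¬p (≤-reflexive (sym y≈x))

  <⇒≱ : ∀ {x y} → x < y → ¬ (y ≤ x)
  <⇒≱ (p , x≉y) q = x≉y (≤-antisym p q)

  <-≤-trans : ∀ {x y z} → x < y → y ≤ z → x < z
  <-≤-trans (p , x≉y) q = ≤-trans p q , λ x≈z → x≉y (≤-antisym p (≤-respʳ (sym x≈z) q))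

  ≤-<-trans : ∀ {x y z} → x ≤ y → y < z → x < z
  ≤-<-trans p (q , y≉z) = ≤-trans p q , λ x≈z → y≉z (≤-antisym q (≤-respˡ x≈z p))

  <-resp : ∀ {x y x′ y′} → x ≈ x′ → y ≈ y′ → x < y → x′ < y′
  <-resp p q (x≤y , x≉y) = ≤-respˡ p (≤-respʳ q x≤y) , λ e → x≉y (trans p (trans e (sym q)))

  trichotomy : ∀ x → x < 0# ⊎ x ≈ 0# ⊎ 0# < x
  trichotomy x with x ≟0 | ≤-total x 0#
  ... | yes x≈0 | _      = inj₂ (inj₁ x≈0)
  ... | no  x≉0 | inj₁ p = inj₁ (p , x≉0)
  ... | no  x≉0 | inj₂ p = inj₂ (inj₂ (p , λ 0≈x → x≉0 (sym 0≈x)))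

  0<⇒< : ∀ {x y} → 0# < y - x → x < y
  0<⇒< {x} {y} (p , ≉) = 0≤⇒≤ p , λ x≈y → ≉ (sym (trans (+-congʳ (sym x≈y)) (-‿inverseʳ x)))

  <⇒0< : ∀ {x y} → x < y → 0# < y - x
  <⇒0< {x} {y} (p , ≉) = ≤⇒0≤ p , λ 0≈y-x → ≉ (sym (begin
    y          ≈⟨ solve 2 (λ x y → y := y :- x :+ x) refl x y ⟩
    y - x + x  ≈⟨ +-congʳ 0≈y-x ⟨
    0# + x     ≈⟨ +-identityˡ x ⟩
    x          ∎))

  <-by : ∀ {x y e} → 0# < e → e ≈ y - x → x < y
  <-by p eq = 0<⇒< (<-resp refl eq p)

  +-pos-nonneg : ∀ {x y} → 0# < x → 0# ≤ y → 0# < x + y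
  +-pos-nonneg {x} {y} p q = <-≤-trans p (≤-respˡ (+-identityʳ x)
      (≤-respˡ (+-comm 0# x) (≤-respʳ (+-comm y x) (+-monoˡ-≤ x q))))

  +-pos : ∀ {x y} → 0# < x → 0# < y → 0# < x + y
  +-pos p q = +-pos-nonneg p (proj₁ q)

  *-cancel-0 : ∀ {x y} → x ≉ 0# → x * y ≈ 0# → y ≈ 0#
  *-cancel-0 {x} {y} x≉0 xy≈0 = begin
    y                ≈⟨ *-identityˡ y ⟨
    1# * y           ≈⟨ *-congʳ (⁻¹-inverse x≉0) ⟨
    x * x ⁻¹ * y     ≈⟨ solve 3 (λ x i y → x :* i :* y := i :* (x :* y)) refl x (x ⁻¹) y ⟩
    x ⁻¹ * (x * y)   ≈⟨ *-congˡ xy≈0 ⟩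
    x ⁻¹ * 0#        ≈⟨ zeroʳ _ ⟩
    0#               ∎

  *-pos : ∀ {x y} → 0# < x → 0# < y → 0# < x * y
  *-pos (p , x≉) (q , y≉) = *-nonneg p q , λ e → y≉ (sym (*-cancel-0 (λ x≈ → x≉ (sym x≈)) (sym e)))

  sq-pos : ∀ {x} → x ≉ 0# → 0# < x * x
  sq-pos x≉ = sq-nonneg _ , λ e → x≉ (*-cancel-0 x≉ (sym e))

  0<1 : 0# < 1#
  0<1 = <-resp refl (*-identityˡ 1#) (sq-pos 1≉0)

  pos⇒≉ : ∀ {x} → 0# < x → x ≉ 0#
  pos⇒≉ (_ , ≉) e = ≉ (sym e)

  -- The inverse equals `x` times the square of the inverse, a product of positive factors.
  pos-inverse : ∀ {x} → 0# < x → 0# < x ⁻¹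
  pos-inverse {x} 0<x = <-resp refl (begin
    x * (x ⁻¹ * x ⁻¹)  ≈⟨ *-assoc _ _ _ ⟨
    x * x ⁻¹ * x ⁻¹    ≈⟨ *-congʳ inv ⟩
    1# * x ⁻¹          ≈⟨ *-identityˡ _ ⟩
    x ⁻¹               ∎) (*-pos 0<x (sq-pos λ e → 1≉0 (trans (sym inv) (trans (*-congˡ e) (zeroʳ x)))))
    where inv = ⁻¹-inverse (pos⇒≉ 0<x)

  nonneg-cancel : ∀ {x y} → 0# < x → 0# ≤ x * y → 0# ≤ y
  nonneg-cancel {x} {y} 0<x p = ≤-respʳ (begin
    x ⁻¹ * (x * y)  ≈⟨ solve 3 (λ x i y → i :* (x :* y) := (x :* i) :* y) refl x (x ⁻¹) y ⟩
    x * x ⁻¹ * y    ≈⟨ *-congʳ (⁻¹-inverse (pos⇒≉ 0<x)) ⟩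
    1# * y          ≈⟨ *-identityˡ y ⟩
    y               ∎) (*-nonneg (proj₁ (pos-inverse 0<x)) p)

  fromℤ-nonneg : ∀ n → 0# ≤ fromℤ (+ n)
  fromℤ-nonneg zero    = ≤-refl
  fromℤ-nonneg (suc n) = +-nonneg (proj₁ 0<1) (fromℤ-nonneg n)

  fromℤ-pos : ∀ n → 0# < fromℤ (+ suc n)
  fromℤ-pos n = +-pos-nonneg 0<1 (fromℤ-nonneg n)

  fromℤ-- : ∀ i j → fromℤ (i ℤ.- j) ≈ fromℤ i - fromℤ j
  fromℤ-- i j = trans (fromℤ-+ i (ℤ.- j)) (+-congˡ (fromℤ-neg j))

  fromℤ-mono-≤ : ∀ {i j} → i ℤ.≤ j → fromℤ i ≤ fromℤ j
  fromℤ-mono-≤ {i} {j} i≤j with j ℤ.- i in eq | ℤ.i≤j⇒0≤j-i i≤j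
  ... | + n | _ = ≤-by (fromℤ-nonneg n) (trans (reflexive (≡.cong fromℤ (≡.sym eq))) (fromℤ-- j i))

  fromℤ-mono-< : ∀ {i j} → i ℤ.< j → fromℤ i < fromℤ j
  fromℤ-mono-< {i} {j} i<j = <-≤-trans
    (<-by 0<1 (trans (sym fromℤ-1) (trans (solve 2 (λ x o → o := (o :+ x) :- x) refl (fromℤ i)
        (fromℤ 1ℤ)) (+-congʳ (sym (fromℤ-+ 1ℤ i))))))
    (fromℤ-mono-≤ (ℤ.i<j⇒suc[i]≤j i<j))

  fromℤ-cancel-≤ : ∀ {i j} → fromℤ i ≤ fromℤ j → i ℤ.≤ j
  fromℤ-cancel-≤ {i} {j} p with i ℤ.≤? j
  ... | yes q = q
  ... | no ¬q = contradiction p (<⇒≱ (fromℤ-mono-< (ℤ.≰⇒> ¬q)))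

  fromℤ-cancel-< : ∀ {i j} → fromℤ i < fromℤ j → i ℤ.< j
  fromℤ-cancel-< {i} {j} p with i ℤ.<? j
  ... | yes q = q
  ... | no ¬q = contradiction (fromℤ-mono-≤ (ℤ.≮⇒≥ ¬q)) (<⇒≱ p)

-- Independent families and the dimension of subspaces.

module LinearAlgebra (em : ExcludedMiddle 0ℓ) (ℝ : RealNumbers) where
  open import Data.Fin.Base using (Fin; zero; suc; punchIn)
  open import Data.Nat.Base as ℕ using (ℕ; zero; suc; s≤s; z≤n)
  import Data.Nat.Properties as ℕ
  open import Data.Product using (∃; _×_; _,_; proj₁; proj₂)
  open import Data.Sum using (inj₁; inj₂)
  open import Data.Unit using (⊤; tt)
  open import Data.Vec.Functional using (Vector; insertAt) renaming (_∷_ to _∷ᵛ_)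
  open import Data.Vec.Functional.Properties using (insertAt-lookup; insertAt-punchIn)
  open import Function.Base using (_∘_)
  open import Relation.Binary.PropositionalEquality as ≡ using (_≡_; _≢_)
  open import Relation.Nullary using (¬_; yes; no; contradiction)
  open import Relation.Unary using (Pred; _∩_)
  open RealNumbers ℝ hiding (zero)
  open Reals ℝ
  open Combinatorics em ℝ
  open OrderedField em ℝ
  open Solver using (solve; _:=_; _:+_; _:*_; _:-_; :-_; con)
  open import Algebra.Properties.Ring ring
  open import Algebra.Properties.Semiring.Sum semiring
    using (sum-cong-≋; ∑-comm; ∑-distrib-+; *-distribˡ-sum; *-distribʳ-sum; sum-remove;
      sum-replicate-zero)
  open import Relation.Binary.Reasoning.Setoid setoid

  infixl 6 _+ᵥ_
  infixr 7 _*ᵥ_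


  private variable d k m n : ℕ

  _+ᵥ_ : Vector Carrier d → Vector Carrier d → Vector Carrier d
  (x +ᵥ y) i = x i + y i

  _*ᵥ_ : Carrier → Vector Carrier d → Vector Carrier d
  (c *ᵥ x) i = c * x i

  ∑-zero : ∀ {f : Vector Carrier n} → (∀ i → f i ≈ 0#) → ∑ f ≈ 0#
  ∑-zero {n} e = trans (sum-cong-≋ e) (sum-replicate-zero n)

  ∙-+ : ∀ (a x y : Vector Carrier d) → a ∙ (x +ᵥ y) ≈ a ∙ x + a ∙ y
  ∙-+ {d} a x y = trans (sum-cong-≋ {d} λ i → distribˡ (a i) (x i) (y i))
      (∑-distrib-+ {d} (λ i → a i * x i) (λ i → a i * y i))

  ∙-* : ∀ (a : Vector Carrier d) c x → a ∙ (c *ᵥ x) ≈ c * (a ∙ x)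
  ∙-* {d} a c x = trans (sum-cong-≋ {d} λ i → solve 3 (λ a c x → a :* (c :* x) := c :* (a :* x)) refl
      (a i) c (x i))
                    (sym (*-distribˡ-sum {d} c (λ i → a i * x i)))

  ∙-zero : ∀ {a x : Vector Carrier d} → IsZero x → a ∙ x ≈ 0#
  ∙-zero z = ∑-zero λ i → trans (*-congˡ (z i)) (zeroʳ _)

  lincomb : Vector Carrier k → Vector (Vector Carrier d) k → Vector Carrier d
  lincomb c v j = ∑ λ i → c i * v i j

  ∙-lincomb : ∀ (a : Vector Carrier d) (c : Vector Carrier k) v → a ∙ lincomb c v ≈ ∑ λ i → c i * (a ∙ v i)
  ∙-lincomb a c v = begin
    ∑ (λ j → a j * ∑ (λ i → c i * v i j))
      ≈⟨ sum-cong-≋ (λ j → *-distribˡ-sum (a j) (λ i → c i * v i j)) ⟩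
    ∑ (λ j → ∑ (λ i → a j * (c i * v i j)))
      ≈⟨ ∑-comm (λ j i → a j * (c i * v i j)) ⟩
    ∑ (λ i → ∑ (λ j → a j * (c i * v i j)))
      ≈⟨ sum-cong-≋ (λ i → ∙-* a (c i) (v i)) ⟩
    ∑ (λ i → c i * (a ∙ v i)) ∎

  δ : Fin d → Vector Carrier d
  δ zero    zero    = 1#
  δ zero    (suc j) = 0#
  δ (suc i) zero    = 0#
  δ (suc i) (suc j) = δ i j

  δ-∙ : ∀ i (x : Vector Carrier d) → δ i ∙ x ≈ x i
  δ-∙ zero    x = trans (+-cong (*-identityˡ _) (∑-zero λ j → zeroˡ (x (suc j)))) (+-identityʳ _)
  δ-∙ (suc i) x = trans (+-cong (zeroˡ _) (δ-∙ i (x ∘ suc))) (+-identityˡ _)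

  δ-sym : ∀ (i j : Fin d) → δ i j ≡ δ j i
  δ-sym zero    zero    = ≡.refl
  δ-sym zero    (suc j) = ≡.refl
  δ-sym (suc i) zero    = ≡.refl
  δ-sym (suc i) (suc j) = δ-sym i j

  δ-diag : ∀ (i : Fin d) → δ i i ≡ 1#
  δ-diag zero    = ≡.refl
  δ-diag (suc i) = δ-diag i

  δ-off : ∀ {i j : Fin d} → i ≢ j → δ i j ≡ 0#
  δ-off {i = zero}  {zero}  i≢j = contradiction ≡.refl i≢j
  δ-off {i = zero}  {suc j} i≢j = ≡.refl
  δ-off {i = suc i} {zero}  i≢j = ≡.refl
  δ-off {i = suc i} {suc j} i≢j = δ-off (i≢j ∘ ≡.cong suc)

  ∙-δ : ∀ (a : Vector Carrier d) i → a ∙ δ i ≈ a i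
  ∙-δ {d} a i = trans (sum-cong-≋ {d} λ j → *-comm (a j) (δ i j)) (δ-∙ i a)

  record IsSubspace (V : Pred (Vector Carrier d) 0ℓ) : Set where
    field
      0∈ : V (λ _ → 0#)
      +∈ : ∀ {x y} → V x → V y → V (x +ᵥ y)
      *∈ : ∀ c {x} → V x → V (c *ᵥ x)
  open IsSubspace

  _^⊥ : Vector Carrier d → Pred (Vector Carrier d) 0ℓ
  (a ^⊥) x = a ∙ x ≈ 0#

  everything : Pred (Vector Carrier d) 0ℓ
  everything _ = ⊤

  everything-subspace : IsSubspace {d} everything
  everything-subspace = record { 0∈ = tt ; +∈ = λ _ _ → tt ; *∈ = λ _ _ → tt }

  ∩⊥-subspace : ∀ {V : Pred (Vector Carrier d) 0ℓ} a → IsSubspace V → IsSubspace (V ∩ a ^⊥)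
  ∩⊥-subspace a sub = record
    { 0∈ = 0∈ sub , ∙-zero {a = a} (λ _ → refl)
    ; +∈ = λ (p , e) (q , f) → +∈ sub p q , trans (∙-+ a _ _) (trans (+-cong e f) (+-identityˡ _))
    ; *∈ = λ c (p , e) → *∈ sub c p , trans (∙-* a c _) (trans (*-congˡ e) (zeroʳ c))
    }

  HasIndependent : Pred (Vector Carrier d) 0ℓ → ℕ → Set
  HasIndependent {d} P k = ∃ λ (v : Vector (Vector Carrier d) k) → (∀ i → P (v i)) × LinearlyIndependent v

  independent-mono : ∀ {P Q : Pred (Vector Carrier d) 0ℓ} → (∀ x → P x → Q x) → HasIndependent P k →
      HasIndependent Q k
  independent-mono P⊆Q (v , Pv , li) = v , (λ i → P⊆Q (v i) (Pv i)) , li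

  independent-tail : ∀ {v : Vector (Vector Carrier d) (suc k)} → LinearlyIndependent v →
      LinearlyIndependent (v ∘ suc)
  independent-tail {v = v} li c z i = li (0# ∷ᵛ c) (λ j → trans (+-cong (zeroˡ (v zero j)) (z j))
      (+-identityˡ _)) (suc i)

  -- Project along vⱼ, where a ∙ vⱼ ≠ 0, onto a ^⊥; the projection is scaled by
  -- a ∙ vⱼ to avoid division.
  independent-restrict : ∀ {V : Pred (Vector Carrier d) 0ℓ} a → IsSubspace V →
                         HasIndependent V (suc k) → HasIndependent (V ∩ a ^⊥) k
  independent-restrict {k = k} {V = V} a sub (v , Vv , li) with em {∃ λ j → a ∙ v j ≉ 0#}
  ... | no none = v ∘ suc , (λ i → Vv (suc i) , ∈⊥ (suc i)) , independent-tail {v = v} li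
    where
    ∈⊥ : ∀ j → a ∙ v j ≈ 0#
    ∈⊥ j with em {a ∙ v j ≈ 0#}
    ... | yes e = e
    ... | no ¬e = contradiction (j , ¬e) none
  ... | yes (j , p≉0) = u , (λ i → +∈ sub (*∈ sub p (Vv _)) (*∈ sub (- q i) (Vv j)) , u⊥ i) , independent
    where
    p = a ∙ v j
    q : Vector Carrier k
    q i = a ∙ v (punchIn j i)
    u : Vector (Vector Carrier _) k
    u i = p *ᵥ v (punchIn j i) +ᵥ (- q i) *ᵥ v j
    u⊥ : ∀ i → a ∙ u i ≈ 0#
    u⊥ i = begin
      a ∙ u i               ≈⟨ ∙-+ a _ _ ⟩
      a ∙ (p *ᵥ v (punchIn j i)) + a ∙ ((- q i) *ᵥ v j) ≈⟨ +-cong (∙-* a p _) (∙-* a (- q i) (v j)) ⟩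
      p * q i + - q i * p   ≈⟨ solve 2 (λ p q → p :* q :+ (:- q) :* p := con (+ 0)) refl p (q i) ⟩
      0# ∎
      where open import Data.Integer.Base using (+_)
    independent : LinearlyIndependent u
    independent c z i = *-cancel-0 p≉0 (trans (reflexive
        (≡.sym (insertAt-punchIn (λ i → p * c i) j _ i))) (li c′ z′ (punchIn j i)))
      where
      -- A relation among the projections is a relation among the original vectors; `s` is the
      -- coefficient that `v j` collects from all of them.
      s = - ∑ (λ i → c i * q i)
      c′ = insertAt (λ i → p * c i) j s
      z′ : IsZero (lincomb c′ v)
      z′ l = begin
        ∑ (λ i → c′ i * v i l)
          ≈⟨ sum-remove {i = j} (λ i → c′ i * v i l) ⟩
        c′ j * v j l + ∑ (λ i → c′ (punchIn j i) * v (punchIn j i) l)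
          ≈⟨ +-cong (*-congʳ (reflexive (insertAt-lookup (λ i → p * c i) j s)))
                    (sum-cong-≋ λ i → *-congʳ (reflexive (insertAt-punchIn (λ i → p * c i) j s i))) ⟩
        s * v j l + ∑ (λ i → p * c i * v (punchIn j i) l)
          ≈⟨ +-congʳ (trans (sym (-‿distribˡ-* _ _)) (trans (-‿distribʳ-* _ _)
              (*-distribʳ-sum {k} (- v j l) (λ i → c i * q i)))) ⟩
        ∑ (λ i → c i * q i * - v j l) + ∑ (λ i → p * c i * v (punchIn j i) l)
          ≈⟨ ∑-distrib-+ (λ i → c i * q i * - v j l) _ ⟨
        ∑ (λ i → c i * q i * - v j l + p * c i * v (punchIn j i) l)
          ≈⟨ sum-cong-≋ (λ i → solve 5 (λ c q w p y → c :* q :* (:- w) :+ p :* c :* y := c :*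
              (p :* y :+ (:- q) :* w))
                                 refl (c i) (q i) (v j l) p (v (punchIn j i) l)) ⟩
        ∑ (λ i → c i * u i l)
          ≈⟨ z l ⟩
        0# ∎

  -- Applying `a` to a vanishing combination kills every term but that of `x`, so the coefficient of
  -- `x` is zero and the independence of `v` settles the others.
  independent-extend : ∀ {V : Pred (Vector Carrier d) 0ℓ} a {x} → V x → a ∙ x ≉ 0# →
                       HasIndependent (V ∩ a ^⊥) k → HasIndependent V (suc k)
  independent-extend a {x} Vx ax≉0 (v , Vv , li) = x ∷ᵛ v , in-V , independent
    where
    in-V : ∀ i → _
    in-V zero    = Vx
    in-V (suc i) = proj₁ (Vv i)
    independent : LinearlyIndependent (x ∷ᵛ v)
    independent c z = λ where
        zero    → c₀
        (suc i) → li (c ∘ suc) rest i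
      where
      c₀ : c zero ≈ 0#
      c₀ = *-cancel-0 ax≉0 (begin
        (a ∙ x) * c zero                                         ≈⟨ *-comm _ _ ⟩
        c zero * (a ∙ x)                                         ≈⟨ +-identityʳ _ ⟨
        c zero * (a ∙ x) + 0#
            ≈⟨ +-congˡ (∑-zero λ i → trans (*-congˡ (proj₂ (Vv i))) (zeroʳ _)) ⟨
        c zero * (a ∙ x) + ∑ (λ i → c (suc i) * (a ∙ v i))       ≈⟨ ∙-lincomb a c (x ∷ᵛ v) ⟨
        a ∙ lincomb c (x ∷ᵛ v)                                   ≈⟨ ∙-zero {a = a} z ⟩
        0# ∎)
      rest : IsZero (lincomb (c ∘ suc) v)
      rest j = begin
        lincomb (c ∘ suc) v j                     ≈⟨ +-identityˡ _ ⟨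
        0# + lincomb (c ∘ suc) v j                ≈⟨ +-congʳ (trans (*-congʳ c₀) (zeroˡ _)) ⟨
        c zero * x j + lincomb (c ∘ suc) v j      ≈⟨ z j ⟩
        0# ∎

  OnAll : (Fin m → Vector Carrier d) → Pred (Vector Carrier d) 0ℓ
  OnAll e x = ∀ i → e i ∙ x ≈ 0#

  independent-restrict* : ∀ {V : Pred (Vector Carrier d) 0ℓ} m (e : Fin m → Vector Carrier d) → IsSubspace V →
                          HasIndependent V (m ℕ.+ k) → HasIndependent (λ x → V x × OnAll e x) k
  independent-restrict* {V = V} zero e sub ind = independent-mono {P = V} {λ x → V x × OnAll e x}
      (λ _ Vx → Vx , λ ()) ind
  independent-restrict* {V = V} (suc m) e sub ind = independent-mono
    {P = λ x → (V ∩ e zero ^⊥) x × OnAll (e ∘ suc) x} {λ x → V x × OnAll e x}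
    (λ _ ((Vx , e₀) , es) → Vx , λ where
      zero    → e₀
      (suc i) → es i)
    (independent-restrict* m (e ∘ suc) (∩⊥-subspace (e zero) sub) (independent-restrict (e zero) sub ind))

  -- Imposing the `d` coordinate equations costs at most `d` vectors. A longer family would leave an
  -- independent family of vectors all of whose coordinates vanish, contradicted by the coefficients
  -- 1, 0, ..., 0.
  independent-bounded : ∀ {P : Pred (Vector Carrier d) 0ℓ} → HasIndependent P k → k ℕ.≤ d
  independent-bounded {d} {k} {P} ind with k ℕ.≤? d
  ... | yes k≤d = k≤d
  ... | no k≰d with ℕ.m≤n⇒∃[o]m+o≡n (ℕ.≰⇒> k≰d)
  ...   | o , ≡.refl = contradiction (≡.subst (HasIndependent everything) (≡.sym (ℕ.+-suc d o))
        (independent-mono {P = P} (λ _ _ → tt) ind)) impossible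
    where
    impossible : ¬ HasIndependent {d} everything (d ℕ.+ suc o)
    impossible ind with independent-restrict* d δ everything-subspace ind
    ... | v , Pv , li = 1≉0 (li (1# ∷ᵛ λ _ → 0#) (λ j → trans
      (+-cong (trans (*-identityˡ _) (trans (sym (δ-∙ j (v zero))) (proj₂ (Pv zero) j)))
          (∑-zero λ i → zeroˡ (v (suc i) j)))
      (+-identityˡ _)) zero)

  maxIndependent-independent : ∀ k (P : Pred (Vector Carrier d) 0ℓ) → HasIndependent P (maxIndependent k P)
  maxIndependent-independent zero P = (λ ()) , (λ ()) , (λ _ _ ())
  maxIndependent-independent (suc k) P with em {HasIndependent P (suc k)}
  ... | yes ind = ind
  ... | no  _   = maxIndependent-independent k P

  -- The search descends from `k` and stops at the first size attained, so it cannot pass `m`.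
  maxIndependent-max : ∀ k (P : Pred (Vector Carrier d) 0ℓ) → HasIndependent P m → m ℕ.≤ k → m ℕ.≤
      maxIndependent k P
  maxIndependent-max zero P ind m≤0 = m≤0
  maxIndependent-max (suc k) P ind m≤1+k with em {HasIndependent P (suc k)}
  ... | yes _ = m≤1+k
  ... | no ¬ind with ℕ.m≤n⇒m<n∨m≡n m≤1+k
  ...   | inj₁ (s≤s m≤k)  = maxIndependent-max k P ind m≤k
  ...   | inj₂ ≡.refl = contradiction ind ¬ind

  dim-independent : ∀ (P : Pred (Vector Carrier d) 0ℓ) → HasIndependent P (dim P)
  dim-independent {d} P = maxIndependent-independent d P

  dim-max : ∀ {P : Pred (Vector Carrier d) 0ℓ} → HasIndependent P k → k ℕ.≤ dim P
  dim-max {d} {P = P} ind = maxIndependent-max d P ind (independent-bounded {P = P} ind)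

  dim-mono : ∀ {P Q : Pred (Vector Carrier d) 0ℓ} → (∀ x → P x → Q x) → dim P ℕ.≤ dim Q
  dim-mono {P = P} {Q} P⊆Q = dim-max {P = Q} (independent-mono {P = P} P⊆Q (dim-independent P))

  dim-cong : ∀ {P Q : Pred (Vector Carrier d) 0ℓ} → (∀ x → P x → Q x) → (∀ x → Q x → P x) → dim P ≡ dim Q
  dim-cong P⊆Q Q⊆P = ℕ.≤-antisym (dim-mono P⊆Q) (dim-mono Q⊆P)

  -- The two inequalities are the restriction and the extension of independent families. The later
  -- dimension counts all rest on this equation.
  dim-∩⊥ : ∀ {V : Pred (Vector Carrier d) 0ℓ} a {x} → IsSubspace V → V x → a ∙ x ≉ 0# → dim V ≡ suc
      (dim (V ∩ a ^⊥))
  dim-∩⊥ {V = V} a {x} sub Vx ax≉0 = ℕ.≤-antisym upper (dim-max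
      (independent-extend a Vx ax≉0 (dim-independent _)))
    where
    upper : dim V ℕ.≤ suc (dim (V ∩ a ^⊥))
    upper with dim V | dim-independent V
    ... | zero  | _   = z≤n
    ... | suc k | ind = s≤s (dim-max (independent-restrict a sub ind))

  δ-independent : LinearlyIndependent {d} δ
  δ-independent {d} c z i = begin
    c i                   ≈⟨ δ-∙ i c ⟨
    δ i ∙ c               ≈⟨ sum-cong-≋ {d} (λ j → trans (*-congʳ (reflexive (δ-sym i j)))
        (*-comm (δ j i) (c j))) ⟩
    lincomb c δ i         ≈⟨ z i ⟩
    0#                    ∎

  dim-everything : dim (everything {d}) ≡ d
  dim-everything {d} = ℕ.≤-antisym (independent-bounded (dim-independent {d} everything))
      (dim-max (δ , (λ _ → tt) , δ-independent))

-- The Möbius function as Whitney's signed count of subsets.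

module Mobius (em : ExcludedMiddle 0ℓ) (ℝ : RealNumbers) where
  open import Data.Fin.Subset using (Subset; _∈_; _⊆_; _⊂_; Nonempty; ⊥)
  open import Data.Fin.Subset.Induction using (⊂-wellFounded)
  open import Data.Fin.Subset.Properties
    using (_∈?_; _⊂?_; nonempty?; ⊆-antisym; ∉⊥; ⊥⊆; Empty-unique)
  open import Data.Integer.Base as ℤ using (ℤ; +_; 0ℤ; 1ℤ)
  open import Data.Nat.Base as ℕ using (ℕ)
  open import Data.List.Base using (map; foldr)
  open import Data.Product using (∃; _×_; _,_)
  open import Relation.Binary.PropositionalEquality as ≡ using (_≡_; refl)
  open import Relation.Nullary using (¬_; yes; no; contradiction; does)
  open import Induction.WellFounded using (module All; module Some; module FixPoint; acc-inverse)
  import Data.Integer.Properties as ℤ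
  open import Data.Integer.Tactic.RingSolver using (solve-∀)
  open import Data.Vec.Base using (tabulate)
  open import Data.Vec.Properties using (lookup∘tabulate; []=⇒lookup; lookup⇒[]=)
  open import Data.Bool.Base using (true)
  open import Relation.Unary using () renaming (_⊆_ to _⊆ₚ_)
  open SubsetSums em
  open Reals ℝ
  open Combinatorics em ℝ

  module _ {d n : ℕ} (A : Arrangement d n) where
    Rec : Subset n → Set
    Rec X = ∀ {Y} → Y ⊂ X → ℤ

    -- The recursion behind μ is local to its definition, hence nameless here.  Each of the following
    -- blocks recovers a piece of it as the solution of a unification problem: its step function only
    -- becomes visible two unfoldings deep, where the accessibility proof is stuck.
    mutual
      μ-summand : ∀ X → Nonempty X → Subset n → ℤ
      μ-summand = _

      μ-nonempty : ∀ X → Nonempty X → ∃ λ ne → μ A X ≡ ℤ.- foldr ℤ._+_ 0ℤ (map (μ-summand X ne) (lattice A))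
      μ-nonempty X ne with nonempty? X
      ... | yes p = p , refl
      ... | no ¬p = contradiction ne ¬p

    mutual
      μ-summand₂ : ∀ X ne Y → Y ⊂ X → Nonempty Y → Subset n → ℤ
      μ-summand₂ = _

      μ-summand-nonempty : ∀ X ne Y → Y ⊂ X → Nonempty Y → ∃ λ Y⊂X → ∃ λ ne′ →
        μ-summand X ne Y ≡ ℤ.- foldr ℤ._+_ 0ℤ (map (μ-summand₂ X ne Y Y⊂X ne′) (lattice A))
      μ-summand-nonempty X ne Y Y⊂X ne′ with Y ⊂? X
      ... | no ¬p = contradiction Y⊂X ¬p
      ... | yes p with nonempty? Y
      ...   | yes q = p , q , refl
      ...   | no ¬q = contradiction ne′ ¬q

    mutual
      μ-step : ∀ X → Rec X → ℤ
      μ-step = _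

      μ-summand₂-rec : ∀ X ne Y Y⊂X ne′ Z → Z ⊂ Y → ∃ λ Z⊂Y →
        μ-summand₂ X ne Y Y⊂X ne′ Z ≡ Some.wfRecBuilder (λ _ → ℤ) μ-step Y
            (acc-inverse (⊂-wellFounded X) Y⊂X) {Z} Z⊂Y
      μ-summand₂-rec X ne Y Y⊂X ne′ Z Z⊂Y with Z ⊂? Y
      ... | yes p = p , refl
      ... | no ¬p = contradiction Z⊂Y ¬p

    mutual
      μ-term : ∀ X → Rec X → Nonempty X → Subset n → ℤ
      μ-term = _

      μ-step-nonempty : ∀ X (rec : Rec X) → Nonempty X → ∃ λ ne →
        μ-step X rec ≡ ℤ.- foldr ℤ._+_ 0ℤ (map (μ-term X rec ne) (lattice A))
      μ-step-nonempty X rec ne with nonempty? X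
      ... | yes p = p , refl
      ... | no ¬p = contradiction ne ¬p

    μ-step-empty : ∀ X (rec : Rec X) → ¬ Nonempty X → μ-step X rec ≡ 1ℤ
    μ-step-empty X rec e with nonempty? X
    ... | yes p = contradiction p e
    ... | no  _ = refl

    μ-term-⊂ : ∀ X (rec : Rec X) ne Y (c : ℤ) → (∀ p → rec {Y} p ≡ c) → Y ⊂ X → μ-term X rec ne Y ≡ c
    μ-term-⊂ X rec ne Y c e Y⊂X with Y ⊂? X
    ... | yes p = e p
    ... | no ¬p = contradiction Y⊂X ¬p

    μ-term-⊄ : ∀ X (rec : Rec X) ne Y → ¬ (Y ⊂ X) → μ-term X rec ne Y ≡ 0ℤ
    μ-term-⊄ X rec ne Y Y⊄X with Y ⊂? X
    ... | yes p = contradiction p Y⊄X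
    ... | no ¬p = refl

    μ-term-cong : ∀ X (rec rec′ : Rec X) ne ne′ → (∀ {Y} p → rec {Y} p ≡ rec′ p) → ∀ Y → μ-term X rec ne
        Y ≡ μ-term X rec′ ne′ Y
    μ-term-cong X rec rec′ ne ne′ e Y with Y ⊂? X
    ... | yes p = e p
    ... | no  _ = refl

    -- Extensionality of the step is what unfolding a well-founded recursion demands, since the
    -- recursive calls carry different accessibility proofs. The nonemptiness proofs `ne₁` and `ne₂`
    -- chosen inside the step may differ as well, hence their separate treatment.
    μ-step-cong : ∀ X {rec rec′ : Rec X} → (∀ {Y} p → rec {Y} p ≡ rec′ p) → μ-step X rec ≡ μ-step X rec′
    μ-step-cong X {rec} {rec′} e with em {Nonempty X}
    ... | no ¬ne = ≡.trans (μ-step-empty X rec ¬ne) (≡.sym (μ-step-empty X rec′ ¬ne))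
    ... | yes ne =
      let (ne₁ , e₁) = μ-step-nonempty X rec ne
          (ne₂ , e₂) = μ-step-nonempty X rec′ ne
      in ≡.trans e₁ (≡.trans (≡.cong ℤ.-_ (Σₗ-cong (μ-term-cong X rec rec′ ne₁ ne₂ e) (lattice A))) (≡.sym e₂))

    μ-unfold : ∀ X → μ A X ≡ μ-step X (λ {Y} _ → μ A Y)
    μ-unfold X = FixPoint.unfold-wfRec ⊂-wellFounded (λ _ → ℤ) μ-step (λ X e → μ-step-cong X e) {X}

    open Arrangement A

    Σ-lattice : ∀ (f : Subset n → ℤ) → Σₗ f (lattice A) ≡ Σₛ (λ S → ind (Closed S) ℤ.* f S)
    Σ-lattice f = ≡.trans (Σₗ-filter (λ S → em {Closed S}) f (subsets n))
        (Σₗ-subsets (λ S → ind (Closed S) ℤ.* f S))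

    μ-⊥ : μ A ⊥ ≡ 1ℤ
    μ-⊥ = ≡.trans (μ-unfold ⊥) (μ-step-empty ⊥ (λ {Y} _ → μ A Y) (λ (i , i∈⊥) → ∉⊥ i∈⊥))

    μ-sum : ∀ {X} → Nonempty X → μ A X ≡ ℤ.- Σₛ (λ Y → ind (Closed Y) ℤ.* (ind (Y ⊂ X) ℤ.* μ A Y))
    μ-sum {X} ne = let (ne′ , e) = μ-step-nonempty X (λ {Y} _ → μ A Y) ne in
      ≡.trans (μ-unfold X) (≡.trans e (≡.cong ℤ.-_
        (≡.trans (Σₗ-cong (term ne′) (lattice A)) (Σ-lattice (λ Y → ind (Y ⊂ X) ℤ.* μ A Y)))))
      where
      term : ∀ ne′ Y → μ-term X (λ {Y} _ → μ A Y) ne′ Y ≡ ind (Y ⊂ X) ℤ.* μ A Y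
      term ne′ Y with em {Y ⊂ X}
      ... | yes p = ≡.trans (μ-term-⊂ X _ ne′ Y (μ A Y) (λ _ → refl) p) (≡.sym (ℤ.*-identityˡ _))
      ... | no ¬p = μ-term-⊄ X _ ne′ Y ¬p

    -- The closure operator of the matroid of normals: `cl S` is the closed index set that
    -- represents the flat `⋂ S`.
    cl : Subset n → Subset n
    cl S = tabulate λ i → does (em {⋂ S ⊆ₚ H i})

    ∈cl⇒⊆H : ∀ {S i} → i ∈ cl S → ∀ x → ⋂ S x → H i x
    ∈cl⇒⊆H {S} {i} i∈ x Sx with em {⋂ S ⊆ₚ H i} | ≡.trans
        (≡.sym (lookup∘tabulate (λ i → does (em {⋂ S ⊆ₚ H i})) i)) ([]=⇒lookup i∈)
    ... | yes p | _ = p Sx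

    ⊆H⇒∈cl : ∀ {S i} → (∀ x → ⋂ S x → H i x) → i ∈ cl S
    ⊆H⇒∈cl {S} {i} p = lookup⇒[]= i (cl S) (≡.trans (lookup∘tabulate (λ i → does (em {⋂ S ⊆ₚ H i})) i)
        inside-cl)
      where
      inside-cl : does (em {⋂ S ⊆ₚ H i}) ≡ true
      inside-cl with em {⋂ S ⊆ₚ H i}
      ... | yes _ = refl
      ... | no ¬p = contradiction (λ {x} → p x) ¬p

    ⋂-cl : ∀ S x → ⋂ S x → ⋂ (cl S) x
    ⋂-cl S x Sx i i∈ = ∈cl⇒⊆H i∈ x Sx

    S⊆cl : ∀ S → S ⊆ cl S
    S⊆cl S {i} i∈S = ⊆H⇒∈cl λ x Sx → Sx i i∈S

    ⋂-anti : ∀ {S T} → S ⊆ T → ∀ x → ⋂ T x → ⋂ S x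
    ⋂-anti S⊆T x Tx i i∈S = Tx i (S⊆T i∈S)

    cl-closed : ∀ S → Closed (cl S)
    cl-closed S i p = ⊆H⇒∈cl λ x Sx → p (⋂-cl S x Sx)

    cl-least : ∀ {S X} → Closed X → S ⊆ X → cl S ⊆ X
    cl-least {S} closed S⊆X {i} i∈ = closed i λ {x} Xx → ∈cl⇒⊆H i∈ x (⋂-anti S⊆X x Xx)

    whitney : Subset n → ℤ
    whitney X = Σₛ λ S → ind (cl S ≡ X) ℤ.* sgn S

    -- The subsets `S` are regrouped by closure: each lies in the fibre of exactly one closed set.
    Σ-whitney : ∀ (f : Subset n → ℤ) → Σₛ (λ X → ind (Closed X) ℤ.* (f X ℤ.* whitney X)) ≡ Σₛ
        (λ S → f (cl S) ℤ.* sgn S)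
    Σ-whitney f = begin
      Σₛ (λ X → ind (Closed X) ℤ.* (f X ℤ.* whitney X))
        ≡⟨ Σₛ-cong (λ X → ≡.trans (≡.sym (ℤ.*-assoc (ind (Closed X)) (f X) _))
            (≡.sym (Σₛ-* (ind (Closed X) ℤ.* f X) (λ S → ind (cl S ≡ X) ℤ.* sgn S)))) ⟩
      Σₛ (λ X → Σₛ (λ S → ind (Closed X) ℤ.* f X ℤ.* (ind (cl S ≡ X) ℤ.* sgn S)))
        ≡⟨ Σₛ-comm (λ X S → ind (Closed X) ℤ.* f X ℤ.* (ind (cl S ≡ X) ℤ.* sgn S)) ⟩
      Σₛ (λ S → Σₛ (λ X → ind (Closed X) ℤ.* f X ℤ.* (ind (cl S ≡ X) ℤ.* sgn S)))
        ≡⟨ Σₛ-cong (λ S → Σₛ-cong (λ X → swap (ind (Closed X)) (f X) (ind (cl S ≡ X)) (sgn S))) ⟩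
      Σₛ (λ S → Σₛ (λ X → ind (cl S ≡ X) ℤ.* (ind (Closed X) ℤ.* (f X ℤ.* sgn S))))
        ≡⟨ Σₛ-cong (λ S → Σₛ-≡ (cl S) (λ X → ind (Closed X) ℤ.* (f X ℤ.* sgn S))) ⟩
      Σₛ (λ S → ind (Closed (cl S)) ℤ.* (f (cl S) ℤ.* sgn S))
        ≡⟨ Σₛ-cong (λ S → ind-*-yes (f (cl S) ℤ.* sgn S) (cl-closed S)) ⟩
      Σₛ (λ S → f (cl S) ℤ.* sgn S) ∎
      where
      open ≡.≡-Reasoning
      swap : ∀ c f i s → c ℤ.* f ℤ.* (i ℤ.* s) ≡ i ℤ.* (c ℤ.* (f ℤ.* s))
      swap = solve-∀

    -- Both sides obey the same recursion. For closed `X` the conditions `cl S ⊆ X` and `S ⊆ X`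
    -- agree, so the sum of `whitney Y` over the closed `Y ⊆ X` is the signed count of the subsets
    -- of `X`, which is zero for nonempty `X`.
    μ≡whitney : ∀ X → Closed X → μ A X ≡ whitney X
    μ≡whitney = All.wfRec ⊂-wellFounded 0ℓ (λ X → Closed X → μ A X ≡ whitney X) step
      where
      open ≡.≡-Reasoning
      Σ-interval : ∀ X → Closed X → Σₛ (λ Y → ind (Closed Y) ℤ.* (ind (Y ⊆ X) ℤ.* whitney Y)) ≡ Σₛ
          (λ S → ind (S ⊆ X) ℤ.* sgn S)
      Σ-interval X closed = ≡.trans (Σ-whitney (λ Y → ind (Y ⊆ X)))
        (Σₛ-cong λ S → ≡.cong (ℤ._* sgn S) (ind-cong {cl S ⊆ X} {S ⊆ X} (λ cl⊆X i∈S → cl⊆X (S⊆cl S i∈S))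
            (λ S⊆X → cl-least closed S⊆X)))
      ⊆-split : ∀ X Y → ind (Y ⊆ X) ≡ ind (Y ⊂ X) ℤ.+ ind (X ≡ Y)
      ⊆-split X Y with em {X ≡ Y}
      ... | yes refl = ≡.trans (ind-yes {X ⊆ X} (λ i∈ → i∈))
            (≡.sym (≡.cong (ℤ._+ 1ℤ) (ind-no {X ⊂ X} λ (_ , i , i∈ , i∉) → i∉ i∈)))
      ... | no X≢Y = ≡.trans (ind-cong {Y ⊆ X} {Y ⊂ X} (λ Y⊆X → Y⊆X , strict Y⊆X) (λ (Y⊆X , _) → Y⊆X))
            (≡.sym (ℤ.+-identityʳ _))
        where
        strict : Y ⊆ X → ∃ λ i → i ∈ X × ¬ (i ∈ Y)
        strict Y⊆X with em {∃ λ i → i ∈ X × ¬ (i ∈ Y)}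
        ... | yes p = p
        ... | no ¬p = contradiction (⊆-antisym X⊆Y Y⊆X) X≢Y
          where
          X⊆Y : X ⊆ Y
          X⊆Y {i} i∈X with i ∈? Y
          ... | yes i∈Y = i∈Y
          ... | no  i∉Y = contradiction (i , i∈X , i∉Y) ¬p
      step : ∀ X → (∀ {Y} → Y ⊂ X → Closed Y → μ A Y ≡ whitney Y) → Closed X → μ A X ≡ whitney X
      step X IH closed with em {Nonempty X}
      -- Here `⊥` is closed, so `cl S` is empty exactly when `S` is, and only the term of the empty
      -- set survives.
      ... | no ¬ne rewrite Empty-unique ¬ne = begin
        μ A ⊥                                ≡⟨ μ-⊥ ⟩
        1ℤ                                   ≡⟨ sgn⊥ n ⟩
        sgn {n} ⊥                            ≡⟨ Σ⊆⊥ {n} sgn ⟨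
        Σₛ {n} (λ S → ind (S ⊆ ⊥) ℤ.* sgn S) ≡⟨ Σₛ-cong (λ S → ≡.cong (ℤ._* sgn S) (ind-cong {S ⊆ ⊥} {cl S ≡ ⊥} (λ S⊆⊥ → ⊆-antisym (cl-least closed S⊆⊥) ⊥⊆) (λ { e → ≡.subst (S ⊆_) e (S⊆cl S) }))) ⟩
        whitney ⊥                            ∎
        where
        sgn⊥ : ∀ n → 1ℤ ≡ sgn {n} ⊥
        sgn⊥ ℕ.zero = refl
        sgn⊥ (ℕ.suc n) = sgn⊥ n
      ... | yes ne = begin
        μ A X                 ≡⟨ μ-sum ne ⟩
        ℤ.- Σₛ (λ Y → ind (Closed Y) ℤ.* (ind (Y ⊂ X) ℤ.* μ A Y))
          ≡⟨ ≡.cong ℤ.-_ (Σₛ-cong λ Y → ind-*-cong (Closed Y) λ cY → ind-*-cong (Y ⊂ X) λ Y⊂X → IH Y⊂X cY) ⟩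
        ℤ.- s                 ≡⟨ from-zero s (whitney X) (≡.trans (≡.sym total) (Σ⊆-sgn-nonempty ne)) ⟩
        whitney X             ∎
        where
        s = Σₛ (λ Y → ind (Closed Y) ℤ.* (ind (Y ⊂ X) ℤ.* whitney Y))
        from-zero : ∀ a b → a ℤ.+ b ≡ 0ℤ → ℤ.- a ≡ b
        from-zero a b e = ≡.trans (≡.sym (ℤ.+-identityˡ _))
            (≡.trans (≡.cong (λ z → z ℤ.- a) (≡.sym e)) (cancel a b))
          where
          cancel : ∀ a b → a ℤ.+ b ℤ.- a ≡ b
          cancel = solve-∀
        distr : ∀ c a b w → c ℤ.* ((a ℤ.+ b) ℤ.* w) ≡ c ℤ.* (a ℤ.* w) ℤ.+ b ℤ.* (c ℤ.* w)
        distr = solve-∀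
        total : Σₛ (λ S → ind (S ⊆ X) ℤ.* sgn S) ≡ s ℤ.+ whitney X
        total = begin
          Σₛ (λ S → ind (S ⊆ X) ℤ.* sgn S)    ≡⟨ Σ-interval X closed ⟨
          Σₛ (λ Y → ind (Closed Y) ℤ.* (ind (Y ⊆ X) ℤ.* whitney Y))
            ≡⟨ Σₛ-cong (λ Y → ≡.trans (≡.cong (λ z → ind (Closed Y) ℤ.* (z ℤ.* whitney Y))
                (⊆-split X Y)) (distr (ind (Closed Y)) (ind (Y ⊂ X)) (ind (X ≡ Y)) (whitney Y))) ⟩
          Σₛ (λ Y → ind (Closed Y) ℤ.* (ind (Y ⊂ X) ℤ.* whitney Y) ℤ.+ ind (X ≡ Y) ℤ.*
              (ind (Closed Y) ℤ.* whitney Y))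
            ≡⟨ Σₛ-+ (λ Y → ind (Closed Y) ℤ.* (ind (Y ⊂ X) ℤ.* whitney Y))
                (λ Y → ind (X ≡ Y) ℤ.* (ind (Closed Y) ℤ.* whitney Y)) ⟩
          s ℤ.+ Σₛ (λ Y → ind (X ≡ Y) ℤ.* (ind (Closed Y) ℤ.* whitney Y))
            ≡⟨ ≡.cong (ℤ._+_ s) (≡.trans (Σₛ-≡ X (λ Y → ind (Closed Y) ℤ.* whitney Y)) (ind-*-yes _ closed)) ⟩
          s ℤ.+ whitney X ∎

    -- For `f` depending on dimension alone the left side evaluates χ: the constant 1 gives the
    -- value at 1, the parity of the dimension the value at -1.
    Σ-μ : ∀ (f : Subset n → ℤ) → Σₛ (λ X → ind (Closed X) ℤ.* (f X ℤ.* μ A X)) ≡ Σₛ (λ S → f (cl S) ℤ.* sgn S)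
    Σ-μ f = ≡.trans (Σₛ-cong λ X → ind-*-cong (Closed X) λ cX → ≡.cong (f X ℤ.*_) (μ≡whitney X cX))
        (Σ-whitney f)

-- Deletion and restriction for realisable sign vectors.

module Chambers (em : ExcludedMiddle 0ℓ) (ℝ : RealNumbers) where
  open import Data.Fin.Base using (Fin; zero; suc)
  open import Data.Fin.Subset using (Subset; Side; inside; outside; _∈_)
  open import Data.Integer.Base as ℤ using (ℤ; +_; 0ℤ; 1ℤ; -1ℤ)
  import Data.Integer.Properties as ℤ
  open import Data.Integer.Tactic.RingSolver using (solve-∀)
  open import Data.Nat.Base as ℕ using (ℕ; zero; suc)
  open import Data.Product using (∃; _×_; _,_; proj₁; proj₂)
  open import Data.Sum using (_⊎_; inj₁; inj₂)
  open import Data.Vec.Base using (_∷_; []; lookup; here; there)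
  open import Data.Vec.Functional using (Vector)
  open import Function.Base using (_∘_)
  open import Relation.Binary.PropositionalEquality as ≡ using (_≡_; refl)
  open import Relation.Nullary using (yes; no; contradiction)
  open import Relation.Unary using (Pred; _∩_)
  open RealNumbers ℝ hiding (zero; refl)
  open Reals ℝ
  open Combinatorics em ℝ
  open SubsetSums em
  open OrderedField em ℝ
  open LinearAlgebra em ℝ
  open Solver using (solve; _:=_; _:+_; _:*_; _:-_; :-_; con)
  open IsSubspace

  private variable d n : ℕ

  -- Sign vectors are encoded as subsets, with `inside` for positive, so that `Σₛ` counts chambers
  -- too.
  signed : Side → Carrier → Carrier
  signed inside  u = u
  signed outside u = - u

  signed-cong : ∀ s {u w} → u ≈ w → signed s u ≈ signed s w
  signed-cong inside  e = e
  signed-cong outside e = -‿cong e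

  signed-linear : ∀ s c u e w → signed s (c * u + e * w) ≈ c * signed s u + e * signed s w
  signed-linear inside  c u e w = RealNumbers.refl ℝ
  signed-linear outside c u e w =
    solve 4 (λ c u e w → :- (c :* u :+ e :* w) := c :* (:- u) :+ e :* (:- w)) (RealNumbers.refl ℝ) c u e w

  ∙-combination : ∀ (a : Vector Carrier d) c x e y → a ∙ (c *ᵥ x +ᵥ e *ᵥ y) ≈ c * (a ∙ x) + e * (a ∙ y)
  ∙-combination a c x e y = trans (∙-+ a (c *ᵥ x) (e *ᵥ y)) (+-cong (∙-* a c x) (∙-* a e y))

  signed-∙ : ∀ s (a : Vector Carrier d) c x e y →
             signed s (a ∙ (c *ᵥ x +ᵥ e *ᵥ y)) ≈ c * signed s (a ∙ x) + e * signed s (a ∙ y)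
  signed-∙ s a c x e y = trans (signed-cong s (∙-combination a c x e y)) (signed-linear s c _ e _)

  HasSigns : (Fin n → Vector Carrier d) → Subset n → Pred (Vector Carrier d) 0ℓ
  HasSigns a σ x = ∀ i → 0# < signed (lookup σ i) (a i ∙ x)

  Chamber : Pred (Vector Carrier d) 0ℓ → (Fin n → Vector Carrier d) → Subset n → Set
  Chamber V a σ = ∃ λ x → V x × HasSigns a σ x

  -- Chambers are open. Instead of shrinking `v`, the point `x` is scaled up: a large multiple of it
  -- outweighs `v` in each of the finitely many functionals.
  signs-perturb : ∀ (a : Fin n → Vector Carrier d) σ x v → HasSigns a σ x →
                  ∃ λ K → ∀ L → K ≤ L → HasSigns a σ (L *ᵥ x +ᵥ 1# *ᵥ v)
  signs-perturb {zero}  a []      x v p = 0# , λ _ _ ()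
  signs-perturb {suc n} a (s ∷ σ) x v p with signs-perturb (a ∘ suc) σ x v (p ∘ suc)
  ... | K , q = proj₁ max , λ where
      L l zero    → head L (≤-trans (proj₂ (proj₂ max)) l)
      L l (suc i) → q L (≤-trans (proj₁ (proj₂ max)) l) i
    where
    b = signed s (a zero ∙ x)
    c = signed s (a zero ∙ v)
    -- Chosen so that `L * b + 1# * c` is at least 1 from `K₀` on.
    K₀ = (1# - c) * b ⁻¹
    max : ∃ λ M → K ≤ M × K₀ ≤ M
    max with ≤-total K K₀
    ... | inj₁ l = K₀ , l , ≤-refl
    ... | inj₂ l = K , ≤-refl , l
    K₀b : K₀ * b ≈ 1# - c
    K₀b = trans (*-assoc _ _ _) (trans (*-congˡ (trans (*-comm _ _) (⁻¹-inverse (pos⇒≉ (p zero)))))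
        (*-identityʳ _))
    head : ∀ L → K₀ ≤ L → 0# < signed s (a zero ∙ (L *ᵥ x +ᵥ 1# *ᵥ v))
    head L l = <-resp (RealNumbers.refl ℝ) (sym (signed-∙ s (a zero) L x 1# v))
      (<-≤-trans 0<1 (≤-by (*-nonneg (≤⇒0≤ l) (proj₁ (p zero))) (begin
        (L - K₀) * b            ≈⟨ solve 3 (λ L K b → (L :- K) :* b := L :* b :- K :* b)
            (RealNumbers.refl ℝ) L K₀ b ⟩
        L * b - K₀ * b          ≈⟨ +-congˡ (-‿cong K₀b) ⟩
        L * b - (1# - c)        ≈⟨ solve 3 (λ x o c → x :- (o :- c) := x :+ c :- o) (RealNumbers.refl ℝ)
            (L * b) 1# c ⟩
        L * b + c - 1#          ≈⟨ +-congʳ (+-congˡ (*-identityˡ c)) ⟨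
        L * b + 1# * c - 1#     ∎)))
      where open import Relation.Binary.Reasoning.Setoid setoid

  -- A point on the hyperplane is pushed off it to the side of `v`; the perturbation is small
  -- enough, relative to the point, to keep all other signs.
  chamber-near : ∀ {V : Pred (Vector Carrier d) 0ℓ} {a : Fin (suc n) → Vector Carrier d} s {σ v} →
      IsSubspace V →
                 V v → 0# < signed s (a zero ∙ v) → Chamber (V ∩ a zero ^⊥) (a ∘ suc) σ → Chamber V a (s ∷ σ)
  chamber-near {a = a} s {σ} {v} sub Vv p (x , (Vx , ax≈0) , q) =
    let (K , r) = signs-perturb (a ∘ suc) σ x v q
    in K *ᵥ x +ᵥ 1# *ᵥ v , +∈ sub (*∈ sub K Vx) (*∈ sub 1# Vv) , λ where
      zero    → <-resp (RealNumbers.refl ℝ)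
                  (sym (trans (signed-cong s (trans (∙-combination (a zero) K x 1# v)
                    (trans (+-cong (trans (*-congˡ ax≈0) (zeroʳ K)) (*-identityˡ _)) (+-identityˡ _))))
                        (RealNumbers.refl ℝ))) p
      (suc i) → r K ≤-refl i

  -- Up to scaling, `z` is where the segment between two points on opposite sides crosses the
  -- hyperplane. Its coefficients `- ay` and `ax` are positive, so signs shared by both points
  -- persist.
  chamber-between : ∀ {V : Pred (Vector Carrier d) 0ℓ} {a : Fin (suc n) → Vector Carrier d} {σ} →
      IsSubspace V →
                    Chamber V a (inside ∷ σ) → Chamber V a (outside ∷ σ) → Chamber (V ∩ a zero ^⊥) (a ∘ suc) σ
  chamber-between {a = a} {σ} sub (x , Vx , p) (y , Vy , q) =
    z , (+∈ sub (*∈ sub (- ay) Vx) (*∈ sub ax Vy) , trans (∙-combination (a zero) (- ay) x ax y)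
           (solve 2 (λ ax ay → (:- ay) :* ax :+ ax :* ay := con 0ℤ) (RealNumbers.refl ℝ) ax ay)) ,
    λ i → <-resp (RealNumbers.refl ℝ) (sym (signed-∙ (lookup σ i) (a (suc i)) (- ay) x ax y))
            (+-pos (*-pos (q zero) (p (suc i))) (*-pos (p zero) (q (suc i))))
    where
    ax = a zero ∙ x
    ay = a zero ∙ y
    z = (- ay) *ᵥ x +ᵥ ax *ᵥ y

  chamber-tail : ∀ {V : Pred (Vector Carrier d) 0ℓ} {a : Fin (suc n) → Vector Carrier d} {s σ} →
                 Chamber V a (s ∷ σ) → Chamber V (a ∘ suc) σ
  chamber-tail (x , Vx , p) = x , Vx , p ∘ suc

  chamber-split : ∀ {V : Pred (Vector Carrier d) 0ℓ} {a : Fin (suc n) → Vector Carrier d} {σ} → Chamber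
      V (a ∘ suc) σ →
                  Chamber V a (inside ∷ σ) ⊎ Chamber V a (outside ∷ σ) ⊎ Chamber (V ∩ a zero ^⊥) (a ∘ suc) σ
  chamber-split {a = a} {σ} (x , Vx , p) with trichotomy (a zero ∙ x)
  ... | inj₂ (inj₂ ax>0) = inj₁ (x , Vx , λ { zero → ax>0 ; (suc i) → p i })
  ... | inj₂ (inj₁ ax≈0) = inj₂ (inj₂ (x , (Vx , ax≈0) , p))
  ... | inj₁ ax<0        = inj₂ (inj₁ (x , Vx , λ { zero → <-resp (RealNumbers.refl ℝ) (+-identityˡ _) (<⇒0< ax<0) ; (suc i) → p i }))

  -- The recursion for a single sign vector: a chamber of the deletion is divided in two when it
  -- meets the hyperplane, and otherwise lies entirely on one side.
  chamber-deletion : ∀ {V : Pred (Vector Carrier d) 0ℓ} (a : Fin (suc n) → Vector Carrier d) {v} →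
      IsSubspace V →
    V v → a zero ∙ v ≉ 0# → ∀ σ →
    ind (Chamber V a (inside ∷ σ)) ℤ.+ ind (Chamber V a (outside ∷ σ)) ≡
    ind (Chamber V (a ∘ suc) σ) ℤ.+ ind (Chamber (V ∩ a zero ^⊥) (a ∘ suc) σ)
  chamber-deletion {V = V} a {v} sub Vv av≉0 σ with em {Chamber (V ∩ a zero ^⊥) (a ∘ suc) σ}
  ... | yes c@(x , (Vx , _) , p) = ≡.cong₂ ℤ._+_
    (≡.trans (ind-yes (near inside (proj₁ positive) (proj₁ (proj₂ positive)) (proj₂ (proj₂ positive))))
        (≡.sym (ind-yes (x , Vx , p))))
    (ind-yes (near outside (proj₁ negative) (proj₁ (proj₂ negative)) (proj₂ (proj₂ negative))))
    where
    near : ∀ s w → V w → 0# < signed s (a zero ∙ w) → Chamber V a (s ∷ σ)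
    near s w Vw q = chamber-near s {v = w} sub Vw q c
    flip : ∀ w → a zero ∙ ((- 1#) *ᵥ w) ≈ - (a zero ∙ w)
    flip w = trans (∙-* (a zero) (- 1#) w) (-1*x≈-x _)
      where open import Algebra.Properties.Ring ring
    positive : ∃ λ w → V w × 0# < a zero ∙ w
    positive with trichotomy (a zero ∙ v)
    ... | inj₂ (inj₂ q) = v , Vv , q
    ... | inj₂ (inj₁ q) = contradiction q av≉0
    ... | inj₁ q        = (- 1#) *ᵥ v , *∈ sub (- 1#) Vv ,
                          <-resp (RealNumbers.refl ℝ) (trans (+-identityˡ _) (sym (flip v))) (<⇒0< q)
    negative : ∃ λ w → V w × 0# < - (a zero ∙ w)
    negative = let (w , Vw , q) = positive in (- 1#) *ᵥ w , *∈ sub (- 1#) Vw ,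
      <-resp (RealNumbers.refl ℝ) (sym (trans (-‿cong (flip w)) (-‿involutive _))) q
      where open import Algebra.Properties.Ring ring
  ... | no ¬c with em {Chamber V a (inside ∷ σ)}
  ...   | yes p = ≡.cong₂ ℤ._+_ (≡.sym (ind-yes (chamber-tail p))) (ind-no λ q → ¬c (chamber-between sub p q))
  ...   | no ¬p = ≡.trans (ℤ.+-identityˡ _) (≡.trans (ind-cong chamber-tail back) (≡.sym (ℤ.+-identityʳ _)))
    where
    back : Chamber V (a ∘ suc) σ → Chamber V a (outside ∷ σ)
    back c with chamber-split {a = a} c
    ... | inj₁ p        = contradiction p ¬p
    ... | inj₂ (inj₁ q) = q
    ... | inj₂ (inj₂ c) = contradiction c ¬c

  chambers : Pred (Vector Carrier d) 0ℓ → (Fin n → Vector Carrier d) → ℤ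
  chambers V a = Σₛ λ σ → ind (Chamber V a σ)

  OnSubset : (Fin n → Vector Carrier d) → Subset n → Pred (Vector Carrier d) 0ℓ
  OnSubset a S x = ∀ i → i ∈ S → a i ∙ x ≈ 0#

  parity : ℕ → ℤ
  parity k = -1ℤ ℤ.^ k

  -- Whitney's sum for the family `a` on `V`, evaluated at t = -1.
  Σ-parity : Pred (Vector Carrier d) 0ℓ → (Fin n → Vector Carrier d) → ℤ
  Σ-parity V a = Σₛ λ S → sgn S ℤ.* parity (dim (V ∩ OnSubset a S))

  Σ-parity-suc : ∀ (V : Pred (Vector Carrier d) 0ℓ) (a : Fin (suc n) → Vector Carrier d) →
    Σ-parity V a ≡ -1ℤ ℤ.* Σ-parity (V ∩ a zero ^⊥) (a ∘ suc) ℤ.+ Σ-parity V (a ∘ suc)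
  Σ-parity-suc {n = n} V a = ≡.cong₂ ℤ._+_
    (≡.trans
      (Σₛ-cong {n} λ S → ≡.trans
        (≡.cong (λ k → sgn (inside ∷ S) ℤ.* parity k) (dim-cong {P = V ∩ OnSubset a (inside ∷ S)}
            {(V ∩ a zero ^⊥) ∩ OnSubset (a ∘ suc) S}
          (λ x (Vx , e) → (Vx , e zero here) , λ i i∈S → e (suc i) (there i∈S))
          (λ x ((Vx , e₀) , e) → Vx , λ { zero here → e₀ ; (suc i) (there i∈S) → e i i∈S })))
        (ℤ.*-assoc -1ℤ (sgn S) _))
      (Σₛ-* -1ℤ (λ S → sgn S ℤ.* parity (dim ((V ∩ a zero ^⊥) ∩ OnSubset (a ∘ suc) S)))))
    (Σₛ-cong {n} λ S → ≡.cong (λ k → sgn S ℤ.* parity k)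
        (dim-cong {P = V ∩ OnSubset a (outside ∷ S)} {V ∩ OnSubset (a ∘ suc) S}
      (λ x (Vx , e) → Vx , λ i i∈S → e (suc i) (there i∈S))
      (λ x (Vx , e) → Vx , λ { (suc i) (there i∈S) → e i i∈S })))

  -- Induction on the family. If the first functional is nonzero somewhere on `V`, restriction loses
  -- one dimension, which accounts for the sign in the recursion. If it vanishes on `V`, strict
  -- signs leave no chamber, and in the sum the index sets with and without it cancel.
  zaslavsky : ∀ (V : Pred (Vector Carrier d) 0ℓ) (a : Fin n → Vector Carrier d) → IsSubspace V →
              parity (dim V) ℤ.* chambers V a ≡ Σ-parity V a
  zaslavsky {n = zero} V a sub = begin
    parity (dim V) ℤ.* ind (Chamber V a [])            ≡⟨ ≡.cong (parity (dim V) ℤ.*_)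
        (ind-yes ((λ _ → 0#) , 0∈ sub , λ ())) ⟩
    parity (dim V) ℤ.* 1ℤ                              ≡⟨ ℤ.*-comm (parity (dim V)) 1ℤ ⟩
    1ℤ ℤ.* parity (dim V)                              ≡⟨ ≡.cong (λ k → 1ℤ ℤ.* parity k)
        (dim-cong {P = V} {V ∩ OnSubset a []} (λ x Vx → Vx , λ _ ()) (λ x (Vx , _) → Vx)) ⟩
    1ℤ ℤ.* parity (dim (V ∩ OnSubset a []))            ∎
    where open ≡.≡-Reasoning
  zaslavsky {n = suc n} V a sub with em {∃ λ v → V v × a zero ∙ v ≉ 0#}
  ... | yes (v , Vv , av≉0) = begin
    parity (dim V) ℤ.* (Σₛ (λ σ → ind (Chamber V a (inside ∷ σ))) ℤ.+ Σₛ
        (λ σ → ind (Chamber V a (outside ∷ σ))))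
      ≡⟨ ≡.cong (parity (dim V) ℤ.*_) (≡.trans (≡.sym (Σₛ-+ (λ σ → ind (Chamber V a (inside ∷ σ)))
          (λ σ → ind (Chamber V a (outside ∷ σ)))))
           (≡.trans (Σₛ-cong {n} (chamber-deletion a sub Vv av≉0))
               (Σₛ-+ (λ σ → ind (Chamber V (a ∘ suc) σ)) (λ σ → ind (Chamber V₀ (a ∘ suc) σ))))) ⟩
    parity (dim V) ℤ.* (chambers V (a ∘ suc) ℤ.+ chambers V₀ (a ∘ suc))
      ≡⟨ ℤ.*-distribˡ-+ (parity (dim V)) _ _ ⟩
    parity (dim V) ℤ.* chambers V (a ∘ suc) ℤ.+ parity (dim V) ℤ.* chambers V₀ (a ∘ suc)
      ≡⟨ ≡.cong₂ ℤ._+_ (zaslavsky V (a ∘ suc) sub) restricted ⟩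
    Σ-parity V (a ∘ suc) ℤ.+ -1ℤ ℤ.* Σ-parity V₀ (a ∘ suc)
      ≡⟨ ℤ.+-comm (Σ-parity V (a ∘ suc)) _ ⟩
    -1ℤ ℤ.* Σ-parity V₀ (a ∘ suc) ℤ.+ Σ-parity V (a ∘ suc)
      ≡⟨ Σ-parity-suc V a ⟨
    Σ-parity V a ∎
    where
    open ≡.≡-Reasoning
    V₀ = V ∩ a zero ^⊥
    restricted : parity (dim V) ℤ.* chambers V₀ (a ∘ suc) ≡ -1ℤ ℤ.* Σ-parity V₀ (a ∘ suc)
    restricted = begin
      parity (dim V) ℤ.* chambers V₀ (a ∘ suc)
        ≡⟨ ≡.cong (λ k → parity k ℤ.* chambers V₀ (a ∘ suc)) (dim-∩⊥ (a zero) sub Vv av≉0) ⟩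
      -1ℤ ℤ.* parity (dim V₀) ℤ.* chambers V₀ (a ∘ suc)
        ≡⟨ ℤ.*-assoc -1ℤ (parity (dim V₀)) _ ⟩
      -1ℤ ℤ.* (parity (dim V₀) ℤ.* chambers V₀ (a ∘ suc))
        ≡⟨ ≡.cong (-1ℤ ℤ.*_) (zaslavsky V₀ (a ∘ suc) (∩⊥-subspace (a zero) sub)) ⟩
      -1ℤ ℤ.* Σ-parity V₀ (a ∘ suc) ∎
  ... | no none = begin
    parity (dim V) ℤ.* chambers V a
      ≡⟨ ≡.cong (parity (dim V) ℤ.*_) (Σₛ-0 {f = λ σ → ind (Chamber V a σ)} no-chamber) ⟩
    parity (dim V) ℤ.* 0ℤ
      ≡⟨ ℤ.*-zeroʳ (parity (dim V)) ⟩
    0ℤ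
      ≡⟨ cancel (Σ-parity V (a ∘ suc)) ⟨
    -1ℤ ℤ.* Σ-parity V (a ∘ suc) ℤ.+ Σ-parity V (a ∘ suc)
      ≡⟨ ≡.cong (λ z → -1ℤ ℤ.* z ℤ.+ Σ-parity V (a ∘ suc)) unrestricted ⟩
    -1ℤ ℤ.* Σ-parity (V ∩ a zero ^⊥) (a ∘ suc) ℤ.+ Σ-parity V (a ∘ suc)
      ≡⟨ Σ-parity-suc V a ⟨
    Σ-parity V a ∎
    where
    open ≡.≡-Reasoning
    cancel : ∀ z → -1ℤ ℤ.* z ℤ.+ z ≡ 0ℤ
    cancel = solve-∀
    on-a : ∀ x → V x → a zero ∙ x ≈ 0#
    on-a x Vx with (a zero ∙ x) ≟0
    ... | yes e = e
    ... | no ¬e = contradiction (x , Vx , ¬e) none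
    unrestricted : Σ-parity V (a ∘ suc) ≡ Σ-parity (V ∩ a zero ^⊥) (a ∘ suc)
    unrestricted = Σₛ-cong {n} λ S → ≡.cong (λ k → sgn S ℤ.* parity k)
      (dim-cong {P = V ∩ OnSubset (a ∘ suc) S} {(V ∩ a zero ^⊥) ∩ OnSubset (a ∘ suc) S}
          (λ x (Vx , e) → (Vx , on-a x Vx) , e) (λ x ((Vx , _) , e) → Vx , e))
    no-chamber : ∀ σ → ind (Chamber V a σ) ≡ 0ℤ
    no-chamber (inside  ∷ σ) = ind-no λ (x , Vx , p) → pos⇒≉ (p zero) (on-a x Vx)
    no-chamber (outside ∷ σ) = ind-no λ (x , Vx , p) → pos⇒≉ (p zero) (trans (-‿cong (on-a x Vx)) -0#≈0#)
      where open import Algebra.Properties.Ring ring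

-- Flats of codimension at most two and their Möbius values.

module Flats (em : ExcludedMiddle 0ℓ) (ℝ : RealNumbers) where
  open import Data.Fin.Base using (zero; suc)
  open import Data.Fin.Subset using (Subset; inside; outside; _∈_; _⊆_; _⊂_; ∣_∣; ⊥; ⁅_⁆)
  open import Data.Fin.Subset.Properties
    using (∉⊥; ⊥⊆; ∣⊥∣≡0; ∣⁅x⁆∣≡1; x∈⁅x⁆; x∈⁅y⁆⇒x≡y; p⊆q⇒∣p∣≤∣q∣; ⊆-antisym; p⊂q⇒∣p∣<∣q∣)
  open import Data.Integer.Base as ℤ using (ℤ; +_; 0ℤ; 1ℤ; -1ℤ)
  import Data.Integer.Properties as ℤ
  open import Data.Integer.Tactic.RingSolver using (solve-∀)
  open import Data.Nat.Base as ℕ using (ℕ; zero; suc; s≤s; z≤n)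
  import Data.Nat.Properties as ℕ
  open import Data.Product using (∃; _×_; _,_)
  open import Data.Vec.Base using (_∷_; []; here; there)
  open import Function.Base using (_∘_)
  open import Relation.Binary.PropositionalEquality as ≡ using (_≡_; _≢_; refl)
  open import Relation.Nullary using (¬_; yes; no; contradiction)
  open import Relation.Unary using (_∩_)
  open RealNumbers ℝ hiding (zero; refl)
  open Reals ℝ
  open Combinatorics em ℝ
  open SubsetSums em
  open OrderedField em ℝ
  open LinearAlgebra em ℝ
  open Mobius em ℝ
  open IsSubspace

  private variable n : ℕ

  -- A view that separates the index sets of the flats of codimension 0 and 1 from those whose
  -- intersection has codimension at least 2.
  data Small {n} : Subset n → Set where
    empty     : Small ⊥
    singleton : ∀ i → Small ⁅ i ⁆
    two       : ∀ {X i j} → i ≢ j → i ∈ X → j ∈ X → Small X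

  small : ∀ (X : Subset n) → Small X
  small [] = empty
  small (outside ∷ X) with small X
  ... | empty       = empty
  ... | singleton i = singleton (suc i)
  ... | two i≢j i∈ j∈ = two (λ { refl → i≢j refl }) (there i∈) (there j∈)
  small (inside ∷ X) with small X
  ... | empty       = singleton zero
  ... | singleton i = two {i = zero} {suc i} (λ ()) here (there (x∈⁅x⁆ i))
  ... | two i≢j i∈ j∈ = two (λ { refl → i≢j refl }) (there i∈) (there j∈)

  two-elements : ∀ {X : Subset n} {i j} → i ≢ j → i ∈ X → j ∈ X → 2 ℕ.≤ ∣ X ∣
  two-elements {X = X} {i} {j} i≢j i∈ j∈ = ≡.subst (ℕ._< ∣ X ∣) (∣⁅x⁆∣≡1 i)
    (p⊂q⇒∣p∣<∣q∣ {p = ⁅ i ⁆} {X} ((λ {x} x∈ → ≡.subst (_∈ X) (≡.sym (x∈⁅y⁆⇒x≡y i x∈)) i∈) , j , j∈ , λ j∈i → i≢j (≡.sym (x∈⁅y⁆⇒x≡y i j∈i))))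

  -- Only the empty set and the `∣ X ∣` singletons contribute.
  Σ⊆-size : ∀ (X : Subset n) (φ : ℕ → ℤ) → (∀ k → φ (suc (suc k)) ≡ 0ℤ) →
            Σₛ (λ Y → ind (Y ⊆ X) ℤ.* φ ∣ Y ∣) ≡ φ 0 ℤ.+ + ∣ X ∣ ℤ.* φ 1
  Σ⊆-size [] φ φ₂ = ≡.trans (ind-*-yes {[] ⊆ []} (φ 0) (λ ())) (≡.sym (ℤ.+-identityʳ _))
  Σ⊆-size (outside ∷ X) φ φ₂ = ≡.trans (Σ⊆-outside X (φ ∘ ∣_∣)) (Σ⊆-size X φ φ₂)
  Σ⊆-size (inside ∷ X) φ φ₂ = ≡.trans (Σ⊆-inside X (φ ∘ ∣_∣)) (≡.trans
    (≡.cong₂ ℤ._+_ (≡.trans (Σ⊆-size X (φ ∘ suc) (φ₂ ∘ suc))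
        (≡.cong (λ z → φ 1 ℤ.+ + ∣ X ∣ ℤ.* z) (φ₂ 0))) (Σ⊆-size X φ φ₂))
    (≡.trans (collect (φ 0) (φ 1) (+ ∣ X ∣)) (≡.cong (λ z → φ 0 ℤ.+ z ℤ.* φ 1) (≡.sym (ℤ.pos-+ 1 ∣ X ∣)))))
    where
    collect : ∀ a b x → b ℤ.+ x ℤ.* 0ℤ ℤ.+ (a ℤ.+ x ℤ.* b) ≡ a ℤ.+ (1ℤ ℤ.+ x) ℤ.* b
    collect = solve-∀

  module _ {d n : ℕ} (A : Arrangement d n) where
    open Arrangement A

    ⋂-subspace : ∀ S → IsSubspace (⋂ S)
    ⋂-subspace S = record
      { 0∈ = λ i _ → ∙-zero {a = normal i} (λ _ → RealNumbers.refl ℝ)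
      ; +∈ = λ p q i i∈ → trans (∙-+ (normal i) _ _) (trans (+-cong (p i i∈) (q i i∈)) (+-identityˡ _))
      ; *∈ = λ c p i i∈ → trans (∙-* (normal i) c _) (trans (*-congˡ (p i i∈)) (zeroʳ c))
      }

    dim-cut : ∀ S i → ¬ (∀ x → ⋂ S x → H i x) → dim (⋂ S) ≡ suc (dim (⋂ S ∩ H i))
    dim-cut S i ⊈ with em {∃ λ x → ⋂ S x × normal i ∙ x ≉ 0#}
    ... | yes (x , Sx , ≉0) = dim-∩⊥ (normal i) (⋂-subspace S) Sx ≉0
    ... | no none = contradiction (λ x Sx → on x Sx) ⊈
      where
      on : ∀ x → ⋂ S x → H i x
      on x Sx with (normal i ∙ x) ≟0
      ... | yes e = e
      ... | no ¬e = contradiction (x , Sx , ¬e) none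

    dim-⋂⊥ : dim (⋂ ⊥) ≡ d
    dim-⋂⊥ = ≡.trans (dim-cong {P = ⋂ ⊥} {everything} (λ _ _ → _) (λ x _ i i∈⊥ → contradiction i∈⊥ ∉⊥))
        dim-everything

    H-proper : ∀ {S} i → (∀ x → ⋂ S x) → ¬ (∀ x → ⋂ S x → H i x)
    H-proper i all ⊆H = nonzero i λ j → trans (sym (∙-δ (normal i) j)) (⊆H (δ j) (all (δ j)))

    on-⊥ : ∀ x → ⋂ ⊥ x
    on-⊥ x i i∈⊥ = contradiction i∈⊥ ∉⊥

    dim-H : ∀ i → suc (dim (H i)) ≡ d
    dim-H i = ≡.trans (≡.cong suc (dim-cong {P = H i} {⋂ ⊥ ∩ H i} (λ x Hx → on-⊥ x , Hx) (λ x (_ , Hx) → Hx)))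
      (≡.trans (≡.sym (dim-cut ⊥ i (H-proper i on-⊥))) dim-⋂⊥)

    on-⁅⁆ : ∀ {i} x → H i x → ⋂ ⁅ i ⁆ x
    on-⁅⁆ {i} x Hx j j∈ = ≡.subst (λ k → H k x) (≡.sym (x∈⁅y⁆⇒x≡y i j∈)) Hx

    dim-⁅⁆ : ∀ i → suc (dim (⋂ ⁅ i ⁆)) ≡ d
    dim-⁅⁆ i = ≡.trans (≡.cong suc (dim-cong {P = ⋂ ⁅ i ⁆} {H i} (λ x p → p i (x∈⁅x⁆ i)) on-⁅⁆)) (dim-H i)

    -- Two hyperplanes have the same dimension, so an inclusion is an equality.
    H⊆H⇒≡ : ∀ {i j} → (∀ x → H i x → H j x) → i ≡ j
    H⊆H⇒≡ {i} {j} Hi⊆Hj with em {i ≡ j}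
    ... | yes i≡j = i≡j
    ... | no  i≢j = contradiction ((λ {x} → Hi⊆Hj x) , λ {x} → Hj⊆Hi x) (distinct i≢j)
      where
      Hj⊆Hi : ∀ x → H j x → H i x
      Hj⊆Hi with em {∀ x → ⋂ ⁅ j ⁆ x → H i x}
      ... | yes p = λ x Hx → p x (on-⁅⁆ x Hx)
      ... | no ¬p = contradiction (≡.trans (dim-H i) (≡.sym (dim-⁅⁆ j)))
            (ℕ.<⇒≢ (s≤s (ℕ.≤-reflexive (≡.sym smaller))))
        where
        smaller : dim (⋂ ⁅ j ⁆) ≡ suc (dim (H i))
        smaller = ≡.trans (dim-cut ⁅ j ⁆ i ¬p) (≡.cong suc
          (dim-cong {P = ⋂ ⁅ j ⁆ ∩ H i} {H i} (λ x (_ , Hx) → Hx) (λ x Hx → on-⁅⁆ x (Hi⊆Hj x Hx) , Hx)))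

    closed-⊥ : Closed ⊥
    closed-⊥ i p = contradiction (λ x ⋂x → p {x} ⋂x) (H-proper i on-⊥)

    closed-⁅⁆ : ∀ i → Closed ⁅ i ⁆
    closed-⁅⁆ i j p with H⊆H⇒≡ {i} {j} (λ x Hx → p (on-⁅⁆ x Hx))
    ... | refl = x∈⁅x⁆ i

    -- Neither of two distinct hyperplanes contains the other, so the second one lowers the
    -- dimension again.
    dim-two : ∀ {X i j} → i ≢ j → i ∈ X → j ∈ X → 2 ℕ.+ dim (⋂ X) ℕ.≤ d
    dim-two {X} {i} {j} i≢j i∈ j∈ = ℕ.≤-trans (s≤s (s≤s
        (dim-mono {P = ⋂ X} {⋂ ⁅ i ⁆ ∩ H j} λ x Xx → on-⁅⁆ x (Xx i i∈) , Xx j j∈)))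
      (ℕ.≤-reflexive (≡.trans (≡.cong suc (≡.sym (dim-cut ⁅ i ⁆ j λ p → i≢j
          (H⊆H⇒≡ λ x Hx → p x (on-⁅⁆ x Hx))))) (dim-⁅⁆ i)))

    -- As `Y` is closed, the hyperplane of an index in `X` but not in `Y` does not contain `⋂ Y`,
    -- and cutting with it costs a dimension.
    dim-strict : ∀ {X Y} → Closed Y → Y ⊂ X → dim (⋂ X) ℕ.< dim (⋂ Y)
    dim-strict {X} {Y} closed (Y⊆X , i , i∈X , i∉Y) = ℕ.≤-trans
      (s≤s (dim-mono {P = ⋂ X} {⋂ Y ∩ H i} λ x Xx → ⋂-anti A Y⊆X x Xx , Xx i i∈X))
      (ℕ.≤-reflexive (≡.sym (dim-cut Y i λ p → i∉Y (closed i λ {x} → p x))))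

    -- The Möbius value by size of the index set for codimension 0 and 1, extended by zero because
    -- larger closed sets do not occur strictly below a flat of codimension two.
    φ : ℕ → ℤ
    φ 0 = 1ℤ
    φ 1 = -1ℤ
    φ (suc (suc _)) = 0ℤ

    μ-⁅⁆ : ∀ i → μ A ⁅ i ⁆ ≡ -1ℤ
    μ-⁅⁆ i = ≡.trans (μ-sum A (i , x∈⁅x⁆ i)) (≡.cong ℤ.-_
      (≡.trans (Σₛ-cong term) (Σₛ-≡ {n} ⊥ (λ _ → 1ℤ))))
      where
      term : ∀ Y → ind (Closed Y) ℤ.* (ind (Y ⊂ ⁅ i ⁆) ℤ.* μ A Y) ≡ ind (⊥ ≡ Y) ℤ.* 1ℤ
      term Y with em {⊥ ≡ Y}
      ... | yes refl = ≡.trans (ind-*-yes _ closed-⊥) (≡.trans (ind-*-yes _ (⊥⊆ , i , x∈⁅x⁆ i , ∉⊥)) (μ-⊥ A))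
      ... | no ⊥≢Y = ≡.trans (≡.cong (ind (Closed Y) ℤ.*_)
            (ind-*-no {Y ⊂ ⁅ i ⁆} (μ A Y) λ Y⊂ → ⊥≢Y (≡.sym (below Y⊂)))) (ℤ.*-zeroʳ (ind (Closed Y)))
        where
        below : Y ⊂ ⁅ i ⁆ → Y ≡ ⊥
        below (Y⊆ , j , j∈ , j∉Y) = ⊆-antisym (λ {k} k∈Y → contradiction (≡.subst (_∈ Y) (≡.trans (x∈⁅y⁆⇒x≡y i (Y⊆ k∈Y)) (≡.sym (x∈⁅y⁆⇒x≡y i j∈))) k∈Y) j∉Y) ⊥⊆

    μ-small : ∀ {Y} → Small Y → ∣ Y ∣ ℕ.< 2 → μ A Y ≡ φ ∣ Y ∣
    μ-small empty         _ = ≡.trans (μ-⊥ A) (≡.cong φ (≡.sym (∣⊥∣≡0 n)))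
    μ-small (singleton i) _ = ≡.trans (μ-⁅⁆ i) (≡.cong φ (≡.sym (∣⁅x⁆∣≡1 i)))
    μ-small (two i≢j i∈ j∈) lt = contradiction (two-elements i≢j i∈ j∈) (ℕ.<⇒≱ lt)

    closed-small : ∀ {Y} → Small Y → ∣ Y ∣ ℕ.< 2 → Closed Y
    closed-small empty         _ = closed-⊥
    closed-small (singleton i) _ = closed-⁅⁆ i
    closed-small (two i≢j i∈ j∈) lt = contradiction (two-elements i≢j i∈ j∈) (ℕ.<⇒≱ lt)

    dim-large : ∀ {Y} → 2 ℕ.≤ ∣ Y ∣ → 2 ℕ.+ dim (⋂ Y) ℕ.≤ d
    dim-large {Y} le with small Y
    ... | empty           = contradiction le (ℕ.<⇒≱ (ℕ.≤-trans (s≤s (ℕ.≤-reflexive (∣⊥∣≡0 n))) (s≤s z≤n)))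
    ... | singleton i     = contradiction le (ℕ.<⇒≱ (s≤s (ℕ.≤-reflexive (∣⁅x⁆∣≡1 i))))
    ... | two i≢j i∈ j∈ = dim-two i≢j i∈ j∈

    codim-two-large : ∀ {X} → 2 ℕ.+ dim (⋂ X) ≡ d → 2 ℕ.≤ ∣ X ∣
    codim-two-large {X} e with small X
    ... | empty         = contradiction (≡.trans e (≡.sym dim-⋂⊥)) (ℕ.>⇒≢ (s≤s (ℕ.n≤1+n _)))
    ... | singleton i   = contradiction (≡.trans e (≡.sym (dim-⁅⁆ i))) (ℕ.>⇒≢ ℕ.≤-refl)
    ... | two i≢j i∈ j∈ = two-elements i≢j i∈ j∈

    -- Strictly below `X` there are only the whole space, of value 1, and the `∣ X ∣` hyperplanes,
    -- of value -1. A closed proper subset with two elements would have dimension at most d - 2, yet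
    -- more than `⋂ X`, which has exactly that.
    μ-codim-two : ∀ {X} → 2 ℕ.+ dim (⋂ X) ≡ d → μ A X ≡ + ∣ X ∣ ℤ.- 1ℤ
    μ-codim-two {X} e with small X | codim-two-large {X} e
    ... | empty         | le = contradiction le (ℕ.<⇒≱ (ℕ.≤-trans (s≤s (ℕ.≤-reflexive (∣⊥∣≡0 n))) (s≤s z≤n)))
    ... | singleton i   | le = contradiction le (ℕ.<⇒≱ (s≤s (ℕ.≤-reflexive (∣⁅x⁆∣≡1 i))))
    ... | two {i = i} i≢j i∈ j∈ | 2≤∣X∣ = begin
      μ A X                                                                 ≡⟨ μ-sum A (i , i∈) ⟩
      ℤ.- Σₛ (λ Y → ind (Closed Y) ℤ.* (ind (Y ⊂ X) ℤ.* μ A Y))             ≡⟨ ≡.cong ℤ.-_ (Σₛ-cong term) ⟩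
      ℤ.- Σₛ (λ Y → ind (Y ⊆ X) ℤ.* φ ∣ Y ∣)
          ≡⟨ ≡.cong ℤ.-_ (Σ⊆-size X φ (λ _ → refl)) ⟩
      ℤ.- (1ℤ ℤ.+ + ∣ X ∣ ℤ.* -1ℤ)                                          ≡⟨ simplify (+ ∣ X ∣) ⟩
      + ∣ X ∣ ℤ.- 1ℤ                                                        ∎
      where
      open ≡.≡-Reasoning
      simplify : ∀ x → ℤ.- (1ℤ ℤ.+ x ℤ.* -1ℤ) ≡ x ℤ.- 1ℤ
      simplify = solve-∀
      φ-large : ∀ k → 2 ℕ.≤ k → φ k ≡ 0ℤ
      φ-large (suc (suc k)) _ = refl
      φ-large (suc zero) (s≤s ())
      term : ∀ Y → ind (Closed Y) ℤ.* (ind (Y ⊂ X) ℤ.* μ A Y) ≡ ind (Y ⊆ X) ℤ.* φ ∣ Y ∣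
      term Y with ∣ Y ∣ ℕ.<? 2
      ... | yes lt = ≡.trans (ind-*-yes _ (closed-small (small Y) lt)) (≡.cong₂ ℤ._*_
        (ind-cong {Y ⊂ X} {Y ⊆ X} (λ (Y⊆X , _) → Y⊆X) proper) (μ-small (small Y) lt))
        where
        proper : Y ⊆ X → Y ⊂ X
        proper Y⊆X with em {Y ⊂ X}
        ... | yes p = p
        ... | no ¬p = contradiction (p⊆q⇒∣p∣≤∣q∣ {p = X} {Y} X⊆Y) (ℕ.<⇒≱ (ℕ.≤-trans lt 2≤∣X∣))
          where
          X⊆Y : X ⊆ Y
          X⊆Y {j} j∈X with em {j ∈ Y}
          ... | yes j∈Y = j∈Y
          ... | no  j∉Y = contradiction ((λ {x} → Y⊆X {x}) , j , j∈X , j∉Y) ¬p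
      ... | no ≮ = ≡.trans zero-left (≡.sym (≡.trans (≡.cong (ind (Y ⊆ X) ℤ.*_)
            (φ-large ∣ Y ∣ (ℕ.≮⇒≥ ≮))) (ℤ.*-zeroʳ (ind (Y ⊆ X)))))
        where
        zero-left : ind (Closed Y) ℤ.* (ind (Y ⊂ X) ℤ.* μ A Y) ≡ 0ℤ
        zero-left = ≡.trans (ind-*-cong (Closed Y) {y = 0ℤ} λ cY → ind-*-no {Y ⊂ X} (μ A Y) λ Y⊂X →
          ℕ.<⇒≱ (dim-strict cY Y⊂X) (ℕ.+-cancelˡ-≤ 2 _ _
              (ℕ.≤-trans (dim-large (ℕ.≮⇒≥ ≮)) (ℕ.≤-reflexive (≡.sym e))))) (ℤ.*-zeroʳ (ind (Closed Y)))

-- Projective chambers as sign vectors up to antipodes.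

module Cells (em : ExcludedMiddle 0ℓ) (ℝ : RealNumbers) where
  open import Data.Bool.Base using (not)
  open import Data.Bool.Properties using (not-involutive)
  open import Data.Fin.Base using (Fin; zero; suc; splitAt; join; _↑ˡ_; _↑ʳ_)
  open import Data.Fin.Properties using (splitAt-↑ˡ; splitAt-↑ʳ; join-splitAt)
  open import Data.Fin.Subset using (Subset; inside; outside; ∁)
  open import Data.Integer.Base as ℤ using (ℤ; +_)
  import Data.Integer.Properties as ℤ
  open import Data.Integer.Tactic.RingSolver using (solve-∀)
  open import Data.Nat.Base as ℕ using (ℕ; zero; suc; s≤s; z≤n)
  import Data.Nat.Properties as ℕ
  open import Data.Product using (∃; _×_; _,_; proj₁; proj₂)
  open import Data.Sum using (_⊎_; inj₁; inj₂)
  open import Data.Vec.Base using (_∷_; []; lookup)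
  open import Data.Vec.Properties using (lookup-map; ∷-injectiveʳ; tabulate∘lookup; tabulate-cong)
  open import Data.Vec.Functional using (Vector)
  open import Function.Base using (_∘_)
  open import Function.Bundles using (_⇔_; mk⇔; Equivalence)
  open import Relation.Binary.PropositionalEquality as ≡ using (_≡_; refl)
  open import Relation.Nullary using (¬_; yes; no; contradiction)
  open RealNumbers ℝ hiding (zero; refl)
  open Reals ℝ
  open Combinatorics em ℝ
  open SubsetSums em
  open OrderedField em ℝ
  open LinearAlgebra em ℝ
  open Chambers em ℝ
  open Flats em ℝ
  open import Algebra.Properties.Ring ring

  private variable d m n : ℕ

  -- Combines the count as a sum of indicators, which the recursion for chambers delivers, with an
  -- explicit listing by `Fin size`, which `HasCells` asks for.
  record Enumeration (P : Subset m → Set) : Set where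
    field
      size       : ℕ
      size-Σ     : + size ≡ Σₛ (λ σ → ind (P σ))
      element    : Fin size → Subset m
      satisfies  : ∀ i → P (element i)
      injective  : ∀ {i j} → element i ≡ element j → i ≡ j
      complete   : ∀ σ → P σ → ∃ λ i → element i ≡ σ

  enumerate : ∀ {m} (P : Subset m → Set) → Enumeration P
  enumerate {zero} P with em {P []}
  ... | yes p = record
    { size = 1 ; size-Σ = ≡.sym (ind-yes p) ; element = λ _ → [] ; satisfies = λ _ → p
    ; injective = λ { {zero} {zero} _ → refl } ; complete = λ { [] _ → zero , refl } }
  ... | no ¬p = record
    { size = 0 ; size-Σ = ≡.sym (ind-no ¬p) ; element = λ () ; satisfies = λ ()
    ; injective = λ { {()} } ; complete = λ { [] p → contradiction p ¬p } }
  enumerate {suc m} P = record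
    { size      = I.size ℕ.+ O.size
    ; size-Σ    = ≡.trans (ℤ.pos-+ I.size O.size) (≡.cong₂ ℤ._+_ I.size-Σ O.size-Σ)
    ; element   = pick ∘ splitAt I.size
    ; satisfies = λ i → pick-satisfies (splitAt I.size i)
    ; injective = λ {i} {j} e → ≡.trans (≡.sym (join-splitAt I.size O.size i))
        (≡.trans (≡.cong (join I.size O.size) (pick-injective (splitAt I.size i) (splitAt I.size j) e))
            (join-splitAt I.size O.size j))
    ; complete  = λ where
        (inside ∷ σ) p → let (i , e) = I.complete σ p in
          i ↑ˡ O.size , ≡.trans (≡.cong pick (splitAt-↑ˡ I.size i O.size)) (≡.cong (inside ∷_) e)
        (outside ∷ σ) p → let (i , e) = O.complete σ p in
          I.size ↑ʳ i , ≡.trans (≡.cong pick (splitAt-↑ʳ I.size O.size i)) (≡.cong (outside ∷_) e)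
    }
    where
    module I = Enumeration (enumerate (P ∘ (inside ∷_)))
    module O = Enumeration (enumerate (P ∘ (outside ∷_)))
    pick : Fin I.size ⊎ Fin O.size → Subset (suc m)
    pick (inj₁ i) = inside ∷ I.element i
    pick (inj₂ i) = outside ∷ O.element i
    pick-satisfies : ∀ i → P (pick i)
    pick-satisfies (inj₁ i) = I.satisfies i
    pick-satisfies (inj₂ i) = O.satisfies i
    pick-injective : ∀ i j → pick i ≡ pick j → i ≡ j
    pick-injective (inj₁ i) (inj₁ j) e = ≡.cong inj₁ (I.injective (∷-injectiveʳ e))
    pick-injective (inj₂ i) (inj₂ j) e = ≡.cong inj₂ (O.injective (∷-injectiveʳ e))

  Σₛ-∁ : ∀ {m} (f : Subset m → ℤ) → Σₛ (f ∘ ∁) ≡ Σₛ f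
  Σₛ-∁ {zero}  f = refl
  Σₛ-∁ {suc m} f = ≡.trans (≡.cong₂ ℤ._+_ (Σₛ-∁ (f ∘ (outside ∷_))) (Σₛ-∁ (f ∘ (inside ∷_))))
      (ℤ.+-comm (Σₛ (f ∘ (outside ∷_))) _)

  negate : Vector Carrier d → Vector Carrier d
  negate x = (- 1#) *ᵥ x

  ∙-negate : ∀ (a x : Vector Carrier d) → a ∙ negate x ≈ - (a ∙ x)
  ∙-negate a x = trans (∙-* a (- 1#) x) (-1*x≈-x _)

  signed-not : ∀ s u → signed (not s) (- u) ≈ signed s u
  signed-not inside  u = -‿involutive u
  signed-not outside u = RealNumbers.refl ℝ

  signs-negate : ∀ (a : Fin n → Vector Carrier d) σ τ x → (∀ i → lookup τ i ≡ not (lookup σ i)) →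
                 HasSigns a σ x → HasSigns a τ (negate x)
  signs-negate a σ τ x e p i = <-resp (RealNumbers.refl ℝ)
    (sym (trans (signed-cong (lookup τ i) (∙-negate (a i) x))
      (trans (reflexive (≡.cong (λ s → signed s (- (a i ∙ x))) (e i))) (signed-not (lookup σ i) (a i ∙ x)))))
    (p i)

  lookup-∁ : ∀ (σ : Subset n) i → lookup (∁ σ) i ≡ not (lookup σ i)
  lookup-∁ σ i = lookup-map i not σ

  lookup-∁⁻ : ∀ (σ : Subset n) i → lookup σ i ≡ not (lookup (∁ σ) i)
  lookup-∁⁻ σ i = ≡.sym (≡.trans (≡.cong not (lookup-∁ σ i)) (not-involutive _))

  chamber-∁ : ∀ {a : Fin n → Vector Carrier d} σ → ind (Chamber everything a σ) ≡ ind
      (Chamber everything a (∁ σ))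
  chamber-∁ {a = a} σ = ind-cong
    (λ (x , _ , p) → negate x , _ , signs-negate a σ (∁ σ) x (lookup-∁ σ) p)
    (λ (x , _ , p) → negate x , _ , signs-negate a (∁ σ) σ x (lookup-∁⁻ σ) p)

  lookup-injective : ∀ {σ τ : Subset n} → (∀ i → lookup σ i ≡ lookup τ i) → σ ≡ τ
  lookup-injective e = ≡.trans (≡.sym (tabulate∘lookup _)) (≡.trans (tabulate-cong e) (tabulate∘lookup _))

  pos⇒¬neg : ∀ {u} → 0# < u → ¬ (u < 0#)
  pos⇒¬neg p q = <⇒≱ p (proj₁ q)

  signed-outside : ∀ {u} → 0# < - u → u < 0#
  signed-outside p = 0<⇒< (<-resp (RealNumbers.refl ℝ) (sym (+-identityˡ _)) p)

  same-sign : ∀ s {u w} → 0# < signed s u → 0# < signed s w → (0# < u ⇔ 0# < w) × (u < 0# ⇔ w < 0#)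
  same-sign inside  p q = mk⇔ (λ _ → q) (λ _ → p) , mk⇔ (λ p′ → contradiction p′ (pos⇒¬neg p))
      (λ q′ → contradiction q′ (pos⇒¬neg q))
  same-sign outside p q = mk⇔ (λ p′ → contradiction (signed-outside p) (pos⇒¬neg p′))
      (λ q′ → contradiction (signed-outside q) (pos⇒¬neg q′)) ,
                          mk⇔ (λ _ → signed-outside q) (λ _ → signed-outside p)

  sign-determined : ∀ s t {u w} → 0# < signed s u → 0# < signed t w → (0# < u ⇔ 0# < w) → s ≡ t
  sign-determined inside  inside  p q e = refl
  sign-determined outside outside p q e = refl
  sign-determined inside  outside p q e = contradiction (signed-outside q) (pos⇒¬neg (Equivalence.to e p))
  sign-determined outside inside  p q e = contradiction (signed-outside p) (pos⇒¬neg (Equivalence.from e q))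

  signs-exist : ∀ {n} (a : Fin n → Vector Carrier d) x → (∀ i → a i ∙ x ≉ 0#) → ∃ λ σ → HasSigns a σ x
  signs-exist {n = zero}  a x p = [] , λ ()
  signs-exist {n = suc n} a x p with signs-exist (a ∘ suc) x (p ∘ suc) | trichotomy (a zero ∙ x)
  ... | σ , q | inj₂ (inj₂ pos) = inside ∷ σ , λ { zero → pos ; (suc i) → q i }
  ... | σ , q | inj₂ (inj₁ e)   = contradiction e (p zero)
  ... | σ , q | inj₁ neg        = outside ∷ σ , λ { zero → <-resp (RealNumbers.refl ℝ) (+-identityˡ _) (<⇒0< neg) ; (suc i) → q i }

  signed-≉0 : ∀ s {u} → 0# < signed s u → u ≉ 0#
  signed-≉0 inside  p e = pos⇒≉ p e
  signed-≉0 outside p e = pos⇒≉ p (trans (-‿cong e) -0#≈0#)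

  module _ {k m : ℕ} (A : Arrangement (suc k) (suc m)) where
    open Arrangement A

    -- A projective chamber is an antipodal pair of cones; fixing the sign at the first hyperplane
    -- selects one cone of each pair.
    cells : Enumeration (λ σ → Chamber everything normal (inside ∷ σ))
    cells = enumerate (λ σ → Chamber everything normal (inside ∷ σ))

    open Enumeration cells

    -- The map x ↦ -x complements sign vectors, so it matches the chambers on the two sides of the
    -- first hyperplane.
    chambers-twice : chambers everything normal ≡ + 2 ℤ.* + size
    chambers-twice = ≡.trans
      (≡.cong₂ ℤ._+_ (≡.sym size-Σ) (≡.trans (Σₛ-cong λ σ → chamber-∁ {a = normal} (outside ∷ σ))
        (≡.trans (Σₛ-∁ (λ σ → ind (Chamber everything normal (inside ∷ σ)))) (≡.sym size-Σ))))
      (double (+ size))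
      where
      double : ∀ x → x ℤ.+ x ≡ + 2 ℤ.* x
      double = solve-∀

    Generic : Vector Carrier (suc k) → Set
    Generic x = ∀ i → normal i ∙ x ≉ 0#

    generic⇒nonzero : ∀ x → Generic x → ¬ IsZero x
    generic⇒nonzero x g z = g zero (∙-zero {a = normal zero} {x} z)

    generic⇒dim : ∀ x → Generic x → dim (support x) ≡ suc k
    generic⇒dim x g = ≡.trans (dim-cong {P = support x} {everything} (λ _ _ → _)
        (λ y _ i e → contradiction e (g i))) (dim-everything {suc k})

    -- The support of a point on `H i` lies within `H i`, whose dimension is only `k`.
    dim⇒generic : ∀ x → dim (support x) ≡ suc k → Generic x
    dim⇒generic x e i on = ℕ.<⇒≢ {dim (support x)} {suc k}
      (ℕ.≤-trans (s≤s (dim-mono {P = support x} {H i} λ y s → s i on)) (ℕ.≤-reflexive (dim-H A i))) e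

    signs⇒generic : ∀ σ x → HasSigns normal σ x → Generic x
    signs⇒generic σ x p i = signed-≉0 (lookup σ i) (p i)

    hasCells : HasCells A k size
    hasCells = record
      { to = λ i → point i , generic⇒nonzero (point i) (generic i) , generic⇒dim (point i) (generic i)
      ; cong = λ { refl → inj₁ λ i → mk⇔ (λ p → p) (λ p → p) , mk⇔ (λ p → p) (λ p → p) }
      ; bijective = (λ {i} {j} → inj {i} {j}) , λ (y , _ , e) → surj y (dim⇒generic y e)
      }
      where
      point : Fin size → Vector Carrier (suc k)
      point i = proj₁ (satisfies i)
      signs : ∀ i → HasSigns normal (inside ∷ element i) (point i)
      signs i = proj₂ (proj₂ (satisfies i))
      generic : ∀ i → Generic (point i)
      generic i = signs⇒generic (inside ∷ element i) (point i) (signs i)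
      inj : ∀ {i j} → SameCell (point i) (point j) → i ≡ j
      inj {i} {j} (inj₁ same) = injective (∷-injectiveʳ
          (lookup-injective {σ = inside ∷ element i} {inside ∷ element j} λ l →
        sign-determined _ _ (signs i l) (signs j l) (proj₁ (same l))))
      -- Both representatives are positive at the first hyperplane, so their signs cannot be
      -- opposite.
      inj {i} {j} (inj₂ opposite) = contradiction (Equivalence.to (proj₁ (opposite zero))
          (signs i zero)) (pos⇒¬neg (signs j zero))
      surj : ∀ y → Generic y → ∃ λ i → ∀ {j} → j ≡ i → SameCell (point j) y
      surj y g with signs-exist normal y g
      ... | inside ∷ σ , p with complete σ (y , _ , p)
      ...   | i , refl = i , λ { refl → inj₁ λ l → same-sign (lookup (inside ∷ σ) l) (signs i l) (p l) }
      -- A point negative at the first hyperplane is found through its antipode, whose sign vector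
      -- is listed.
      surj y g | outside ∷ σ , p with complete (∁ σ) (negate y , _ , signs-negate normal (outside ∷ σ)
          (∁ (outside ∷ σ)) y (lookup-∁ (outside ∷ σ)) p)
      ...   | i , e = i , λ { refl → inj₂ opposite }
        where
        opposite : OppositeSigns (point i) y
        opposite l with same-sign (lookup (inside ∷ element i) l) (signs i l)
          (≡.subst (λ τ → HasSigns normal τ (negate y)) (≡.cong (inside ∷_) (≡.sym e))
            (signs-negate normal (outside ∷ σ) (∁ (outside ∷ σ)) y (lookup-∁ (outside ∷ σ)) p) l)
        ... | P⇔ , N⇔ = mk⇔
            (λ q → signed-outside (<-resp (RealNumbers.refl ℝ) (∙-negate (normal l) y) (Equivalence.to P⇔ q)))
            (λ q → Equivalence.from P⇔ (<-resp (RealNumbers.refl ℝ)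
                (trans (+-identityˡ _) (sym (∙-negate (normal l) y))) (<⇒0< q)))
          , mk⇔
            (λ q → <-resp (RealNumbers.refl ℝ) (-‿involutive _) (negative→ (Equivalence.to N⇔ q)))
            (λ q → Equivalence.from N⇔ (signed-outside (<-resp (RealNumbers.refl ℝ)
                (sym (trans (-‿cong (∙-negate (normal l) y)) (-‿involutive _))) q)))
          where
          negative→ : normal l ∙ negate y < 0# → 0# < - - (normal l ∙ y)
          negative→ q = <-resp (RealNumbers.refl ℝ) (trans (+-identityˡ _)
              (-‿cong (∙-negate (normal l) y))) (<⇒0< q)

  -- Without hyperplanes the common intersection would be the whole space, which contains the
  -- nonzero vector `δ zero`.
  hyperplanes-exist : ∀ {k n} → Arrangement (suc k) n → 1 ℕ.≤ n
  hyperplanes-exist {n = zero}  A = contradiction (Arrangement.essential A (δ zero) (λ ()) zero) 1≉0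
  hyperplanes-exist {n = suc n} A = s≤s z≤n

  count-cells : ∀ {k n} (A : Arrangement (suc k) n) →
                ∃ λ f → HasCells A k f × chambers everything (Arrangement.normal A) ≡ + 2 ℤ.* + f
  count-cells {n = zero}  A = contradiction (hyperplanes-exist A) λ ()
  count-cells {n = suc n} A = Enumeration.size (cells A) , hasCells A , chambers-twice A

-- The coefficients of the characteristic polynomial.

module CharPoly (em : ExcludedMiddle 0ℓ) (ℝ : RealNumbers) where
  open import Data.Fin.Subset using (Subset; _⊆_; ∣_∣; Nonempty; ⊥; ⊤)
  open import Data.Fin.Subset.Properties using (∈⊤; ⊆⊤; ∣⊤∣≡n; ∣⊥∣≡0; ∣⁅x⁆∣≡1; ∣p∣≤n; _∈?_)
  open import Data.Fin.Base using (zero; suc)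
  open import Data.Integer.Base as ℤ using (ℤ; +_; 0ℤ; 1ℤ; -1ℤ)
  import Data.Integer.Properties as ℤ
  open import Data.Integer.Tactic.RingSolver using (solve-∀)
  open import Data.List.Base using (List; []; _∷_; map; filter; foldr; length; allFin)
  open import Data.List.Properties using (filter-≐)
  open import Data.List.Relation.Unary.All as All using (All; []; _∷_)
  open import Data.List.Relation.Unary.All.Properties using (all-filter)
  open import Data.Nat.Base as ℕ using (ℕ; zero; suc; s≤s)
  open import Data.Nat.ListAction using (sum)
  import Data.Nat.Properties as ℕ
  open import Data.Product using (_×_; _,_)
  open import Function.Base using (_∘_)
  open import Relation.Binary.PropositionalEquality as ≡ using (_≡_; _≢_; refl)
  open import Relation.Nullary using (yes; no)
  open import Relation.Unary using (_∩_)
  open RealNumbers ℝ using (1≉0)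
  open Reals ℝ
  open Combinatorics em ℝ
  open SubsetSums em hiding (interchange)
  open LinearAlgebra em ℝ
  open Mobius em ℝ
  open Flats em ℝ
  open Chambers em ℝ
  open Weights hiding (interchange)

  coeff-⊕ : ∀ p q k → coeff (p ⊕ q) k ≡ coeff p k ℤ.+ coeff q k
  coeff-⊕ []      q       k       = ≡.sym (ℤ.+-identityˡ _)
  coeff-⊕ (a ∷ p) []      k       = ≡.sym (ℤ.+-identityʳ _)
  coeff-⊕ (a ∷ p) (b ∷ q) zero    = refl
  coeff-⊕ (a ∷ p) (b ∷ q) (suc k) = coeff-⊕ p q k

  coeff-monomial : ∀ a j k → coeff (monomial a j) k ≡ ind (j ≡ k) ℤ.* a
  coeff-monomial a zero    zero    = ≡.sym (ind-*-yes a refl)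
  coeff-monomial a zero    (suc k) = ≡.sym (ind-*-no a λ ())
  coeff-monomial a (suc j) zero    = ≡.sym (ind-*-no a λ ())
  coeff-monomial a (suc j) (suc k) = ≡.trans (coeff-monomial a j k)
      (≡.cong (ℤ._* a) (ind-cong (≡.cong suc) ℕ.suc-injective))

  coeff-Σ : ∀ {A : Set} (f : A → Poly) xs k → coeff (foldr _⊕_ [] (map f xs)) k ≡ Σₗ (λ x → coeff (f x) k) xs
  coeff-Σ f []       k = refl
  coeff-Σ f (x ∷ xs) k = ≡.trans (coeff-⊕ (f x) _ k) (≡.cong (ℤ._+_ (coeff (f x) k)) (coeff-Σ f xs k))

  module _ {d n : ℕ} (A : Arrangement d n) where
    open Arrangement A

    coeff-χ : ∀ k → coeff (χ A) k ≡ Σₛ (λ X → ind (Closed X) ℤ.* (ind (dim (⋂ X) ≡ k) ℤ.* μ A X))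
    coeff-χ k = ≡.trans (coeff-Σ (λ X → monomial (μ A X) (dim (⋂ X))) (lattice A) k)
      (≡.trans (Σₗ-cong (λ X → coeff-monomial (μ A X) (dim (⋂ X)) k) (lattice A))
          (Σ-lattice A (λ X → ind (dim (⋂ X) ≡ k) ℤ.* μ A X)))

    coeff-χ-top : coeff (χ A) d ≡ 1ℤ
    coeff-χ-top = ≡.trans (coeff-χ d) (≡.trans (Σₛ-cong term) (Σₛ-≡ {n} ⊥ (λ _ → 1ℤ)))
      where
      term : ∀ X → ind (Closed X) ℤ.* (ind (dim (⋂ X) ≡ d) ℤ.* μ A X) ≡ ind (⊥ ≡ X) ℤ.* 1ℤ
      term X with em {⊥ ≡ X}
      ... | yes refl = ≡.trans (ind-*-yes _ (closed-⊥ A)) (≡.trans (ind-*-yes _ (dim-⋂⊥ A)) (μ-⊥ A))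
      ... | no ⊥≢X = ≡.trans (≡.cong (ind (Closed X) ℤ.*_) (ind-*-no (μ A X) (lower (small X) ⊥≢X)))
            (ℤ.*-zeroʳ (ind (Closed X)))
        where
        lower : ∀ {X} → Small X → ⊥ ≢ X → dim (⋂ X) ≢ d
        lower empty           ⊥≢⊥ _ = ⊥≢⊥ refl
        lower (singleton i)   _   e = ℕ.<⇒≢ (ℕ.≤-reflexive (dim-⁅⁆ A i)) e
        lower (two i≢j i∈ j∈) _   e = ℕ.<⇒≢ (ℕ.≤-trans (ℕ.n≤1+n _) (dim-two A i≢j i∈ j∈)) e

    -- The flats of codimension one are exactly the singletons, each of Möbius value -1; `ψ`
    -- isolates them by size.
    coeff-χ-hyperplanes : ∀ k → suc k ≡ d → coeff (χ A) k ≡ ℤ.- + n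
    coeff-χ-hyperplanes k 1+k≡d = begin
      coeff (χ A) k
        ≡⟨ coeff-χ k ⟩
      Σₛ (λ X → ind (Closed X) ℤ.* (ind (dim (⋂ X) ≡ k) ℤ.* μ A X))
        ≡⟨ Σₛ-cong {n} (λ X → ≡.trans (term (small X)) (≡.sym (ind-*-yes {X ⊆ ⊤} (ψ ∣ X ∣) ⊆⊤))) ⟩
      Σₛ {n} (λ X → ind (X ⊆ ⊤) ℤ.* ψ ∣ X ∣)
        ≡⟨ Σ⊆-size (⊤ {n}) ψ (λ _ → refl) ⟩
      0ℤ ℤ.+ + ∣ ⊤ {n} ∣ ℤ.* -1ℤ
        ≡⟨ ≡.cong (λ m → 0ℤ ℤ.+ + m ℤ.* -1ℤ) (∣⊤∣≡n n) ⟩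
      0ℤ ℤ.+ + n ℤ.* -1ℤ
        ≡⟨ simplify (+ n) ⟩
      ℤ.- + n ∎
      where
      open ≡.≡-Reasoning
      simplify : ∀ x → 0ℤ ℤ.+ x ℤ.* -1ℤ ≡ ℤ.- x
      simplify = solve-∀
      ψ : ℕ → ℤ
      ψ 1 = -1ℤ
      ψ _ = 0ℤ
      ψ-large : ∀ m → 2 ℕ.≤ m → 0ℤ ≡ ψ m
      ψ-large (suc zero) (s≤s ())
      ψ-large (suc (suc m)) _ = refl
      vanish : ∀ {X} → dim (⋂ X) ≢ k → ind (Closed X) ℤ.* (ind (dim (⋂ X) ≡ k) ℤ.* μ A X) ≡ 0ℤ
      vanish {X} ≢ = ≡.trans (≡.cong (ind (Closed X) ℤ.*_) (ind-*-no (μ A X) ≢)) (ℤ.*-zeroʳ (ind (Closed X)))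
      term : ∀ {X} → Small X → ind (Closed X) ℤ.* (ind (dim (⋂ X) ≡ k) ℤ.* μ A X) ≡ ψ ∣ X ∣
      term empty = ≡.trans (vanish {⊥} λ e → ℕ.<⇒≢ (ℕ.≤-reflexive (≡.trans (≡.cong suc e) 1+k≡d))
          (dim-⋂⊥ A)) (≡.cong ψ (≡.sym (∣⊥∣≡0 n)))
      term (singleton i) = ≡.trans (ind-*-yes _ (closed-⁅⁆ A i))
          (≡.trans (ind-*-yes _ (ℕ.suc-injective (≡.trans (dim-⁅⁆ A i) (≡.sym 1+k≡d))))
        (≡.trans (μ-⁅⁆ A i) (≡.cong ψ (≡.sym (∣⁅x⁆∣≡1 i)))))
      term {X} (two i≢j i∈ j∈) = ≡.trans
        (vanish {X} λ e → ℕ.<⇒≢ (dim-two A i≢j i∈ j∈) (≡.trans (≡.cong suc e) 1+k≡d))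
        (ψ-large ∣ X ∣ (two-elements i≢j i∈ j∈))

    -- Weighted by 1, every index set contributes its sign whatever its closure, and the signs of
    -- all subsets of a nonempty set cancel.
    Σ-μ-sum : 1 ℕ.≤ n → Σₛ (λ X → ind (Closed X) ℤ.* (1ℤ ℤ.* μ A X)) ≡ 0ℤ
    Σ-μ-sum 1≤n = ≡.trans (Σ-μ A (λ _ → 1ℤ)) (≡.trans
      (Σₛ-cong {n} λ S → ≡.cong (ℤ._* sgn S) (≡.sym (ind-yes {S ⊆ ⊤} ⊆⊤)))
      (Σ⊆-sgn-nonempty {X = ⊤} (nonempty 1≤n)))
      where
      nonempty : ∀ {n} → 1 ℕ.≤ n → Nonempty (⊤ {n})
      nonempty (s≤s _) = zero , ∈⊤

    dim-⋂≤d : ∀ X → dim (⋂ X) ℕ.≤ d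
    dim-⋂≤d X = independent-bounded {P = ⋂ X} (dim-independent (⋂ X))

    coeff-χ-large : ∀ k → d ℕ.< k → coeff (χ A) k ≡ 0ℤ
    coeff-χ-large k d<k = ≡.trans (coeff-χ k) (Σₛ-0 λ X → ≡.trans
      (≡.cong (ind (Closed X) ℤ.*_) (ind-*-no (μ A X) (ℕ.<⇒≢ (ℕ.≤-<-trans (dim-⋂≤d X) d<k))))
          (ℤ.*-zeroʳ (ind (Closed X))))

    -- An index set and its closure cut out the same subspace, which turns the sum over flats into
    -- `Σ-parity` on the whole space.
    Σ-μ-parity : Σₛ (λ X → ind (Closed X) ℤ.* (parity (dim (⋂ X)) ℤ.* μ A X)) ≡ parity d ℤ.* chambers
        everything normal
    Σ-μ-parity = begin
      Σₛ (λ X → ind (Closed X) ℤ.* (parity (dim (⋂ X)) ℤ.* μ A X))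
        ≡⟨ Σ-μ A (λ X → parity (dim (⋂ X))) ⟩
      Σₛ (λ S → parity (dim (⋂ (cl A S))) ℤ.* sgn S)
        ≡⟨ Σₛ-cong (λ S → ≡.trans (ℤ.*-comm _ (sgn S)) (≡.cong (λ k → sgn S ℤ.* parity k)
             (dim-cong {P = ⋂ (cl A S)} {everything ∩ OnSubset normal S}
                 (λ x p → _ , ⋂-anti A (S⊆cl A S) x p) (λ x (_ , p) → ⋂-cl A S x p)))) ⟩
      Σ-parity everything normal
        ≡⟨ zaslavsky everything normal everything-subspace ⟨
      parity (dim (everything {d})) ℤ.* chambers everything normal
        ≡⟨ ≡.cong (λ k → parity k ℤ.* chambers everything normal) (dim-everything {d}) ⟩
      parity d ℤ.* chambers everything normal ∎
      where open ≡.≡-Reasoning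

  module _ {n : ℕ} (A : Arrangement 4 n) where
    open Arrangement A

    lines : List (Subset n)
    lines = filter (λ X → dim (⋂ X) ℕ.≟ 2) (lattice A)

    -- These bounds guarantee that the truncated sums defining `h` and `g₁` reach every line.
    lines-weight : All (λ X → 2 ℕ.≤ ∣ X ∣ × ∣ X ∣ ℕ.< 2 ℕ.+ n) lines
    lines-weight = All.map
      (λ {X} e → codim-two-large A (≡.cong (2 ℕ.+_) e) , s≤s (ℕ.≤-trans (∣p∣≤n X) (ℕ.n≤1+n n)))
      (all-filter (λ X → dim (⋂ X) ℕ.≟ 2) (lattice A))

    h≡sum : h A ≡ sum (map ((ℕ._∸ 1) ∘ ∣_∣) lines)
    h≡sum = sum-by-weight ∣_∣ (ℕ._∸ 1) lines lines-weight

    h+g₁ : h A ℕ.+ g₁ A ≡ restrictionSum A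
    h+g₁ = begin
      h A ℕ.+ g₁ A
        ≡⟨ ≡.cong₂ ℕ._+_ h≡sum (sum-by-weight ∣_∣ (λ _ → 1) lines lines-weight) ⟩
      sum (map ((ℕ._∸ 1) ∘ ∣_∣) lines) ℕ.+ sum (map (λ _ → 1) lines)
        ≡⟨ sum-pred ∣_∣ lines lines-weight ⟩
      sum (map ∣_∣ lines)
        ≡⟨ sum-incidences lines ⟨
      sum (map (λ i → length (filter (i ∈?_) lines)) (allFin n))
        ≡⟨ ≡.cong (λ L → sum (map (λ i → length (filter (i ∈?_) L)) (allFin n))) codimTwo≡lines ⟨
      restrictionSum A ∎
      where
      open ≡.≡-Reasoning
      codimTwo≡lines : codimTwo A ≡ lines
      codimTwo≡lines = filter-≐ (λ X → dim (⋂ X) ℕ.+ 2 ℕ.≟ 4) (λ X → dim (⋂ X) ℕ.≟ 2)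
        ((λ {X} e → ℕ.+-cancelʳ-≡ 2 (dim (⋂ X)) 2 e) , (λ e → ≡.cong (ℕ._+ 2) e)) (lattice A)

    restriction-formula : + h A ≡ + restrictionSum A ℤ.- + g₁ A
    restriction-formula = begin
      + h A                               ≡⟨ cancel (+ h A) (+ g₁ A) ⟩
      + h A ℤ.+ + g₁ A ℤ.- + g₁ A         ≡⟨ ≡.cong (λ m → + m ℤ.- + g₁ A) h+g₁ ⟩
      + restrictionSum A ℤ.- + g₁ A       ∎
      where
      open ≡.≡-Reasoning
      cancel : ∀ a b → a ≡ a ℤ.+ b ℤ.- b
      cancel = solve-∀

    +h≡Σ : + h A ≡ Σₛ (λ X → ind (Closed X) ℤ.* (ind (dim (⋂ X) ≡ 2) ℤ.* + (∣ X ∣ ℕ.∸ 1)))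
    +h≡Σ = begin
      + h A                                            ≡⟨ ≡.cong +_ h≡sum ⟩
      + sum (map ((ℕ._∸ 1) ∘ ∣_∣) lines)               ≡⟨ +-sum lines ⟩
      Σₗ (λ X → + (∣ X ∣ ℕ.∸ 1)) lines                 ≡⟨ Σₗ-filter (λ X → dim (⋂ X) ℕ.≟ 2)
          (λ X → + (∣ X ∣ ℕ.∸ 1)) (lattice A) ⟩
      Σₗ (λ X → ind (dim (⋂ X) ≡ 2) ℤ.* + (∣ X ∣ ℕ.∸ 1)) (lattice A)
        ≡⟨ Σ-lattice A (λ X → ind (dim (⋂ X) ≡ 2) ℤ.* + (∣ X ∣ ℕ.∸ 1)) ⟩
      Σₛ (λ X → ind (Closed X) ℤ.* (ind (dim (⋂ X) ≡ 2) ℤ.* + (∣ X ∣ ℕ.∸ 1))) ∎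
      where
      open ≡.≡-Reasoning
      +-sum : ∀ (L : List (Subset n)) → + sum (map ((ℕ._∸ 1) ∘ ∣_∣) L) ≡ Σₗ (λ X → + (∣ X ∣ ℕ.∸ 1)) L
      +-sum []      = refl
      +-sum (X ∷ L) = ≡.trans (ℤ.pos-+ (∣ X ∣ ℕ.∸ 1) _) (≡.cong (ℤ._+_ (+ (∣ X ∣ ℕ.∸ 1))) (+-sum L))

    coeff-χ-lines : coeff (χ A) 2 ≡ + h A
    coeff-χ-lines = ≡.trans (coeff-χ A 2) (≡.trans (Σₛ-cong term) (≡.sym +h≡Σ))
      where
      pred : ∀ m → 2 ℕ.≤ m → + m ℤ.- 1ℤ ≡ + (m ℕ.∸ 1)
      pred (suc m) _ = refl
      term : ∀ X → ind (Closed X) ℤ.* (ind (dim (⋂ X) ≡ 2) ℤ.* μ A X) ≡ ind (Closed X) ℤ.*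
          (ind (dim (⋂ X) ≡ 2) ℤ.* + (∣ X ∣ ℕ.∸ 1))
      term X = ≡.cong (ind (Closed X) ℤ.*_) (ind-*-cong (dim (⋂ X) ≡ 2) λ e →
        ≡.trans (μ-codim-two A {X} (≡.cong (2 ℕ.+_) e)) (pred ∣ X ∣ (codim-two-large A (≡.cong (2 ℕ.+_) e))))

    -- The flats are collected by dimension. With `g k` the k-th power of t, the left side is χ(t);
    -- the uses are t = 1 and t = -1.
    Σ-coefficients : ∀ (g : ℕ → ℤ) →
      g 0 ℤ.* coeff (χ A) 0 ℤ.+ (g 1 ℤ.* coeff (χ A) 1 ℤ.+
          (g 2 ℤ.* coeff (χ A) 2 ℤ.+ (g 3 ℤ.* coeff (χ A) 3 ℤ.+ g 4 ℤ.* coeff (χ A) 4))) ≡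
      Σₛ (λ X → ind (Closed X) ℤ.* (g (dim (⋂ X)) ℤ.* μ A X))
    Σ-coefficients g = ≡.sym (begin
      Σₛ (λ X → ind (Closed X) ℤ.* (g (dim (⋂ X)) ℤ.* μ A X))
        ≡⟨ Σₛ-cong (λ X → pick (dim (⋂ X)) (dim-⋂≤d A X) (ind (Closed X)) (μ A X)) ⟩
      Σₛ (λ X → s 0 X ℤ.+ (s 1 X ℤ.+ (s 2 X ℤ.+ (s 3 X ℤ.+ s 4 X))))
        ≡⟨ split (s 0) _ (split (s 1) _ (split (s 2) _ (split (s 3) (s 4) refl))) ⟩
      Σₛ (s 0) ℤ.+ (Σₛ (s 1) ℤ.+ (Σₛ (s 2) ℤ.+ (Σₛ (s 3) ℤ.+ Σₛ (s 4))))
        ≡⟨ ≡.cong₂ ℤ._+_ (out 0) (≡.cong₂ ℤ._+_ (out 1)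
            (≡.cong₂ ℤ._+_ (out 2) (≡.cong₂ ℤ._+_ (out 3) (out 4)))) ⟩
      g 0 ℤ.* coeff (χ A) 0 ℤ.+ (g 1 ℤ.* coeff (χ A) 1 ℤ.+
          (g 2 ℤ.* coeff (χ A) 2 ℤ.+ (g 3 ℤ.* coeff (χ A) 3 ℤ.+ g 4 ℤ.* coeff (χ A) 4))) ∎)
      where
      open ≡.≡-Reasoning
      s : ℕ → Subset n → ℤ
      s k X = g k ℤ.* (ind (Closed X) ℤ.* (ind (dim (⋂ X) ≡ k) ℤ.* μ A X))
      out : ∀ k → Σₛ (s k) ≡ g k ℤ.* coeff (χ A) k
      out k = ≡.trans (Σₛ-* (g k) (λ X → ind (Closed X) ℤ.* (ind (dim (⋂ X) ≡ k) ℤ.* μ A X)))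
          (≡.cong (g k ℤ.*_) (≡.sym (coeff-χ A k)))
      split : ∀ (f f′ : Subset n → ℤ) {z} → Σₛ f′ ≡ z → Σₛ (λ X → f X ℤ.+ f′ X) ≡ Σₛ f ℤ.+ z
      split f f′ e = ≡.trans (Σₛ-+ f f′) (≡.cong (ℤ._+_ (Σₛ f)) e)
      one : ∀ k c m → g k ℤ.* (c ℤ.* (ind (k ≡ k) ℤ.* m)) ≡ c ℤ.* (g k ℤ.* m)
      one k c m = ≡.trans (≡.cong (λ z → g k ℤ.* (c ℤ.* z)) (ind-*-yes m refl)) (swap (g k) c m)
        where
        swap : ∀ a c m → a ℤ.* (c ℤ.* m) ≡ c ℤ.* (a ℤ.* m)
        swap = solve-∀
      none : ∀ {j} k c m → j ≢ k → g k ℤ.* (c ℤ.* (ind (j ≡ k) ℤ.* m)) ≡ 0ℤ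
      none k c m j≢k = ≡.trans (≡.cong (λ z → g k ℤ.* (c ℤ.* z)) (ind-*-no m j≢k))
          (≡.trans (≡.cong (g k ℤ.*_) (ℤ.*-zeroʳ c)) (ℤ.*-zeroʳ (g k)))
      pick : ∀ j → j ℕ.≤ 4 → ∀ c m → c ℤ.* (g j ℤ.* m) ≡
        g 0 ℤ.* (c ℤ.* (ind (j ≡ 0) ℤ.* m)) ℤ.+ (g 1 ℤ.* (c ℤ.* (ind (j ≡ 1) ℤ.* m)) ℤ.+
            (g 2 ℤ.* (c ℤ.* (ind (j ≡ 2) ℤ.* m))
          ℤ.+ (g 3 ℤ.* (c ℤ.* (ind (j ≡ 3) ℤ.* m)) ℤ.+ g 4 ℤ.* (c ℤ.* (ind (j ≡ 4) ℤ.* m)))))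
      pick 0 _ c m rewrite one 0 c m | none {0} 1 c m (λ ()) | none {0} 2 c m (λ ()) | none {0} 3 c m
          (λ ()) | none {0} 4 c m (λ ()) = ≡.sym (ℤ.+-identityʳ _)
      pick 1 _ c m rewrite one 1 c m | none {1} 0 c m (λ ()) | none {1} 2 c m (λ ()) | none {1} 3 c m
          (λ ()) | none {1} 4 c m (λ ()) = ≡.sym (≡.trans (ℤ.+-identityˡ _) (ℤ.+-identityʳ _))
      pick 2 _ c m rewrite one 2 c m | none {2} 0 c m (λ ()) | none {2} 1 c m (λ ()) | none {2} 3 c m
          (λ ()) | none {2} 4 c m (λ ()) = ≡.sym (≡.trans (ℤ.+-identityˡ _)
              (≡.trans (ℤ.+-identityˡ _) (ℤ.+-identityʳ _)))
      pick 3 _ c m rewrite one 3 c m | none {3} 0 c m (λ ()) | none {3} 1 c m (λ ()) | none {3} 2 c m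
          (λ ()) | none {3} 4 c m (λ ()) = ≡.sym (≡.trans (ℤ.+-identityˡ _)
              (≡.trans (ℤ.+-identityˡ _) (≡.trans (ℤ.+-identityˡ _) (ℤ.+-identityʳ _))))
      pick 4 _ c m rewrite one 4 c m | none {4} 0 c m (λ ()) | none {4} 1 c m (λ ()) | none {4} 2 c m
          (λ ()) | none {4} 3 c m (λ ()) = ≡.sym (≡.trans (ℤ.+-identityˡ _)
              (≡.trans (ℤ.+-identityˡ _) (≡.trans (ℤ.+-identityˡ _) (ℤ.+-identityˡ _))))
      pick (suc (suc (suc (suc (suc _))))) (s≤s (s≤s (s≤s (s≤s ()))))

    χ-factorisation : ∀ f₃ → 1 ℕ.≤ n → chambers everything normal ≡ + 2 ℤ.* + f₃ →
      χ A ≋ (ℤ.- 1ℤ ∷ 1ℤ ∷ []) ⊗ (+ h A ℤ.+ 1ℤ ℤ.- + f₃ ∷ + h A ℤ.+ 1ℤ ℤ.- + n ∷ 1ℤ ℤ.- + n ∷ 1ℤ ∷ [])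
    χ-factorisation f₃ 1≤n count = λ where
        0 → ≡.trans c₀ (p₀ (+ h A) (+ f₃))
        1 → ≡.trans c₁ (p₁ (+ h A) (+ f₃) (+ n))
        2 → ≡.trans c₂ (p₂ (+ h A) (+ n))
        3 → ≡.trans c₃ (p₃ (+ n))
        4 → c₄
        (suc (suc (suc (suc (suc k))))) → coeff-χ-large A (5 ℕ.+ k) (ℕ.m≤m+n 5 k)
      where
      c₂ = coeff-χ-lines
      c₃ : coeff (χ A) 3 ≡ ℤ.- + n
      c₃ = coeff-χ-hyperplanes A 3 refl
      c₄ : coeff (χ A) 4 ≡ 1ℤ
      c₄ = coeff-χ-top A
      x = coeff (χ A) 0
      y = coeff (χ A) 1
      at-1 : 1ℤ ℤ.* x ℤ.+ (1ℤ ℤ.* y ℤ.+ (1ℤ ℤ.* + h A ℤ.+ (1ℤ ℤ.* (ℤ.- + n) ℤ.+ 1ℤ ℤ.* 1ℤ))) ≡ 0ℤ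
      at-1 = ≡.subst₂ (λ a b → 1ℤ ℤ.* x ℤ.+ (1ℤ ℤ.* y ℤ.+ (1ℤ ℤ.* a ℤ.+ (1ℤ ℤ.* b ℤ.+ 1ℤ ℤ.* 1ℤ))) ≡ 0ℤ) c₂ c₃
        (≡.subst (λ c → 1ℤ ℤ.* x ℤ.+ (1ℤ ℤ.* y ℤ.+ (1ℤ ℤ.* coeff (χ A) 2 ℤ.+
            (1ℤ ℤ.* coeff (χ A) 3 ℤ.+ 1ℤ ℤ.* c))) ≡ 0ℤ) c₄
          (≡.trans (Σ-coefficients (λ _ → 1ℤ)) (Σ-μ-sum A 1≤n)))
      at--1 : 1ℤ ℤ.* x ℤ.+ (-1ℤ ℤ.* y ℤ.+ (1ℤ ℤ.* + h A ℤ.+ (-1ℤ ℤ.* (ℤ.- + n) ℤ.+ 1ℤ ℤ.* 1ℤ))) ≡ 1ℤ ℤ.*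
          (+ 2 ℤ.* + f₃)
      at--1 = ≡.subst₂ (λ a b → 1ℤ ℤ.* x ℤ.+ (-1ℤ ℤ.* y ℤ.+ (1ℤ ℤ.* a ℤ.+ (-1ℤ ℤ.* b ℤ.+ 1ℤ ℤ.* 1ℤ))) ≡
          1ℤ ℤ.* (+ 2 ℤ.* + f₃)) c₂ c₃
        (≡.subst₂ (λ c z → 1ℤ ℤ.* x ℤ.+ (-1ℤ ℤ.* y ℤ.+ (1ℤ ℤ.* coeff (χ A) 2 ℤ.+
            (-1ℤ ℤ.* coeff (χ A) 3 ℤ.+ 1ℤ ℤ.* c))) ≡ 1ℤ ℤ.* z) c₄ count
          (≡.trans (Σ-coefficients parity) (Σ-μ-parity A)))
      -- Adding the values at 1 and -1 eliminates the linear and the cubic coefficient; the result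
      -- is twice the constant one plus known terms.
      c₀ : x ≡ + f₃ ℤ.- + h A ℤ.- 1ℤ
      c₀ = ℤ.*-cancelˡ-≡ (+ 2) _ _ (≡.trans (add x y (+ h A) (+ n))
          (≡.trans (≡.cong₂ (λ u v → u ℤ.+ v ℤ.- + 2 ℤ.* + h A ℤ.- + 2) at-1 at--1) (sub (+ f₃) (+ h A))))
        where
        add : ∀ x y h n → + 2 ℤ.* x ≡ (1ℤ ℤ.* x ℤ.+ (1ℤ ℤ.* y ℤ.+
            (1ℤ ℤ.* h ℤ.+ (1ℤ ℤ.* (ℤ.- n) ℤ.+ 1ℤ ℤ.* 1ℤ))))
          ℤ.+ (1ℤ ℤ.* x ℤ.+ (-1ℤ ℤ.* y ℤ.+ (1ℤ ℤ.* h ℤ.+ (-1ℤ ℤ.* (ℤ.- n) ℤ.+ 1ℤ ℤ.* 1ℤ)))) ℤ.- + 2 ℤ.*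
              h ℤ.- + 2
        add = solve-∀
        sub : ∀ f h → 0ℤ ℤ.+ 1ℤ ℤ.* (+ 2 ℤ.* f) ℤ.- + 2 ℤ.* h ℤ.- + 2 ≡ + 2 ℤ.* (f ℤ.- h ℤ.- 1ℤ)
        sub = solve-∀
      c₁ : y ≡ + n ℤ.- + f₃
      c₁ = ≡.trans (isolate x y (+ h A) (+ n)) (≡.trans
          (≡.cong₂ (λ u v → u ℤ.- v ℤ.- + h A ℤ.+ + n ℤ.- 1ℤ) at-1 c₀) (sub (+ f₃) (+ h A) (+ n)))
        where
        isolate : ∀ x y h n → y ≡ (1ℤ ℤ.* x ℤ.+ (1ℤ ℤ.* y ℤ.+
            (1ℤ ℤ.* h ℤ.+ (1ℤ ℤ.* (ℤ.- n) ℤ.+ 1ℤ ℤ.* 1ℤ)))) ℤ.- x ℤ.- h ℤ.+ n ℤ.- 1ℤ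
        isolate = solve-∀
        sub : ∀ f h n → 0ℤ ℤ.- (f ℤ.- h ℤ.- 1ℤ) ℤ.- h ℤ.+ n ℤ.- 1ℤ ≡ n ℤ.- f
        sub = solve-∀
      p₀ : ∀ h f → f ℤ.- h ℤ.- 1ℤ ≡ ℤ.- 1ℤ ℤ.* (h ℤ.+ 1ℤ ℤ.- f) ℤ.+ 0ℤ
      p₀ = solve-∀
      p₁ : ∀ h f n → n ℤ.- f ≡ ℤ.- 1ℤ ℤ.* (h ℤ.+ 1ℤ ℤ.- n) ℤ.+ (1ℤ ℤ.* (h ℤ.+ 1ℤ ℤ.- f) ℤ.+ 0ℤ)
      p₁ = solve-∀
      p₂ : ∀ h n → h ≡ ℤ.- 1ℤ ℤ.* (1ℤ ℤ.- n) ℤ.+ 1ℤ ℤ.* (h ℤ.+ 1ℤ ℤ.- n)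
      p₂ = solve-∀
      p₃ : ∀ n → ℤ.- n ≡ ℤ.- 1ℤ ℤ.* 1ℤ ℤ.+ 1ℤ ℤ.* (1ℤ ℤ.- n)
      p₃ = solve-∀

-- Intermediate values, square roots and integer parts from suprema.

module Analysis (em : ExcludedMiddle 0ℓ) (ℝ : RealNumbers) where
  open import Data.Integer.Base as ℤ using (ℤ; +_; 0ℤ; 1ℤ; -1ℤ)
  import Data.Integer.Properties as ℤ
  open import Data.Integer.Tactic.RingSolver using (solve-∀)
  open import Data.List.Base using (List; []; _∷_; map)
  open import Data.Nat.Base using (zero; suc)
  open import Data.Product using (∃; _×_; _,_; proj₁; proj₂)
  open import Data.Sum using (inj₁; inj₂)
  open import Relation.Binary.PropositionalEquality as ≡ using (_≡_)
  open import Relation.Nullary using (¬_; yes; no; contradiction)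
  open RealNumbers ℝ hiding (zero)
  open Reals ℝ
  open OrderedField em ℝ
  open Solver using (solve; _:=_; _:+_; _:*_; _:-_; :-_; con)
  open import Algebra.Properties.Ring ring
  open import Relation.Binary.Reasoning.Setoid setoid

  Bounded : Carrier → Carrier → Set
  Bounded C x = - C ≤ x × x ≤ C

  bounded-+ : ∀ {C D x y} → Bounded C x → Bounded D y → Bounded (C + D) (x + y)
  bounded-+ {C} {D} {x} {y} (l , u) (l′ , u′) =
    ≤-by (+-nonneg (≤⇒0≤ l) (≤⇒0≤ l′))
      (solve 4 (λ C D x y → (x :- (:- C)) :+ (y :- (:- D)) := (x :+ y) :- (:- (C :+ D))) refl C D x y) ,
    ≤-by (+-nonneg (≤⇒0≤ u) (≤⇒0≤ u′))
      (solve 4 (λ C D x y → (C :- x) :+ (D :- y) := (C :+ D) :- (x :+ y)) refl C D x y)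

  -- Both 2(CD + xy) and 2(CD - xy) are sums of two products of the nonnegative numbers C ± x and D
  -- ± y, which spares a case distinction on signs.
  bounded-* : ∀ {C D x y} → Bounded C x → Bounded D y → Bounded (C * D) (x * y)
  bounded-* {C} {D} {x} {y} (l , u) (l′ , u′) =
    0≤⇒≤ (nonneg-cancel (fromℤ-pos 1) (≤-respʳ
      (solve 4 (λ C D x y → (x :- (:- C)) :* (y :- (:- D)) :+ (C :- x) :* (D :- y) := con (+ 2) :*
          (x :* y :- (:- (C :* D)))) refl C D x y)
      (+-nonneg (*-nonneg (≤⇒0≤ l) (≤⇒0≤ l′)) (*-nonneg (≤⇒0≤ u) (≤⇒0≤ u′))))) ,
    0≤⇒≤ (nonneg-cancel (fromℤ-pos 1) (≤-respʳ
      (solve 4 (λ C D x y → (C :- x) :* (y :- (:- D)) :+ (x :- (:- C)) :* (D :- y) := con (+ 2) :*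
          (C :* D :- x :* y)) refl C D x y)
      (+-nonneg (*-nonneg (≤⇒0≤ u) (≤⇒0≤ l′)) (*-nonneg (≤⇒0≤ l) (≤⇒0≤ u′)))))

  bound : ∀ x → ∃ λ C → 0# ≤ C × Bounded C x
  bound x with ≤-total 0# x
  ... | inj₁ 0≤x = x , 0≤x , ≤-by (+-nonneg 0≤x 0≤x) (solve 1 (λ x → x :+ x := x :- (:- x)) refl x) , ≤-refl
  ... | inj₂ x≤0 = - x , neg-nonneg x≤0 , ≤-reflexive (-‿involutive x) ,
    ≤-by (+-nonneg (neg-nonneg x≤0) (neg-nonneg x≤0)) refl

  bounded-weaken : ∀ {C D x} → C ≤ D → Bounded C x → Bounded D x
  bounded-weaken {C} {D} C≤D (l , u) =
    ≤-trans (≤-by (≤⇒0≤ C≤D) (solve 2 (λ C D → D :- C := (:- C) :- (:- D)) refl C D)) l , ≤-trans u C≤D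

  evalℝ : List Carrier → Carrier → Carrier
  evalℝ []      x = 0#
  evalℝ (c ∷ p) x = c + x * evalℝ p x

  evalℝ-cong : ∀ p {x y} → x ≈ y → evalℝ p x ≈ evalℝ p y
  evalℝ-cong []      e = refl
  evalℝ-cong (c ∷ p) e = +-congˡ (*-cong e (evalℝ-cong p e))

  evalℝ-neg : ∀ p x → evalℝ (map -_ p) x ≈ - evalℝ p x
  evalℝ-neg []      x = sym -0#≈0#
  evalℝ-neg (c ∷ p) x = trans (+-congˡ (*-congˡ (evalℝ-neg p x)))
    (solve 3 (λ c x e → (:- c) :+ x :* (:- e) := :- (c :+ x :* e)) refl c x (evalℝ p x))

  -- Continuity in algebraic form, with `g` as difference quotient. One Horner step takes the
  -- quotient g of p to p(s) + (s + δ) g, and the constant `C` bounds this for δ between -1 and 1.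
  locally-lipschitz : ∀ p s → ∃ λ C → 0# ≤ C × (∀ δ → Bounded 1# δ →
    ∃ λ g → evalℝ p (s + δ) ≈ evalℝ p s + δ * g × Bounded C g)
  locally-lipschitz [] s = 0# , ≤-refl , λ δ _ → 0# , sym (trans (+-identityˡ _) (zeroʳ δ)) ,
    ≤-reflexive -0#≈0# , ≤-refl
  locally-lipschitz (c ∷ p) s =
    let (C , 0≤C , f) = locally-lipschitz p s
        (S , 0≤S , s≤) = bound s
        (E , 0≤E , e≤) = bound (evalℝ p s)
    in E + (S + 1#) * C , +-nonneg 0≤E (*-nonneg (+-nonneg 0≤S (proj₁ 0<1)) 0≤C) , λ δ δ≤ →
       let (g , eq , g≤) = f δ δ≤
       in evalℝ p s + (s + δ) * g , trans (+-congˡ (*-congˡ eq)) (regroup c s δ (evalℝ p s) g) ,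
          bounded-+ e≤ (bounded-* (bounded-+ s≤ δ≤) g≤)
    where
    regroup : ∀ c s δ e g → c + (s + δ) * (e + δ * g) ≈ c + s * e + δ * (e + (s + δ) * g)
    regroup = solve 5 (λ c s δ e g → c :+ (s :+ δ) :* (e :+ δ :* g) := c :+ s :* e :+ δ :*
        (e :+ (s :+ δ) :* g)) refl

  -- The witness is `F` divided by `F + C + 1#`.
  small-step : ∀ {F C} → 0# < F → 0# ≤ C → ∃ λ ε → 0# < ε × ε ≤ 1# × ε * C < F
  small-step {F} {C} 0<F 0≤C = scale (K ⁻¹) (pos-inverse 0<K) (⁻¹-inverse (pos⇒≉ 0<K))
    where
    K = F + C + 1#
    0<K : 0# < K
    0<K = +-pos (+-pos-nonneg 0<F 0≤C) 0<1
    scale : ∀ i → 0# < i → K * i ≈ 1# → ∃ λ ε → 0# < ε × ε ≤ 1# × ε * C < F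
    scale i 0<i Ki≈1 = F * i , *-pos 0<F 0<i ,
      ≤-by (*-nonneg (+-nonneg 0≤C (proj₁ 0<1)) (proj₁ 0<i)) (begin
        (C + 1#) * i          ≈⟨ solve 4 (λ F C o i → (C :+ o) :* i := (F :+ C :+ o) :* i :- F :* i)
            refl F C 1# i ⟩
        K * i - F * i         ≈⟨ +-congʳ Ki≈1 ⟩
        1# - F * i            ∎) ,
      <-by (*-pos 0<F (*-pos (+-pos 0<F 0<1) 0<i)) (begin
        F * ((F + 1#) * i)        ≈⟨ solve 4 (λ F C o i → F :* ((F :+ o) :* i) := F :*
            ((F :+ C :+ o) :* i) :- F :* i :* C) refl F C 1# i ⟩
        F * (K * i) - F * i * C   ≈⟨ +-congʳ (trans (*-congˡ Ki≈1) (*-identityʳ F)) ⟩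
        F - F * i * C             ∎)

  positive-near : ∀ p s → 0# < evalℝ p s → ∃ λ ε → 0# < ε × (∀ δ → Bounded ε δ → 0# < evalℝ p (s + δ))
  positive-near p s 0<F =
    let (C , 0≤C , f) = locally-lipschitz p s
        (ε , 0<ε , ε≤1 , εC<F) = small-step 0<F 0≤C
    in ε , 0<ε , λ δ δ≤ →
       let (g , eq , g≤) = f δ (bounded-weaken ε≤1 δ≤)
       in <-resp refl (sym eq) (combine (evalℝ p s) (δ * g) (ε * C) εC<F (proj₁ (bounded-* δ≤ g≤)))
    where
    combine : ∀ F x y → y < F → - y ≤ x → 0# < F + x
    combine F x y y<F -y≤x = <-resp refl (solve 3 (λ F x y → F :- y :+ (x :- (:- y)) := F :+ x) refl F x y)
      (+-pos-nonneg (<⇒0< y<F) (≤⇒0≤ -y≤x))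

  negative-near : ∀ p s → evalℝ p s < 0# → ∃ λ ε → 0# < ε × (∀ δ → Bounded ε δ → evalℝ p (s + δ) < 0#)
  negative-near p s neg =
    let (ε , 0<ε , near) = positive-near (map -_ p) s (<-resp refl (trans (+-identityˡ _) (sym (evalℝ-neg p s))) (<⇒0< neg))
    in ε , 0<ε , λ δ δ≤ → 0<⇒< (<-resp refl (trans (evalℝ-neg p (s + δ)) (sym (+-identityˡ _))) (near δ δ≤))

  -- Here `s` is the supremum of the points up to `b` where `p` is nonpositive. A positive value at
  -- `s` would persist to the left and give a smaller upper bound; a negative one would persist to
  -- the right, giving a larger such point or reaching `b`, where `p` is nonnegative.
  supremum-root : ∀ p {b s} → s ≤ b → 0# ≤ evalℝ p b →
    (∀ t → t ≤ b × evalℝ p t ≤ 0# → t ≤ s) →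
    (∀ u → (∀ t → t ≤ b × evalℝ p t ≤ 0# → t ≤ u) → s ≤ u) → evalℝ p s ≈ 0#
  supremum-root p {b} {s} s≤b 0≤pb upper least = root
    where
    move : ∀ t → s + (t - s) ≈ t
    move t = solve 2 (λ s t → s :+ (t :- s) := t) refl s t
    not-positive : ¬ (0# < evalℝ p s)
    not-positive pos = far (positive-near p s pos)
      where
      far : ¬ ∃ λ ε → 0# < ε × (∀ δ → Bounded ε δ → 0# < evalℝ p (s + δ))
      far (ε , 0<ε , near) = <⇒≱ (<-by 0<ε (solve 2 (λ s e → e := s :- (s :- e)) refl s ε))
          (least (s - ε) bounds)
        where
        bounds : ∀ t → t ≤ b × evalℝ p t ≤ 0# → t ≤ s - ε
        bounds t Pt with em {t ≤ s - ε}
        ... | yes le = le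
        ... | no ¬le = contradiction (proj₂ Pt) (<⇒≱ (<-resp refl (evalℝ-cong p (move t)) (near (t - s)
          ( ≤-by (≤⇒0≤ (proj₁ (≰⇒> ¬le))) (solve 3 (λ s t e → t :- (s :- e) := (t :- s) :- (:- e)) refl s t ε)
          , ≤-by (+-nonneg (≤⇒0≤ (upper t Pt)) (proj₁ 0<ε))
              (solve 3 (λ s t e → (s :- t) :+ e := e :- (t :- s)) refl s t ε)))))
    not-negative : ¬ (evalℝ p s < 0#)
    not-negative neg = far (negative-near p s neg)
      where
      far : ¬ ∃ λ ε → 0# < ε × (∀ δ → Bounded ε δ → evalℝ p (s + δ) < 0#)
      far (ε , 0<ε , near) with ≤-total ε (b - s)
      ... | inj₁ ε≤ = <⇒≱ (<-by 0<ε (solve 2 (λ s e → e := (s :+ e) :- s) refl s ε)) (upper (s + ε)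
          ( ≤-by (≤⇒0≤ ε≤) (solve 3 (λ b s e → b :- s :- e := b :- (s :+ e)) refl b s ε)
          , proj₁ (near ε (≤-by (+-nonneg (proj₁ 0<ε) (proj₁ 0<ε))
              (solve 1 (λ e → e :+ e := e :- (:- e)) refl ε) , ≤-refl))))
      ... | inj₂ ≤ε = <⇒≱ (<-resp (evalℝ-cong p (move b)) refl (near (b - s)
            ( ≤-by (+-nonneg (≤⇒0≤ s≤b) (proj₁ 0<ε)) (solve 3
                (λ b s e → b :- s :+ e := b :- s :- (:- e)) refl b s ε) , ≤ε))) 0≤pb
    root : evalℝ p s ≈ 0#
    root with trichotomy (evalℝ p s)
    ... | inj₁ neg        = contradiction neg not-negative
    ... | inj₂ (inj₁ e)   = e
    ... | inj₂ (inj₂ pos) = contradiction pos not-positive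

  intermediate-value : ∀ p {a b} → a ≤ b → evalℝ p a ≤ 0# → 0# ≤ evalℝ p b → ∃ λ s → a ≤ s × evalℝ p s ≈ 0#
  intermediate-value p {a} {b} a≤b pa≤0 0≤pb =
    let (s , upper , least) = supremum (λ t → t ≤ b × evalℝ p t ≤ 0#) (a , a≤b , pa≤0) (b , λ t → proj₁)
    in s , upper a (a≤b , pa≤0) , supremum-root p (least b λ t → proj₁) 0≤pb upper least

  -- A zero of y² - x between 0 and x + 1; at the right end the polynomial takes the value x² + x +
  -- 1.
  sqrt : ∀ {x} → 0# ≤ x → ∃ (IsSqrt x)
  sqrt {x} 0≤x =
    let (s , 0≤s , root) = intermediate-value (- x ∷ 0# ∷ 1# ∷ []) {0#} {x + 1#} (+-nonneg 0≤x (proj₁ 0<1))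
          (≤-respˡ (sym (simplify 0#)) (≤-by 0≤x (solve 1 (λ x → x := con 0ℤ :- (con 0ℤ :* con 0ℤ :- x))
              refl x)))
          (≤-respʳ (sym (simplify (x + 1#))) (≤-respʳ (square x)
              (+-nonneg (+-nonneg (*-nonneg 0≤x 0≤x) 0≤x) (proj₁ 0<1))))
    in s , 0≤s , minus-zero (s * s) (trans (sym (simplify s)) root)
    where
    simplify : ∀ y → - x + y * (0# + y * (1# + y * 0#)) ≈ y * y - x
    simplify y = trans (+-comm _ _) (+-congʳ (*-congˡ (trans (+-identityˡ _)
        (trans (*-congˡ (trans (+-congˡ (zeroʳ y)) (+-identityʳ 1#))) (*-identityʳ y)))))
    square : ∀ x → x * x + x + 1# ≈ (x + 1#) * (x + 1#) - x
    square x = begin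
      x * x + x + 1#                               ≈⟨ +-cong (+-congˡ (sym (*-identityʳ x)))
          (sym (*-identityˡ 1#)) ⟩
      x * x + x * 1# + 1# * 1#                     ≈⟨ solve 2
          (λ x o → x :* x :+ x :* o :+ o :* o := (x :+ o) :* (x :+ o) :- x :* o) refl x 1# ⟩
      (x + 1#) * (x + 1#) - x * 1#                 ≈⟨ +-congˡ (-‿cong (*-identityʳ x)) ⟩
      (x + 1#) * (x + 1#) - x                      ∎
    minus-zero : ∀ y → y - x ≈ 0# → y ≈ x
    minus-zero y e = trans (solve 2 (λ x y → y := x :+ (y :- x)) refl x y) (trans (+-congˡ e) (+-identityʳ x))

  -- If `x` bounded the naturals they would have a supremum s. As t + 1 is a natural whenever t is,
  -- s - 1 would be an upper bound too.
  archimedean : ∀ x → ∃ λ N → x < fromℤ (+ N)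
  archimedean x with em {∃ λ N → x < fromℤ (+ N)}
  ... | yes p = p
  ... | no none =
    let (s , upper , least) = supremum P (0# , 0 , refl) (x , λ t (N , e) → ≤-respˡ (sym e) (below N))
    in contradiction (least (s - 1#) (bounds s upper)) (<⇒≱ (<-by 0<1 (solve 2 (λ s o → o := s :- (s :- o)) refl s 1#)))
    where
    P : Carrier → Set
    P t = ∃ λ N → t ≈ fromℤ (+ N)
    below : ∀ N → fromℤ (+ N) ≤ x
    below N with em {fromℤ (+ N) ≤ x}
    ... | yes le = le
    ... | no ¬le = contradiction (N , ≰⇒> ¬le) none
    bounds : ∀ s → (∀ t → P t → t ≤ s) → ∀ t → P t → t ≤ s - 1#
    bounds s upper t (N , e) = ≤-by (≤⇒0≤ (upper (1# + t) (suc N , +-congˡ e)))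
        (solve 3 (λ s o t → s :- (o :+ t) := s :- o :- t) refl s 1# t)

  floor-ℕ : ∀ M y → 0# ≤ y → y < fromℤ (+ M) → ∃ λ k → fromℤ (+ k) ≤ y × y < fromℤ (+ suc k)
  floor-ℕ zero    y 0≤y y<0 = contradiction 0≤y (<⇒≱ y<0)
  floor-ℕ (suc M) y 0≤y y<1+M with em {fromℤ (+ M) ≤ y}
  ... | yes le = M , le , y<1+M
  ... | no ¬le = floor-ℕ M y 0≤y (≰⇒> ¬le)

  floor : ∀ x → ∃ (IsFloor x)
  floor x =
    let (N , -x<N) = archimedean (- x)
        (M , y<M) = archimedean (x + fromℤ (+ N))
        (k , k≤ , <1+k) = floor-ℕ M (x + fromℤ (+ N))
          (≤-respʳ (solve 2 (λ x n → n :- (:- x) := x :+ n) refl x (fromℤ (+ N))) (≤⇒0≤ (proj₁ -x<N))) y<M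
    in + k ℤ.- + N , shifted N k k≤ <1+k
    where
    shift : ∀ k n → 1ℤ ℤ.+ k ℤ.- n ≡ k ℤ.- n ℤ.+ 1ℤ
    shift = solve-∀
    shifted : ∀ N k → fromℤ (+ k) ≤ x + fromℤ (+ N) → x + fromℤ (+ N) < fromℤ (+ suc k) → IsFloor x
        (+ k ℤ.- + N)
    shifted N k k≤ <1+k =
      ≤-by (≤⇒0≤ k≤) (trans (solve 3 (λ x n k → x :+ n :- k := x :- (k :- n)) refl x (fromℤ (+ N))
          (fromℤ (+ k))) (+-congˡ (-‿cong (sym (fromℤ-- (+ k) (+ N)))))) ,
      <-by (<⇒0< <1+k) (trans (solve 3 (λ x n k → k :- (x :+ n) := k :- n :- x) refl x (fromℤ (+ N))
          (fromℤ (+ suc k)))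
        (+-congʳ (trans (sym (fromℤ-- (+ suc k) (+ N))) (reflexive (≡.cong fromℤ (shift (+ k) (+ N)))))))

  ceiling : ∀ x → ∃ (IsCeiling x)
  ceiling x = let (z , z≤ , <1+z) = floor (- x) in ℤ.- z , negated z z≤ <1+z
    where
    neg : ∀ z → ℤ.- (z ℤ.+ 1ℤ) ≡ ℤ.- z ℤ.- 1ℤ
    neg = solve-∀
    negated : ∀ z → fromℤ z ≤ - x → - x < fromℤ (z ℤ.+ 1ℤ) → IsCeiling x (ℤ.- z)
    negated z z≤ <1+z =
      <-by (<⇒0< <1+z) (trans (solve 2 (λ x z → z :- (:- x) := x :- (:- z)) refl x (fromℤ (z ℤ.+ 1ℤ)))
        (+-congˡ (-‿cong (trans (sym (fromℤ-neg (z ℤ.+ 1ℤ))) (reflexive (≡.cong fromℤ (neg z))))))) ,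
      ≤-by (≤⇒0≤ z≤) (trans (solve 2 (λ x z → (:- x) :- z := (:- z) :- x) refl x (fromℤ z))
          (+-congʳ (sym (fromℤ-neg z))))

  -- An integer not exceeding `x` is below the floor plus 1, hence at most the floor. Thus rounding
  -- does not change a bound on an integer.
  ≤⇒≤⌊⌋ : ∀ {m x} → fromℤ m ≤ x → m ≤⌊ x ⌋
  ≤⇒≤⌊⌋ {m} {x} m≤x = from (floor x)
    where
    ℤ-cancel : ∀ {m z} → 1ℤ ℤ.+ m ℤ.≤ z ℤ.+ 1ℤ → m ℤ.≤ z
    ℤ-cancel {m} {z} le = ≡.subst₂ ℤ._≤_ (left m) (right z) (ℤ.+-monoʳ-≤ -1ℤ le)
      where
      left : ∀ m → -1ℤ ℤ.+ (1ℤ ℤ.+ m) ≡ m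
      left = solve-∀
      right : ∀ z → -1ℤ ℤ.+ (z ℤ.+ 1ℤ) ≡ z
      right = solve-∀
    from : ∃ (IsFloor x) → m ≤⌊ x ⌋
    from (z , z≤ , <1+z) = z , (z≤ , <1+z) ,
      ℤ-cancel (ℤ.i<j⇒suc[i]≤j (fromℤ-cancel-< {m} {z ℤ.+ 1ℤ} (≤-<-trans m≤x <1+z)))

  ≤⌊⌋⇒≤ : ∀ {m x} → m ≤⌊ x ⌋ → fromℤ m ≤ x
  ≤⌊⌋⇒≤ (z , (z≤ , _) , m≤z) = ≤-trans (fromℤ-mono-≤ m≤z) z≤

  ≥⇒≥⌈⌉ : ∀ {m x} → x ≤ fromℤ m → m ≥⌈ x ⌉
  ≥⇒≥⌈⌉ {m} {x} x≤m = from (ceiling x)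
    where
    cancel : ∀ z → 1ℤ ℤ.+ (z ℤ.- 1ℤ) ≡ z
    cancel = solve-∀
    from : ∃ (IsCeiling x) → m ≥⌈ x ⌉
    from (z , z< , ≤z) = z , (z< , ≤z) ,
      ≡.subst (ℤ._≤ m) (cancel z) (ℤ.i<j⇒suc[i]≤j (fromℤ-cancel-< {z ℤ.- 1ℤ} {m} (<-≤-trans z< x≤m)))

  ≥⌈⌉⇒≥ : ∀ {m x} → m ≥⌈ x ⌉ → x ≤ fromℤ m
  ≥⌈⌉⇒≥ (z , (_ , ≤z) , m≥z) = ≤-trans ≤z (fromℤ-mono-≤ m≥z)

-- Real-rootedness of a monic cubic and its discriminant.

module Cubic (em : ExcludedMiddle 0ℓ) (ℝ : RealNumbers) where
  open import Data.Integer.Base using (+_; 0ℤ)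
  open import Data.Nat.Base using (zero)
  open import Data.Product using (_,_; proj₁)
  open import Relation.Nullary using (yes; no; contradiction)
  open RealNumbers ℝ hiding (zero)
  open Reals ℝ
  open OrderedField em ℝ
  open Analysis em ℝ
  open Solver using (solve; _:=_; _:+_; _:*_; _:-_; :-_; con; Polynomial)
  open import Algebra.Properties.Ring ring
  open import Relation.Binary.Reasoning.Setoid setoid

  -- The real and imaginary parts of t³ + a t² + b t + c at t = x + i y, the latter with its factor
  -- y taken out.
  re im : Carrier → Carrier → Carrier → Carrier → Carrier → Carrier
  re a b c x y = c + b * x + a * (x * x - y * y) + (x * x * x - fromℤ (+ 3) * x * y * y)
  im a b c x y = y * (fromℤ (+ 3) * x * x - y * y + fromℤ (+ 2) * a * x + b)

  AllReal : Carrier → Carrier → Carrier → Set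
  AllReal a b c = ∀ x y → re a b c x y ≈ 0# → im a b c x y ≈ 0# → y ≈ 0#

  -- The cubic t³ + a t² + b t + c has discriminant (4 D³ − Q²) / 27.
  D : Carrier → Carrier → Carrier
  D a b = a * a - fromℤ (+ 3) * b

  Q : Carrier → Carrier → Carrier → Carrier
  Q a b c = fromℤ (+ 2) * a * a * a - fromℤ (+ 9) * a * b + fromℤ (+ 27) * c

  cube : Carrier → Carrier
  cube x = x * x * x

  private
    D′ : ∀ {n} (a b : Polynomial n) → Polynomial n
    D′ a b = a :* a :- con (+ 3) :* b
    Q′ : ∀ {n} (a b c : Polynomial n) → Polynomial n
    Q′ a b c = con (+ 2) :* a :* a :* a :- con (+ 9) :* a :* b :+ con (+ 27) :* c
    re′ im′ : ∀ {n} (a b c x y : Polynomial n) → Polynomial n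
    re′ a b c x y = c :+ b :* x :+ a :* (x :* x :- y :* y) :+ (x :* x :* x :- con (+ 3) :* x :* y :* y)
    im′ a b c x y = y :* (con (+ 3) :* x :* x :- y :* y :+ con (+ 2) :* a :* x :+ b)

  D-cong : ∀ {a b b′} → b ≈ b′ → D a b ≈ D a b′
  D-cong e = +-congˡ (-‿cong (*-congˡ e))

  Q-cong : ∀ {a b b′ c c′} → b ≈ b′ → c ≈ c′ → Q a b c ≈ Q a b′ c′
  Q-cong e f = +-cong (+-congˡ (-‿cong (*-congˡ e))) (*-congˡ f)

  cube-cong : ∀ {x y} → x ≈ y → cube x ≈ cube y
  cube-cong e = *-cong (*-cong e e) e

  from-zero : ∀ {x y} → x - y ≈ 0# → x ≈ y
  from-zero {x} {y} e = trans (solve 2 (λ x y → x := y :+ (x :- y)) refl x y)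
      (trans (+-congˡ e) (+-identityʳ y))

  zero-from : ∀ {x y} → x ≈ y → x - y ≈ 0#
  zero-from {x} {y} e = trans (+-congʳ e) (-‿inverseʳ y)

  -- With p = 3x + a, a pair of conjugate roots x ± iy gives D = p² − 3y² and
  -- Q = 2p (p² + 9y²).
  nonreal-root : ∀ {a b c x y} → y ≉ 0# → re a b c x y ≈ 0# → im a b c x y ≈ 0# → fromℤ (+ 4) * cube
      (D a b) < Q a b c * Q a b c
  nonreal-root {a} {b} {c} {x} {y} y≉0 re≈0 im≈0 = <-by
    (*-pos (fromℤ-pos 107) (*-pos (sq-pos y≉0) (sq-pos (pos⇒≉
        (<-resp refl (+-comm _ _) (+-pos-nonneg (sq-pos y≉0) (sq-nonneg p)))))))
    (begin
      fromℤ (+ 108) * (y * y * ((p * p + y * y) * (p * p + y * y)))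
        ≈⟨ discriminant p y ⟩
      Q₁ * Q₁ - fromℤ (+ 4) * cube D₁
        ≈⟨ +-cong (*-cong Q≈ Q≈) (-‿cong (*-congˡ (cube-cong D≈))) ⟨
      Q a b c * Q a b c - fromℤ (+ 4) * cube (D a b) ∎)
    where
    p = fromℤ (+ 3) * x + a
    D₁ = p * p - fromℤ (+ 3) * (y * y)
    Q₁ = fromℤ (+ 2) * p * (p * p + fromℤ (+ 9) * (y * y))
    b₁ = y * y - fromℤ (+ 3) * x * x - fromℤ (+ 2) * a * x
    c₁ = fromℤ (+ 2) * x * (x * x + y * y) + a * (x * x + y * y)
    discriminant : ∀ p y → fromℤ (+ 108) * (y * y * ((p * p + y * y) * (p * p + y * y))) ≈
      fromℤ (+ 2) * p * (p * p + fromℤ (+ 9) * (y * y)) * (fromℤ (+ 2) * p * (p * p + fromℤ (+ 9) * (y * y)))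
        - fromℤ (+ 4) * cube (p * p - fromℤ (+ 3) * (y * y))
    discriminant = solve 2 (λ p y →
      con (+ 108) :* (y :* y :* ((p :* p :+ y :* y) :* (p :* p :+ y :* y))) :=
      con (+ 2) :* p :* (p :* p :+ con (+ 9) :* (y :* y)) :*
          (con (+ 2) :* p :* (p :* p :+ con (+ 9) :* (y :* y)))
        :- con (+ 4) :* ((p :* p :- con (+ 3) :* (y :* y)) :* (p :* p :- con (+ 3) :* (y :* y)) :*
            (p :* p :- con (+ 3) :* (y :* y)))) refl
    b≈ : b ≈ b₁
    b≈ = from-zero (trans
      (solve 4 (λ a b x y → b :- (y :* y :- con (+ 3) :* x :* x :- con (+ 2) :* a :* x) := con (+ 3) :*
          x :* x :- y :* y :+ con (+ 2) :* a :* x :+ b) refl a b x y)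
      (*-cancel-0 y≉0 im≈0))
    c≈ : c ≈ c₁
    c≈ = from-zero (trans
      (solve 5 (λ a b c x y → c :- (con (+ 2) :* x :* (x :* x :+ y :* y) :+ a :* (x :* x :+ y :* y)) :=
        re′ a b c x y :- x :* (b :- (y :* y :- con (+ 3) :* x :* x :- con (+ 2) :* a :* x))) refl a b c x y)
      (trans (+-cong re≈0 (-‿cong (trans (*-congˡ (zero-from b≈)) (zeroʳ x)))) (-‿inverseʳ 0#)))
    D≈ : D a b ≈ D₁
    D≈ = trans (D-cong b≈) (solve 3 (λ a x y → D′ a (y :* y :- con (+ 3) :* x :* x :- con (+ 2) :* a :* x) :=
      (con (+ 3) :* x :+ a) :* (con (+ 3) :* x :+ a) :- con (+ 3) :* (y :* y)) refl a x y)
    Q≈ : Q a b c ≈ Q₁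
    Q≈ = trans (Q-cong b≈ c≈) (solve 3 (λ a x y →
      Q′ a (y :* y :- con (+ 3) :* x :* x :- con (+ 2) :* a :* x)
          (con (+ 2) :* x :* (x :* x :+ y :* y) :+ a :* (x :* x :+ y :* y)) :=
      con (+ 2) :* (con (+ 3) :* x :+ a) :* ((con (+ 3) :* x :+ a) :* (con (+ 3) :* x :+ a) :+ con (+ 9)
          :* (y :* y))) refl a x y)

  discriminant⇒allReal : ∀ {a b c} → Q a b c * Q a b c ≤ fromℤ (+ 4) * cube (D a b) → AllReal a b c
  discriminant⇒allReal le x y re≈0 im≈0 with y ≟0
  ... | yes e = e
  ... | no y≉0 = contradiction le (<⇒≱ (nonreal-root y≉0 re≈0 im≈0))

  -- Dividing by t − r leaves t² + p t + q, of discriminant E = p² − 4q.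
  module Quotient {a b c r : Carrier} (root : c + r * (b + r * (a + r)) ≈ 0#) where
    p q E : Carrier
    p = a + r
    q = b + r * p
    E = p * p - fromℤ (+ 4) * q

    -- If R + i y I is the value of t² + p t + q at x + i y, that of the cubic is (x - r + i y)(R +
    -- i y I) plus the remainder, which is zero by `root`.
    re-division : ∀ x y → x * x - y * y + p * x + q ≈ 0# → fromℤ (+ 2) * x + p ≈ 0# → re a b c x y ≈ 0#
    re-division x y R≈0 I≈0 = trans
      (solve 6 (λ a b c r x y → re′ a b c x y :=
        (x :- r) :* (x :* x :- y :* y :+ (a :+ r) :* x :+ (b :+ r :* (a :+ r))) :- y :*
            (y :* (con (+ 2) :* x :+ (a :+ r)))
          :+ (c :+ r :* (b :+ r :* (a :+ r)))) refl a b c r x y)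
      (trans (+-cong (+-cong (trans (*-congˡ R≈0) (zeroʳ _))
          (-‿cong (trans (*-congˡ (trans (*-congˡ I≈0) (zeroʳ y))) (zeroʳ y)))) root)
        (solve 0 (con 0ℤ :- con 0ℤ :+ con 0ℤ := con 0ℤ) refl))

    im-division : ∀ x y → x * x - y * y + p * x + q ≈ 0# → fromℤ (+ 2) * x + p ≈ 0# → im a b c x y ≈ 0#
    im-division x y R≈0 I≈0 = trans
      (solve 6 (λ a b c r x y → im′ a b c x y :=
        (x :- r) :* (y :* (con (+ 2) :* x :+ (a :+ r))) :+ y :*
            (x :* x :- y :* y :+ (a :+ r) :* x :+ (b :+ r :* (a :+ r)))) refl a b c r x y)
      (trans (+-cong (trans (*-congˡ (trans (*-congˡ I≈0) (zeroʳ y))) (zeroʳ _))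
          (trans (*-congˡ R≈0) (zeroʳ y))) (+-identityˡ 0#))

    -- For negative `E` the number (-p + i √(-E))/2 is a root of the quadratic and hence of the
    -- cubic. Its imaginary part must vanish, which forces `E` to be zero after all.
    E-nonneg : AllReal a b c → 0# ≤ E
    E-nonneg all with em {0# ≤ E}
    ... | yes le = le
    ... | no ¬le = contradiction (sqrt (neg-nonneg (proj₁ (≰⇒> ¬le)))) λ (w , _ , ww) → ¬le
          (≤-reflexive (sym (E≈0 w ww)))
      where
      two = fromℤ (+ 2)
      half = two ⁻¹
      two-half : two * half ≈ 1#
      two-half = ⁻¹-inverse (pos⇒≉ (fromℤ-pos 1))
      double-half : ∀ u → two * (u * half) ≈ u
      double-half u = trans (solve 3 (λ t u h → t :* (u :* h) := u :* (t :* h)) refl two u half)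
          (trans (*-congˡ two-half) (*-identityʳ u))
      E≈0 : ∀ w → w * w ≈ - E → E ≈ 0#
      E≈0 w ww = begin
        E          ≈⟨ -‿involutive E ⟨
        - - E      ≈⟨ -‿cong ww ⟨
        - (w * w)  ≈⟨ -‿cong (trans (*-congʳ w≈0) (zeroˡ w)) ⟩
        - 0#       ≈⟨ -0#≈0# ⟩
        0#         ∎
        where
        x = - p * half
        y = w * half
        I≈0 : two * x + p ≈ 0#
        I≈0 = trans (+-congʳ (double-half (- p))) (-‿inverseˡ p)
        R≈0 : x * x - y * y + p * x + q ≈ 0#
        R≈0 = *-cancel-0 (pos⇒≉ (fromℤ-pos 3)) (begin
          fromℤ (+ 4) * (x * x - y * y + p * x + q)
            ≈⟨ solve 4 (λ x y p q → con (+ 4) :* (x :* x :- y :* y :+ p :* x :+ q) :=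
                 (con (+ 2) :* x) :* (con (+ 2) :* x) :- (con (+ 2) :* y) :* (con (+ 2) :* y) :+ con
                     (+ 2) :* p :* (con (+ 2) :* x) :+ con (+ 4) :* q) refl x y p q ⟩
          (two * x) * (two * x) - (two * y) * (two * y) + two * p * (two * x) + fromℤ (+ 4) * q
            ≈⟨ +-congʳ (+-cong (+-cong (*-cong 2x 2x) (-‿cong (trans (*-cong 2y 2y) ww))) (*-congˡ 2x)) ⟩
          - p * - p - - E + two * p * - p + fromℤ (+ 4) * q
            ≈⟨ solve 2 (λ p q → (:- p) :* (:- p) :- (:- (p :* p :- con (+ 4) :* q)) :+ con (+ 2) :* p :*
                (:- p) :+ con (+ 4) :* q := con 0ℤ) refl p q ⟩
          0# ∎)
          where
          2x = double-half (- p)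
          2y = double-half w
        w≈0 : w ≈ 0#
        w≈0 = begin
          w        ≈⟨ double-half w ⟨
          two * y  ≈⟨ *-congˡ (all x y (re-division x y R≈0 I≈0) (im-division x y R≈0 I≈0)) ⟩
          two * 0# ≈⟨ zeroʳ two ⟩
          0#       ∎

    -- The identity is 4 D = 3 E + (p + 2 r)².
    D-nonneg : 0# ≤ E → 0# ≤ D a b
    D-nonneg 0≤E = nonneg-cancel (fromℤ-pos 3) (≤-respʳ
      (solve 3 (λ a b r → con (+ 3) :* ((a :+ r) :* (a :+ r) :- con (+ 4) :* (b :+ r :* (a :+ r)))
          :+ ((a :+ r) :+ con (+ 2) :* r) :* ((a :+ r) :+ con (+ 2) :* r) := con (+ 4) :* D′ a b) refl a b r)
      (+-nonneg (*-nonneg (fromℤ-nonneg 3) 0≤E) (sq-nonneg (p + fromℤ (+ 2) * r))))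

    -- The discriminant of the cubic is that of the quadratic times the squared value of the
    -- quadratic at `r`, so 4 D³ - Q² = 27 E (r² + p r + q)².
    discriminant-nonneg : 0# ≤ E → Q a b c * Q a b c ≤ fromℤ (+ 4) * cube (D a b)
    discriminant-nonneg 0≤E = ≤-by (*-nonneg (*-nonneg (fromℤ-nonneg 27) 0≤E)
        (sq-nonneg (r * r + p * r + q))) (begin
      fromℤ (+ 27) * E * ((r * r + p * r + q) * (r * r + p * r + q))
        ≈⟨ solve 3 (λ a b r → con (+ 27) :* ((a :+ r) :* (a :+ r) :- con (+ 4) :* (b :+ r :* (a :+ r)))
             :* ((r :* r :+ (a :+ r) :* r :+ (b :+ r :* (a :+ r))) :*
                 (r :* r :+ (a :+ r) :* r :+ (b :+ r :* (a :+ r)))) :=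
             con (+ 4) :* (D′ a b :* D′ a b :* D′ a b) :- Q′ a b (:- (r :* (b :+ r :* (a :+ r)))) :* Q′
                 a b (:- (r :* (b :+ r :* (a :+ r))))) refl a b r ⟩
      fromℤ (+ 4) * cube (D a b) - Q a b (- (r * q)) * Q a b (- (r * q))
        ≈⟨ +-congˡ (-‿cong (*-cong Q≈ Q≈)) ⟨
      fromℤ (+ 4) * cube (D a b) - Q a b c * Q a b c ∎)
      where
      c≈ : c ≈ - (r * q)
      c≈ = from-zero (trans (+-congˡ (-‿involutive _)) root)
      Q≈ : Q a b c ≈ Q a b (- (r * q))
      Q≈ = Q-cong refl c≈

  square-bound : ∀ {x s} → 0# ≤ s → x * x ≤ s * s → x ≤ s
  square-bound {x} {s} 0≤s le with em {x ≤ s}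
  ... | yes x≤s = x≤s
  ... | no x≰s = contradiction le (<⇒≱ (<-by (*-pos (<⇒0< s<x) (+-pos-nonneg (≤-<-trans 0≤s s<x) 0≤s))
      (solve 2 (λ x s → (x :- s) :* (x :+ s) := x :* x :- s :* s) refl x s)))
    where s<x = ≰⇒> x≰s

  bound-square : ∀ {x s} → 0# ≤ x → x ≤ s → x * x ≤ s * s
  bound-square {x} {s} 0≤x x≤s = ≤-by (*-nonneg (≤⇒0≤ x≤s) (+-nonneg (≤-trans 0≤x x≤s) 0≤x))
    (solve 2 (λ x s → (s :- x) :* (s :+ x) := s :* s :- x :* x) refl x s)

-- Complex evaluation of polynomials and the linear factor.

module RealRoots (em : ExcludedMiddle 0ℓ) (ℝ : RealNumbers) where
  open import Data.Integer.Base as ℤ using (ℤ; +_; 0ℤ; 1ℤ; -1ℤ)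
  import Data.Integer.Properties as ℤ
  open import Data.List.Base using ([]; _∷_; map)
  open import Data.Nat.Base using (zero; suc)
  open import Data.Product using (_×_; _,_; proj₁; proj₂)
  open import Function.Bundles using (_⇔_; mk⇔)
  open import Relation.Binary.PropositionalEquality as ≡ using (_≡_)
  open import Relation.Nullary using (yes; no)
  open RealNumbers ℝ hiding (zero)
  open Reals ℝ
  open OrderedField em ℝ
  open Analysis em ℝ
  open Cubic em ℝ
  open Solver using (solve; _:=_; _:+_; _:*_; _:-_; :-_; con; Polynomial)

  infix 4 _≈ℂ_
  _≈ℂ_ : ℂ → ℂ → Set
  (u , v) ≈ℂ (u′ , v′) = u ≈ u′ × v ≈ v′

  _·_ : ℂ → ℂ → ℂ
  (x , y) · (u , v) = x * u - y * v , x * v + y * u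

  infixl 7 _·_

  transℂ : ∀ {u v w} → u ≈ℂ v → v ≈ℂ w → u ≈ℂ w
  transℂ (p , q) (r , s) = trans p r , trans q s

  -- Trailing zeros are invisible to `≋`, so lists of different lengths must evaluate alike; this
  -- settles the excess part.
  evalℂ-0 : ∀ p z → (∀ k → coeff p k ≡ 0ℤ) → evalℂ p z ≈ℂ (0# , 0#)
  evalℂ-0 []      z         e = refl , refl
  evalℂ-0 (c ∷ p) z@(x , y) e with evalℂ p z | evalℂ-0 p z (λ k → e (suc k))
  ... | u , v | u≈0 , v≈0 =
    trans (+-cong (reflexive (≡.cong fromℤ (e 0))) (+-cong (trans (*-congˡ u≈0) (zeroʳ x))
        (-‿cong (trans (*-congˡ v≈0) (zeroʳ y)))))
      (solve 0 (con 0ℤ :+ (con 0ℤ :- con 0ℤ) := con 0ℤ) refl) ,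
    trans (+-cong (trans (*-congˡ v≈0) (zeroʳ x)) (trans (*-congˡ u≈0) (zeroʳ y))) (+-identityˡ 0#)

  evalℂ-≋ : ∀ p q z → p ≋ q → evalℂ p z ≈ℂ evalℂ q z
  evalℂ-≋ []      q       z e = let (r , i) = evalℂ-0 q z (λ k → ≡.sym (e k)) in sym r , sym i
  evalℂ-≋ (a ∷ p) []      z e = evalℂ-0 (a ∷ p) z e
  evalℂ-≋ (a ∷ p) (b ∷ q) z@(x , y) e with evalℂ p z | evalℂ q z | evalℂ-≋ p q z (λ k → e (suc k))
  ... | u , v | u′ , v′ | r , i =
    +-cong (reflexive (≡.cong fromℤ (e 0))) (+-cong (*-congˡ r) (-‿cong (*-congˡ i))) ,
    +-cong (*-congˡ i) (*-congˡ r)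

  evalℂ-⊕ : ∀ p q z → evalℂ (p ⊕ q) z ≈ℂ (proj₁ (evalℂ p z) + proj₁ (evalℂ q z) , proj₂ (evalℂ p z) +
      proj₂ (evalℂ q z))
  evalℂ-⊕ []      q       z = sym (+-identityˡ _) , sym (+-identityˡ _)
  evalℂ-⊕ (a ∷ p) []      z = sym (+-identityʳ _) , sym (+-identityʳ _)
  evalℂ-⊕ (a ∷ p) (b ∷ q) z@(x , y) with evalℂ (p ⊕ q) z | evalℂ p z | evalℂ q z | evalℂ-⊕ p q z
  ... | s , t | u , v | u′ , v′ | r , i =
    trans (+-cong (fromℤ-+ a b) (+-cong (*-congˡ r) (-‿cong (*-congˡ i))))
      (solve 8 (λ a b x y u v u′ v′ → a :+ b :+ (x :* (u :+ u′) :- y :* (v :+ v′)) := a :+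
          (x :* u :- y :* v) :+ (b :+ (x :* u′ :- y :* v′)))
        refl (fromℤ a) (fromℤ b) x y u v u′ v′) ,
    trans (+-cong (*-congˡ i) (*-congˡ r))
      (solve 6 (λ x y u v u′ v′ → x :* (v :+ v′) :+ y :* (u :+ u′) := x :* v :+ y :* u :+
          (x :* v′ :+ y :* u′)) refl x y u v u′ v′)

  evalℂ-scale : ∀ a q z → evalℂ (map (a ℤ.*_) q) z ≈ℂ (fromℤ a * proj₁ (evalℂ q z) , fromℤ a * proj₂
      (evalℂ q z))
  evalℂ-scale a []      z = sym (zeroʳ _) , sym (zeroʳ _)
  evalℂ-scale a (c ∷ q) z@(x , y) with evalℂ (map (a ℤ.*_) q) z | evalℂ q z | evalℂ-scale a q z
  ... | s , t | u , v | r , i =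
    trans (+-cong (fromℤ-* a c) (+-cong (*-congˡ r) (-‿cong (*-congˡ i))))
      (solve 6 (λ a c x y u v → a :* c :+ (x :* (a :* u) :- y :* (a :* v)) := a :*
          (c :+ (x :* u :- y :* v))) refl (fromℤ a) (fromℤ c) x y u v) ,
    trans (+-cong (*-congˡ i) (*-congˡ r))
      (solve 5 (λ a x y u v → x :* (a :* v) :+ y :* (a :* u) := a :* (x :* v :+ y :* u)) refl (fromℤ a)
          x y u v)

  evalℂ-⊗ : ∀ p q z → evalℂ (p ⊗ q) z ≈ℂ evalℂ p z · evalℂ q z
  evalℂ-⊗ []      q z = solve 2 (λ u v → con 0ℤ := con 0ℤ :* u :- con 0ℤ :* v) refl (proj₁ (evalℂ q z))
      (proj₂ (evalℂ q z)) ,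
                        solve 2 (λ u v → con 0ℤ := con 0ℤ :* v :+ con 0ℤ :* u) refl (proj₁ (evalℂ q z))
                            (proj₂ (evalℂ q z))
  evalℂ-⊗ (a ∷ p) q z@(x , y) = transℂ (evalℂ-⊕ (map (a ℤ.*_) q) (0ℤ ∷ p ⊗ q) z)
    (step (evalℂ (p ⊗ q) z) (evalℂ (map (a ℤ.*_) q) z) (evalℂ p z) (evalℂ q z) (evalℂ-scale a q z)
        (evalℂ-⊗ p q z))
    where
    step : ∀ (w s e f : ℂ) → s ≈ℂ (fromℤ a * proj₁ f , fromℤ a * proj₂ f) → w ≈ℂ e · f →
      (proj₁ s + (0# + (x * proj₁ w - y * proj₂ w)) , proj₂ s + (x * proj₂ w + y * proj₁ w)) ≈ℂ
      (fromℤ a + (x * proj₁ e - y * proj₂ e) , x * proj₂ e + y * proj₁ e) · f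
    step (w₁ , w₂) (s₁ , s₂) (e₁ , e₂) (f₁ , f₂) (p , q) (r , t) =
      trans (+-cong p (+-congˡ (+-cong (*-congˡ r) (-‿cong (*-congˡ t)))))
        (solve 7 (λ a x y e₁ e₂ f₁ f₂ → a :* f₁ :+ (con 0ℤ :+
            (x :* (e₁ :* f₁ :- e₂ :* f₂) :- y :* (e₁ :* f₂ :+ e₂ :* f₁))) :=
          (a :+ (x :* e₁ :- y :* e₂)) :* f₁ :- (x :* e₂ :+ y :* e₁) :* f₂) refl (fromℤ a) x y e₁ e₂ f₁ f₂) ,
      trans (+-cong q (+-cong (*-congˡ t) (*-congˡ r)))
        (solve 7 (λ a x y e₁ e₂ f₁ f₂ → a :* f₂ :+ (x :* (e₁ :* f₂ :+ e₂ :* f₁) :+ y :*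
            (e₁ :* f₁ :- e₂ :* f₂)) :=
          (a :+ (x :* e₁ :- y :* e₂)) :* f₂ :+ (x :* e₂ :+ y :* e₁) :* f₁) refl (fromℤ a) x y e₁ e₂ f₁ f₂)

  evalℂ-cubic : ∀ A B C x y → evalℂ (C ∷ B ∷ A ∷ 1ℤ ∷ []) (x , y) ≈ℂ
    (re (fromℤ A) (fromℤ B) (fromℤ C) x y , im (fromℤ A) (fromℤ B) (fromℤ C) x y)
  evalℂ-cubic A B C x y =
    solve 5 (λ a b c x y → let u₃ = con 1ℤ :+ (x :* con 0ℤ :- y :* con 0ℤ) ; v₃ = x :* con 0ℤ :+ y :* con 0ℤ
                               u₂ = a :+ (x :* u₃ :- y :* v₃) ; v₂ = x :* v₃ :+ y :* u₃
                               u₁ = b :+ (x :* u₂ :- y :* v₂) ; v₁ = x :* v₂ :+ y :* u₂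
      in c :+ (x :* u₁ :- y :* v₁) :=
         c :+ b :* x :+ a :* (x :* x :- y :* y) :+ (x :* x :* x :- con (+ 3) :* x :* y :* y)) refl
             (fromℤ A) (fromℤ B) (fromℤ C) x y ,
    solve 4 (λ a b x y → let u₃ = con 1ℤ :+ (x :* con 0ℤ :- y :* con 0ℤ) ; v₃ = x :* con 0ℤ :+ y :* con 0ℤ
                             u₂ = a :+ (x :* u₃ :- y :* v₃) ; v₂ = x :* v₃ :+ y :* u₃
                             u₁ = b :+ (x :* u₂ :- y :* v₂) ; v₁ = x :* v₂ :+ y :* u₂
      in x :* v₁ :+ y :* u₁ :=
         y :* (con (+ 3) :* x :* x :- y :* y :+ con (+ 2) :* a :* x :+ b)) refl (fromℤ A) (fromℤ B) x y

  linear-factor : Poly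
  linear-factor = ℤ.- 1ℤ ∷ 1ℤ ∷ []

  evalℂ-linear : ∀ x y → evalℂ linear-factor (x , y) ≈ℂ (x - fromℤ 1ℤ , y)
  evalℂ-linear x y =
    solve 2 (λ x y → con -1ℤ :+ (x :* (con 1ℤ :+ (x :* con 0ℤ :- y :* con 0ℤ)) :- y :*
        (x :* con 0ℤ :+ y :* con 0ℤ)) := x :- con 1ℤ) refl x y ,
    solve 2 (λ x y → x :* (x :* con 0ℤ :+ y :* con 0ℤ) :+ y :* (con 1ℤ :+ (x :* con 0ℤ :- y :* con 0ℤ))
        := y) refl x y

  ·-zeroʳ : ∀ z {w} → w ≈ℂ (0# , 0#) → z · w ≈ℂ (0# , 0#)
  ·-zeroʳ (x , y) (p , q) =
    trans (+-cong (trans (*-congˡ p) (zeroʳ x)) (-‿cong (trans (*-congˡ q) (zeroʳ y)))) (-‿inverseʳ 0#) ,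
    trans (+-cong (trans (*-congˡ q) (zeroʳ x)) (trans (*-congˡ p) (zeroʳ y))) (+-identityʳ 0#)

  ·-cong : ∀ {z z′ w w′} → z ≈ℂ z′ → w ≈ℂ w′ → z · w ≈ℂ z′ · w′
  ·-cong (p , q) (r , s) = +-cong (*-cong p r) (-‿cong (*-cong q s)) , +-cong (*-cong p s) (*-cong q r)

  symℂ : ∀ {z w} → z ≈ℂ w → w ≈ℂ z
  symℂ (p , q) = sym p , sym q

  -- Multiplication by the conjugate leaves w scaled by x² + y², which is positive.
  ·-cancel : ∀ {x y w} → y ≉ 0# → (x , y) · w ≈ℂ (0# , 0#) → w ≈ℂ (0# , 0#)
  ·-cancel {x} {y} {u , v} y≉0 (p , q) =
    *-cancel-0 N≉0 (trans (solve 4 (λ x y u v → (y :* y :+ x :* x) :* u := x :* (x :* u :- y :* v) :+ y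
        :* (x :* v :+ y :* u)) refl x y u v) (both (*-congˡ p) (*-congˡ q))) ,
    *-cancel-0 N≉0 (trans (solve 4 (λ x y u v → (y :* y :+ x :* x) :* v := x :* (x :* v :+ y :* u) :+
        (:- y) :* (x :* u :- y :* v)) refl x y u v) (both (*-congˡ q) (*-congˡ p)))
    where
    N≉0 : y * y + x * x ≉ 0#
    N≉0 = pos⇒≉ (+-pos-nonneg (sq-pos y≉0) (sq-nonneg x))
    both : ∀ {s t a b} → s ≈ a * 0# → t ≈ b * 0# → s + t ≈ 0#
    both e f = trans (+-cong (trans e (zeroʳ _)) (trans f (zeroʳ _))) (+-identityʳ 0#)

  -- The factor t - 1 has no zero off the real line, so the nonreal roots of `P` are those of the
  -- cubic.
  allRootsReal⇔ : ∀ A B C P → P ≋ linear-factor ⊗ (C ∷ B ∷ A ∷ 1ℤ ∷ []) →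
                  AllRootsReal P ⇔ AllReal (fromℤ A) (fromℤ B) (fromℤ C)
  allRootsReal⇔ A B C P P≋ = mk⇔
    (λ all x y re≈0 im≈0 → all (x , y) (transℂ (value x y) (·-zeroʳ _ (re≈0 , im≈0))))
    (λ all (x , y) root → from all x y root)
    where
    value : ∀ x y → evalℂ P (x , y) ≈ℂ (x - fromℤ 1ℤ , y) ·
        (re (fromℤ A) (fromℤ B) (fromℤ C) x y , im (fromℤ A) (fromℤ B) (fromℤ C) x y)
    value x y = transℂ (evalℂ-≋ P (linear-factor ⊗ (C ∷ B ∷ A ∷ 1ℤ ∷ [])) (x , y) P≋)
        (transℂ (evalℂ-⊗ linear-factor (C ∷ B ∷ A ∷ 1ℤ ∷ []) (x , y))
      (·-cong (evalℂ-linear x y) (evalℂ-cubic A B C x y)))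
    from : AllReal (fromℤ A) (fromℤ B) (fromℤ C) → ∀ x y → evalℂ P (x , y) ≈ℂ (0# , 0#) → y ≈ 0#
    from all x y root with y ≟0
    ... | yes e = e
    ... | no y≉0 = let (r , i) = ·-cancel y≉0 (transℂ (symℂ (value x y)) root) in all x y r i

-- The integer bounds as conditions on D and Q.

module Conditions (em : ExcludedMiddle 0ℓ) (ℝ : RealNumbers) where
  open import Data.Integer.Base as ℤ using (ℤ; +_; 0ℤ; 1ℤ; -1ℤ)
  open import Data.Integer.DivMod using (_/ℕ_; a≡a%ℕn+[a/ℕn]*n; n%ℕd<d)
  import Data.Integer.Properties as ℤ
  open import Data.Integer.Tactic.RingSolver using (solve-∀)
  open import Data.List.Base using ([]; _∷_)
  open import Data.Nat.Base as ℕ using (ℕ; zero)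
  open import Data.Product using (∃; ∃-syntax; _×_; _,_)
  open import Data.Sum using (inj₁; inj₂)
  open import Function.Bundles using (_⇔_; mk⇔; Equivalence)
  open import Relation.Binary.PropositionalEquality as ≡ using (_≡_)
  open import Relation.Nullary using (yes; no; contradiction)
  open RealNumbers ℝ hiding (zero)
  open Reals ℝ
  open OrderedField em ℝ
  open Analysis em ℝ
  open Cubic em ℝ
  open RealRoots em ℝ
  open Solver using (solve; _:=_; _:+_; _:*_; _:-_; :-_; con; Polynomial)
  open import Relation.Binary.Reasoning.Setoid setoid

  infixl 6 _⊞_ _⊟_
  infixl 7 _⊠_

  -- A record, so that the integer expression is inferred from the leaves.
  record Represents (i : ℤ) (x : Carrier) : Set where
    constructor represents
    field represented : fromℤ i ≈ x
  open Represents

  int : ∀ i → Represents i (fromℤ i)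
  int i = represents refl

  _⊞_ : ∀ {i j x y} → Represents i x → Represents j y → Represents (i ℤ.+ j) (x + y)
  _⊞_ {i} {j} (represents p) (represents q) = represents (trans (fromℤ-+ i j) (+-cong p q))

  _⊟_ : ∀ {i j x y} → Represents i x → Represents j y → Represents (i ℤ.- j) (x - y)
  _⊟_ {i} {j} (represents p) (represents q) = represents (trans (fromℤ-- i j) (+-cong p (-‿cong q)))

  _⊠_ : ∀ {i j x y} → Represents i x → Represents j y → Represents (i ℤ.* j) (x * y)
  _⊠_ {i} {j} (represents p) (represents q) = represents (trans (fromℤ-* i j) (*-cong p q))

  -- `_/ℕ_` rounds down for dividends of either sign: the remainder is nonnegative and below 3, so
  -- `k` is below three times the successor of the quotient.
  ÷3-bound : ∀ {m k} → + 3 ℤ.* m ℤ.≤ k → m ℤ.≤ k /ℕ 3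
  ÷3-bound {m} {k} 3m≤k with m ℤ.≤? k /ℕ 3
  ... | yes le = le
  ... | no ¬le = contradiction (ℤ.≤-<-trans 3m≤k (ℤ.<-≤-trans k<3[1+q]
        (ℤ.*-monoˡ-≤-nonNeg (+ 3) (ℤ.i<j⇒suc[i]≤j (ℤ.≰⇒> ¬le))))) (ℤ.<-irrefl ≡.refl)
    where
    k<3[1+q] : k ℤ.< + 3 ℤ.* (1ℤ ℤ.+ k /ℕ 3)
    k<3[1+q] = ≡.subst₂ ℤ._<_ (≡.sym (a≡a%ℕn+[a/ℕn]*n k 3)) (expand (k /ℕ 3))
        (ℤ.+-monoˡ-< (k /ℕ 3 ℤ.* + 3) (ℤ.+<+ (n%ℕd<d k 3)))
      where
      expand : ∀ q → + 3 ℤ.+ q ℤ.* + 3 ≡ + 3 ℤ.* (1ℤ ℤ.+ q)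
      expand = solve-∀

  module _ (n h f : ℕ) where
    A B C : ℤ
    A = 1ℤ ℤ.- + n
    B = + h ℤ.+ 1ℤ ℤ.- + n
    C = + h ℤ.+ 1ℤ ℤ.- + f

    a b c Δ : Carrier
    a = fromℤ A
    b = fromℤ B
    c = fromℤ C
    Δ = D a b

    radicandℤ : ℤ
    radicandℤ = (+ n) ℤ.^ 2 ℤ.+ + n ℤ.- + 2 ℤ.- + 3 ℤ.* + h

    fromℤ-D : fromℤ radicandℤ ≈ Δ
    fromℤ-D = trans (reflexive (≡.cong fromℤ (identity (+ n) (+ h))))
        (represented (int A ⊠ int A ⊟ int (+ 3) ⊠ int B))
      where
      identity : ∀ n h → n ℤ.* (n ℤ.* 1ℤ) ℤ.+ n ℤ.- + 2 ℤ.- + 3 ℤ.* h ≡ (1ℤ ℤ.- n) ℤ.* (1ℤ ℤ.- n) ℤ.- +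
          3 ℤ.* (h ℤ.+ 1ℤ ℤ.- n)
      identity = solve-∀

    fromℤ-radicand : fromℤ (radicandℤ ℤ.^ 3) ≈ cube Δ
    fromℤ-radicand = trans (reflexive (≡.cong fromℤ (identity radicandℤ))) (represented (z ⊠ z ⊠ z))
      where
      z : Represents radicandℤ Δ
      z = represents fromℤ-D
      identity : ∀ z → z ℤ.* (z ℤ.* (z ℤ.* 1ℤ)) ≡ z ℤ.* z ℤ.* z
      identity = solve-∀

    numerator : Carrier → Carrier
    numerator r = fromℤ ((+ 9 ℤ.* + n ℤ.+ + 18) ℤ.* + h ℤ.+ + 20 ℤ.+ + 12 ℤ.* + n) + fromℤ (+ 2) * r
      - fromℤ (+ 2 ℤ.* (+ n) ℤ.^ 3) - fromℤ (+ 3 ℤ.* (+ n) ℤ.^ 2)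

    numerator-Q : ∀ r → numerator r - fromℤ (+ 27) * fromℤ (+ f) ≈ fromℤ (+ 2) * r + Q a b c
    numerator-Q r = begin
      u + fromℤ (+ 2) * r - v - w - fromℤ (+ 27) * fromℤ (+ f)
        ≈⟨ regroup u (fromℤ (+ 2) * r) v w (fromℤ (+ 27) * fromℤ (+ f)) ⟩
      fromℤ (+ 2) * r + (u - v - w - fromℤ (+ 27) * fromℤ (+ f))
        ≈⟨ +-congˡ (represented (int U ⊟ int V ⊟ int W ⊟ int (+ 27) ⊠ int (+ f))) ⟨
      fromℤ (+ 2) * r + fromℤ (U ℤ.- V ℤ.- W ℤ.- + 27 ℤ.* + f)
        ≈⟨ +-congˡ (reflexive (≡.cong fromℤ (identity (+ n) (+ h) (+ f)))) ⟩
      fromℤ (+ 2) * r + fromℤ (+ 2 ℤ.* A ℤ.* A ℤ.* A ℤ.- + 9 ℤ.* A ℤ.* B ℤ.+ + 27 ℤ.* C)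
        ≈⟨ +-congˡ (represented (int (+ 2) ⊠ int A ⊠ int A ⊠ int A ⊟ int (+ 9) ⊠ int A ⊠ int B ⊞ int
            (+ 27) ⊠ int C)) ⟩
      fromℤ (+ 2) * r + Q a b c ∎
      where
      U = (+ 9 ℤ.* + n ℤ.+ + 18) ℤ.* + h ℤ.+ + 20 ℤ.+ + 12 ℤ.* + n
      V = + 2 ℤ.* (+ n) ℤ.^ 3
      W = + 3 ℤ.* (+ n) ℤ.^ 2
      u = fromℤ U
      v = fromℤ V
      w = fromℤ W
      regroup : ∀ u r v w f → u + r - v - w - f ≈ r + (u - v - w - f)
      regroup = solve 5 (λ u r v w f → u :+ r :- v :- w :- f := r :+ (u :- v :- w :- f)) refl
      identity : ∀ n h f → (+ 9 ℤ.* n ℤ.+ + 18) ℤ.* h ℤ.+ + 20 ℤ.+ + 12 ℤ.* n ℤ.- + 2 ℤ.*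
          (n ℤ.* (n ℤ.* (n ℤ.* 1ℤ))) ℤ.- + 3 ℤ.* (n ℤ.* (n ℤ.* 1ℤ)) ℤ.- + 27 ℤ.* f ≡
        + 2 ℤ.* (1ℤ ℤ.- n) ℤ.* (1ℤ ℤ.- n) ℤ.* (1ℤ ℤ.- n) ℤ.- + 9 ℤ.* (1ℤ ℤ.- n) ℤ.* (h ℤ.+ 1ℤ ℤ.- n) ℤ.+
            + 27 ℤ.* (h ℤ.+ 1ℤ ℤ.- f)
      identity = solve-∀

    27·estimate : ∀ r → fromℤ (+ 27) * estimate (+ n) (+ h) r ≈ numerator r
    27·estimate r = trans (solve 3 (λ t m i → t :* (m :* i) := m :* (t :* i)) refl (fromℤ (+ 27))
        (numerator r) (fromℤ (+ 27) ⁻¹))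
      (trans (*-congˡ (⁻¹-inverse (pos⇒≉ (fromℤ-pos 26)))) (*-identityʳ (numerator r)))

    -- The source of both bounds: with r = ±s for a square root s of D³, the number `f` lies between
    -- the two estimates exactly when -2 s ≤ Q ≤ 2 s.
    excess : ∀ r → fromℤ (+ 27) * (estimate (+ n) (+ h) r - fromℤ (+ f)) ≈ fromℤ (+ 2) * r + Q a b c
    excess r = trans (solve 3 (λ t e f → t :* (e :- f) := t :* e :- t :* f) refl (fromℤ (+ 27))
        (estimate (+ n) (+ h) r) (fromℤ (+ f)))
      (trans (+-congʳ (27·estimate r)) (numerator-Q r))

    upper⇔ : ∀ s → fromℤ (+ f) ≤ estimate (+ n) (+ h) s ⇔ 0# ≤ fromℤ (+ 2) * s + Q a b c
    upper⇔ s = mk⇔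
      (λ le → ≤-respʳ (excess s) (*-nonneg (fromℤ-nonneg 27) (≤⇒0≤ le)))
      (λ le → 0≤⇒≤ (nonneg-cancel (fromℤ-pos 26) (≤-respʳ (sym (excess s)) le)))

    lower⇔ : ∀ s → estimate (+ n) (+ h) (- s) ≤ fromℤ (+ f) ⇔ Q a b c ≤ fromℤ (+ 2) * s
    lower⇔ s = mk⇔
      (λ le → ≤-by (*-nonneg (fromℤ-nonneg 27) (≤⇒0≤ le)) deficit)
      (λ le → 0≤⇒≤ (nonneg-cancel (fromℤ-pos 26) (≤-respʳ (sym deficit) (≤⇒0≤ le))))
      where
      deficit : fromℤ (+ 27) * (fromℤ (+ f) - estimate (+ n) (+ h) (- s)) ≈ fromℤ (+ 2) * s - Q a b c
      deficit = trans (solve 3 (λ t e f → t :* (f :- e) := :- (t :* (e :- f))) refl (fromℤ (+ 27))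
          (estimate (+ n) (+ h) (- s)) (fromℤ (+ f)))
        (trans (-‿cong (excess (- s))) (solve 2 (λ s q → :- (con (+ 2) :* (:- s) :+ q) := con (+ 2) :* s
            :- q) refl s (Q a b c)))

    fromℤ-value : ∀ m → evalℝ (c ∷ b ∷ a ∷ fromℤ 1ℤ ∷ []) (fromℤ m) ≈ fromℤ
        (C ℤ.+ m ℤ.* (B ℤ.+ m ℤ.* (A ℤ.+ m ℤ.* (1ℤ ℤ.+ m ℤ.* 0ℤ))))
    fromℤ-value m = sym (represented (int C ⊞ int m ⊠ (int B ⊞ int m ⊠
        (int A ⊞ int m ⊠ (int 1ℤ ⊞ int m ⊠ int 0ℤ)))))

    -- The cubic is −f at −1 and nonnegative at n + f.
    real-root : ∃ λ r → c + r * (b + r * (a + r)) ≈ 0#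
    real-root =
      let (r , _ , root) = intermediate-value (c ∷ b ∷ a ∷ fromℤ 1ℤ ∷ []) {fromℤ -1ℤ} {fromℤ M}
            (fromℤ-mono-≤ { -1ℤ} {M} (ℤ.≤-trans ℤ.-≤+ (ℤ.+≤+ ℕ.z≤n)))
            (≤-respˡ (sym (fromℤ-value -1ℤ)) (fromℤ-mono-≤ {j = 0ℤ}
                (≡.subst (ℤ._≤ 0ℤ) (≡.sym (at--1 (+ n) (+ h) (+ f))) (ℤ.neg-mono-≤ (ℤ.+≤+ (ℕ.z≤n {f}))))))
            (≤-respʳ (sym (fromℤ-value M)) (≤-respʳ (reflexive
                (≡.cong fromℤ (≡.sym (at-M (+ n) (+ h) (+ f))))) nonneg))
      in r , trans (sym (simplify r)) root
      where
      M = + n ℤ.+ + f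
      nonneg : 0# ≤ fromℤ (M ℤ.* M ℤ.* + f ℤ.+ M ℤ.* + f ℤ.+ + h ℤ.* M ℤ.+ + n ℤ.+ + h ℤ.+ 1ℤ)
      nonneg = ≤-respʳ
        (sym (represented (int M ⊠ int M ⊠ int (+ f) ⊞ int M ⊠ int (+ f) ⊞ int (+ h) ⊠ int M ⊞ int (+ n)
            ⊞ int (+ h) ⊞ int 1ℤ)))
        (+-nonneg (+-nonneg (+-nonneg (+-nonneg (+-nonneg
          (*-nonneg (*-nonneg M≥0 M≥0) (fromℤ-nonneg f)) (*-nonneg M≥0 (fromℤ-nonneg f)))
              (*-nonneg (fromℤ-nonneg h) M≥0))
          (fromℤ-nonneg n)) (fromℤ-nonneg h)) (fromℤ-nonneg 1))
        where
        M≥0 : 0# ≤ fromℤ M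
        M≥0 = fromℤ-nonneg (n ℕ.+ f)
      at--1 : ∀ n h f → h ℤ.+ 1ℤ ℤ.- f ℤ.+ -1ℤ ℤ.* (h ℤ.+ 1ℤ ℤ.- n ℤ.+ -1ℤ ℤ.*
          (1ℤ ℤ.- n ℤ.+ -1ℤ ℤ.* (1ℤ ℤ.+ -1ℤ ℤ.* 0ℤ))) ≡ ℤ.- f
      at--1 = solve-∀
      at-M : ∀ n h f → h ℤ.+ 1ℤ ℤ.- f ℤ.+ (n ℤ.+ f) ℤ.*
          (h ℤ.+ 1ℤ ℤ.- n ℤ.+ (n ℤ.+ f) ℤ.* (1ℤ ℤ.- n ℤ.+ (n ℤ.+ f) ℤ.* (1ℤ ℤ.+ (n ℤ.+ f) ℤ.* 0ℤ))) ≡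
        (n ℤ.+ f) ℤ.* (n ℤ.+ f) ℤ.* f ℤ.+ (n ℤ.+ f) ℤ.* f ℤ.+ h ℤ.* (n ℤ.+ f) ℤ.+ n ℤ.+ h ℤ.+ 1ℤ
      at-M = solve-∀
      simplify : ∀ r → evalℝ (c ∷ b ∷ a ∷ fromℤ 1ℤ ∷ []) r ≈ c + r * (b + r * (a + r))
      simplify r = solve 4 (λ a b c r → c :+ r :* (b :+ r :* (a :+ r :* (con 1ℤ :+ r :* con 0ℤ))) := c
          :+ r :* (b :+ r :* (a :+ r))) refl a b c r

    Root : Carrier → Set
    Root s = IsSqrt (fromℤ (radicandℤ ℤ.^ 3)) s

    double-square : ∀ {s} → Root s → fromℤ (+ 2) * s * (fromℤ (+ 2) * s) ≈ fromℤ (+ 4) * cube Δ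
    double-square {s} (_ , ss) = trans (solve 1 (λ s → con (+ 2) :* s :* (con (+ 2) :* s) := con (+ 4)
        :* (s :* s)) refl s)
      (*-congˡ (trans ss fromℤ-radicand))

    2s-nonneg : ∀ {s} → Root s → 0# ≤ fromℤ (+ 2) * s
    2s-nonneg (0≤s , _) = *-nonneg (fromℤ-nonneg 2) 0≤s

    ConditionH : Set
    ConditionH = + h ℤ.≤ ((+ n ℤ.+ + 2) ℤ.* (+ n ℤ.- 1ℤ)) /ℕ 3

    ConditionU ConditionL : Set
    ConditionU = ∃[ s ] Root s × + f ≤⌊ estimate (+ n) (+ h) s ⌋
    ConditionL = ∃[ s ] Root s × + f ≥⌈ estimate (+ n) (+ h) (- s) ⌉

    allReal⇒conditions : AllReal a b c → ConditionH × ConditionU × ConditionL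
    allReal⇒conditions all = fromRoot real-root
      where
      neg-square : ∀ x → (- x) * (- x) ≈ x * x
      neg-square x = solve 1 (λ x → (:- x) :* (:- x) := x :* x) refl x
      fromSqrt : Q a b c * Q a b c ≤ fromℤ (+ 4) * cube Δ → ∃ Root → ConditionU × ConditionL
      fromSqrt disc (s , root) =
        (s , root , ≤⇒≤⌊⌋ {+ f} (Equivalence.from (upper⇔ s)
            (≤-respʳ (solve 2 (λ x q → x :- (:- q) := x :+ q) refl (fromℤ (+ 2) * s) (Q a b c))
          (≤⇒0≤ (square-bound (2s-nonneg root) (≤-respˡ (sym (neg-square (Q a b c))) Q²≤)))))) ,
        (s , root , ≥⇒≥⌈⌉ {+ f} (Equivalence.from (lower⇔ s) (square-bound (2s-nonneg root) Q²≤)))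
        where
        Q²≤ : Q a b c * Q a b c ≤ fromℤ (+ 2) * s * (fromℤ (+ 2) * s)
        Q²≤ = ≤-respʳ (sym (double-square root)) disc
      fromRoot : (∃ λ r → c + r * (b + r * (a + r)) ≈ 0#) → ConditionH × ConditionU × ConditionL
      fromRoot (r , root) = condH , fromSqrt (discriminant-nonneg 0≤E)
          (sqrt (≤-respʳ (sym fromℤ-radicand) (*-nonneg (*-nonneg 0≤Δ 0≤Δ) 0≤Δ)))
        where
        open Quotient {a} {b} {c} {r} root using (E-nonneg; D-nonneg; discriminant-nonneg)
        0≤E = E-nonneg all
        0≤Δ = D-nonneg 0≤E
        condH : ConditionH
        -- The radicand is (n + 2)(n - 1) - 3 h, so its being nonnegative is the bound on `h` before
        -- rounding.
        condH = ÷3-bound {+ h} {(+ n ℤ.+ + 2) ℤ.* (+ n ℤ.- 1ℤ)}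
            (ℤ.0≤i-j⇒j≤i (≡.subst (0ℤ ℤ.≤_) (identity (+ n) (+ h))
                (fromℤ-cancel-≤ {0ℤ} {radicandℤ} (≤-respʳ (sym fromℤ-D) 0≤Δ))))
          where
          identity : ∀ n h → n ℤ.* (n ℤ.* 1ℤ) ℤ.+ n ℤ.- + 2 ℤ.- + 3 ℤ.* h ≡ (n ℤ.+ + 2) ℤ.* (n ℤ.- 1ℤ)
              ℤ.- + 3 ℤ.* h
          identity = solve-∀

    conditions⇒allReal : ConditionU → ConditionL → AllReal a b c
    conditions⇒allReal (s , root , f≤) (s′ , root′ , f≥) = discriminant⇒allReal Q²≤
      where
      low : 0# ≤ fromℤ (+ 2) * s + Q a b c
      low = Equivalence.to (upper⇔ s) (≤⌊⌋⇒≤ {+ f} f≤)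
      high : Q a b c ≤ fromℤ (+ 2) * s′
      high = Equivalence.to (lower⇔ s′) (≥⌈⌉⇒≥ {+ f} f≥)
      Q²≤ : Q a b c * Q a b c ≤ fromℤ (+ 4) * cube Δ
      -- The conditions supply square roots `s` and `s′` separately. The sign of Q decides which
      -- bound limits its absolute value, so the two roots are never compared.
      Q²≤ with ≤-total 0# (Q a b c)
      ... | inj₁ 0≤Q = ≤-respʳ (double-square root′) (bound-square 0≤Q high)
      ... | inj₂ Q≤0 = ≤-respʳ (double-square root) (≤-respˡ
            (solve 1 (λ x → (:- x) :* (:- x) := x :* x) refl (Q a b c))
        (bound-square (neg-nonneg Q≤0) (≤-by low (solve 2 (λ x q → x :+ q := x :- (:- q)) refl
            (fromℤ (+ 2) * s) (Q a b c)))))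

  -- The conditions are spelled out so that their instances need no unfolding of h.
  realRoots⇔conditions : ∀ n h f P →
    P ≋ (ℤ.- 1ℤ ∷ 1ℤ ∷ []) ⊗ (+ h ℤ.+ 1ℤ ℤ.- + f ∷ + h ℤ.+ 1ℤ ℤ.- + n ∷ 1ℤ ℤ.- + n ∷ 1ℤ ∷ []) →
    AllRootsReal P ⇔
      ( + h ℤ.≤ ((+ n ℤ.+ + 2) ℤ.* (+ n ℤ.- 1ℤ)) /ℕ 3
      × (∃[ s ] IsSqrt (fromℤ (((+ n) ℤ.^ 2 ℤ.+ + n ℤ.- + 2 ℤ.- + 3 ℤ.* + h) ℤ.^ 3)) s × + f ≤⌊ estimate
          (+ n) (+ h) s ⌋)
      × (∃[ s ] IsSqrt (fromℤ (((+ n) ℤ.^ 2 ℤ.+ + n ℤ.- + 2 ℤ.- + 3 ℤ.* + h) ℤ.^ 3)) s × + f ≥⌈ estimate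
          (+ n) (+ h) (- s) ⌉) )
  realRoots⇔conditions n h f P P≋ = mk⇔
    (λ all → allReal⇒conditions n h f (Equivalence.to roots⇔ all))
    (λ (_ , upper , lower) → Equivalence.from roots⇔ (conditions⇒allReal n h f upper lower))
    where
    roots⇔ : AllRootsReal P ⇔ AllReal (a n h f) (b n h f) (c n h f)
    roots⇔ = allRootsReal⇔ (A n h f) (B n h f) (C n h f) P P≋

-- The arrangement of the coordinate hyperplanes.

module Example (em : ExcludedMiddle 0ℓ) (ℝ : RealNumbers) where
  open import Data.Fin.Base using (Fin; zero; suc)
  open import Data.Fin.Subset using (Side; inside; outside; ∣_∣)
  open import Data.Fin.Subset.Properties using (_∈?_)
  open import Data.Integer.Base as ℤ using (ℤ; +_; -[1+_]; 0ℤ; 1ℤ; -1ℤ)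
  open import Data.Integer.DivMod using (_/ℕ_)
  import Data.Integer.Properties as ℤ
  open import Data.List.Base using ([]; _∷_)
  open import Data.Nat.Base as ℕ using (ℕ; zero; suc)
  import Data.Nat.Properties as ℕ
  open import Data.Product using (∃-syntax; _×_; _,_)
  open import Data.Vec.Base using (_∷_; []; lookup; here; there)
  open import Data.Vec.Properties using ([]=⇒lookup)
  open import Data.Vec.Functional using (Vector)
  open import Function.Base using (_∘_)
  open import Relation.Binary.PropositionalEquality as ≡ using (_≡_; _≢_)
  open import Relation.Nullary using (yes; no; contradiction)
  open import Relation.Unary using (Pred; _∩_)
  open RealNumbers ℝ hiding (zero)
  open Reals ℝ
  open Combinatorics em ℝ
  open SubsetSums em
  open OrderedField em ℝ
  open LinearAlgebra em ℝ
  open Chambers em ℝ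
  open Cells em ℝ
  open CharPoly em ℝ
  open Cubic em ℝ
  open Conditions em ℝ using (Root; excess)
  open Solver using (solve; _:=_; _:+_; _:*_; _:-_; :-_; con)
  open import Algebra.Properties.Ring ring

  private variable d n : ℕ

  -- Each `v i` satisfies every equation but its own, so it witnesses that this equation still cuts
  -- down the dimension after any of the others have been imposed.
  dim-dual : ∀ (V : Pred (Vector Carrier d) 0ℓ) (a v : Fin n → Vector Carrier d) → IsSubspace V →
      (∀ i → V (v i)) →
    (∀ i → a i ∙ v i ≉ 0#) → (∀ {i j} → i ≢ j → a i ∙ v j ≈ 0#) → ∀ S → dim V ≡ ∣ S ∣ ℕ.+ dim
        (V ∩ OnSubset a S)
  dim-dual V a v sub Vv diag off [] = dim-cong {P = V} {V ∩ OnSubset a []} (λ x Vx → Vx , λ _ ())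
      (λ x (Vx , _) → Vx)
  dim-dual V a v sub Vv diag off (inside ∷ S) = ≡.trans (dim-∩⊥ (a zero) sub (Vv zero) (diag zero))
      (≡.cong suc
    (≡.trans
      (dim-dual (V ∩ a zero ^⊥) (a ∘ suc) (v ∘ suc) (∩⊥-subspace (a zero) sub) (λ i → Vv (suc i) , off λ ()) (diag ∘ suc) (λ i≢j → off λ { ≡.refl → i≢j ≡.refl }) S)
      (≡.cong (∣ S ∣ ℕ.+_) (dim-cong {P = (V ∩ a zero ^⊥) ∩ OnSubset (a ∘ suc) S}
          {V ∩ OnSubset a (inside ∷ S)}
        (λ x ((Vx , e₀) , e) → Vx , λ { zero here → e₀ ; (suc i) (there i∈S) → e i i∈S })
        (λ x (Vx , e) → (Vx , e zero here) , λ i i∈S → e (suc i) (there i∈S))))))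
  dim-dual V a v sub Vv diag off (outside ∷ S) = ≡.trans
    (dim-dual V (a ∘ suc) (v ∘ suc) sub (Vv ∘ suc) (diag ∘ suc) (λ i≢j → off λ { ≡.refl → i≢j ≡.refl }) S)
    (≡.cong (∣ S ∣ ℕ.+_) (dim-cong {P = V ∩ OnSubset (a ∘ suc) S} {V ∩ OnSubset a (outside ∷ S)}
      (λ x (Vx , e) → Vx , λ { (suc i) (there i∈S) → e i i∈S })
      (λ x (Vx , e) → Vx , λ i i∈S → e (suc i) (there i∈S))))

  coordinate : ∀ d → Arrangement d d
  coordinate d = record
    { normal    = δ
    ; nonzero   = λ i z → 1≉0 (trans (reflexive (≡.sym (δ-diag i))) (z i))
    ; distinct  = λ {i} {j} i≢j (Hi⊆Hj , _) → 1≉0 (trans (reflexive (≡.sym (δ-diag j)))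
        (trans (sym (δ-∙ j (δ j))) (Hi⊆Hj {δ j} (trans (δ-∙ i (δ j)) (reflexive (δ-off (i≢j ∘ ≡.sym)))))))
    ; essential = λ x on i → trans (sym (δ-∙ i x)) (on i)
    }

  module _ {d : ℕ} where
    open Arrangement (coordinate d)

    coordinate-closed : ∀ S → Closed S
    coordinate-closed S i S⊆H with i ∈? S
    ... | yes i∈S = i∈S
    ... | no  i∉S = contradiction (trans (sym (reflexive off-S)) (trans (sym (δ-∙ i x)) (S⊆H {x} on-S))) 1≉0
      where
      value : Side → Carrier
      value inside  = 0#
      value outside = 1#
      -- The 0-1 vector that vanishes exactly at the indices in `S` separates `⋂ S` from all other
      -- coordinate hyperplanes.
      x : Vector Carrier d
      x j = value (lookup S j)
      on-S : ⋂ S x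
      on-S j j∈S = trans (δ-∙ j x) (reflexive (≡.cong value ([]=⇒lookup j∈S)))
      off-S : x i ≡ 1#
      off-S with lookup S i in e
      ... | outside = ≡.refl
      ... | inside  = contradiction (lookup⇒[]= i S e) i∉S
        where open import Data.Vec.Properties using (lookup⇒[]=)

    coordinate-dim : ∀ S → d ≡ ∣ S ∣ ℕ.+ dim (⋂ S)
    coordinate-dim S = ≡.trans (≡.sym (dim-everything {d})) (≡.trans
      (dim-dual everything δ δ everything-subspace _ (λ i → pos⇒≉
          (<-resp refl (sym (trans (δ-∙ i (δ i)) (reflexive (δ-diag i)))) 0<1))
        (λ {i} {j} i≢j → trans (δ-∙ i (δ j)) (reflexive (δ-off (i≢j ∘ ≡.sym)))) S)
      (≡.cong (∣ S ∣ ℕ.+_) (dim-cong {P = everything ∩ OnSubset δ S} {⋂ S} (λ x (_ , e) → e)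
          (λ x e → _ , e))))

    coordinate-chamber : ∀ σ → Chamber everything normal σ
    coordinate-chamber σ = x , _ , λ i → <-resp refl
        (sym (trans (signed-cong (lookup σ i) (δ-∙ i x)) (signed-signed (lookup σ i)))) 0<1
      where
      x : Vector Carrier d
      x i = signed (lookup σ i) 1#
      signed-signed : ∀ s → signed s (signed s 1#) ≈ 1#
      signed-signed inside  = refl
      signed-signed outside = -‿involutive 1#

  -- Every index set is closed and cuts out dimension 4 - ∣X∣, so the lines are the six pairs.
  -- Passing from `ind` to the decision procedure behind `𝟙` lets the sum evaluate.
  coordinate-h : h (coordinate 4) ≡ 6
  coordinate-h = ℤ.+-injective (≡.trans (+h≡Σ (coordinate 4))
      (Σₛ-cong {4} {g = λ X → 𝟙 (∣ X ∣ ℕ.≟ 2) ℤ.* + (∣ X ∣ ℕ.∸ 1)} term))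
    where
    open Arrangement (coordinate 4)
    term : ∀ X → ind (Closed X) ℤ.* (ind (dim (⋂ X) ≡ 2) ℤ.* + (∣ X ∣ ℕ.∸ 1)) ≡ 𝟙 (∣ X ∣ ℕ.≟ 2) ℤ.* +
        (∣ X ∣ ℕ.∸ 1)
    term X = ≡.trans (ind-*-yes _ (coordinate-closed X)) (≡.cong (ℤ._* + (∣ X ∣ ℕ.∸ 1)) (≡.trans
      (ind-cong (λ e → ≡.sym (ℕ.+-cancelʳ-≡ 2 2 ∣ X ∣ (≡.trans (coordinate-dim X) (≡.cong (∣ X ∣ ℕ.+_) e))))
                (λ e → ≡.sym (ℕ.+-cancelˡ-≡ 2 2 (dim (⋂ X))
                    (≡.trans (coordinate-dim X) (≡.cong (ℕ._+ dim (⋂ X)) e)))))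
      (≡.sym (𝟙≡ind (∣ X ∣ ℕ.≟ 2)))))

  -- With the first sign fixed, all eight choices of the other three are realised.
  coordinate-cells : Enumeration.size (cells (coordinate 4)) ≡ 8
  coordinate-cells = ℤ.+-injective (≡.trans (Enumeration.size-Σ (cells (coordinate 4)))
    (Σₛ-cong {3} {g = λ _ → 1ℤ} λ σ → ind-yes (coordinate-chamber (inside ∷ σ))))

  -- Stated for numbers known to be 6 and 8, since the values attached to the arrangement depend on
  -- excluded middle and do not compute. The radicand is then 0, and both estimates are exactly 8.
  tight : ∀ {h f} → h ≡ 6 → f ≡ 8 →
    + h ≡ ((+ 4 ℤ.+ + 2) ℤ.* (+ 4 ℤ.- 1ℤ)) /ℕ 3
    × (∃[ s ] IsSqrt (fromℤ (((+ 4) ℤ.^ 2 ℤ.+ + 4 ℤ.- + 2 ℤ.- + 3 ℤ.* + h) ℤ.^ 3)) s × IsFloor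
        (estimate (+ 4) (+ h) s) (+ f))
    × (∃[ s ] IsSqrt (fromℤ (((+ 4) ℤ.^ 2 ℤ.+ + 4 ℤ.- + 2 ℤ.- + 3 ℤ.* + h) ℤ.^ 3)) s × IsCeiling
        (estimate (+ 4) (+ h) (- s)) (+ f))
  tight ≡.refl ≡.refl = ≡.refl ,
    (0# , root , ≤-reflexive (sym (exact 0# refl)) , <-resp (sym (exact 0# refl)) refl
        (fromℤ-mono-< {+ 8} {+ 9} (ℤ.+<+ (ℕ.n<1+n 8)))) ,
    (0# , root , <-resp refl (sym (exact (- 0#) -0#≈0#)) (fromℤ-mono-< {+ 7} {+ 8} (ℤ.+<+ (ℕ.n<1+n 7)))
        , ≤-reflexive (exact (- 0#) -0#≈0#))
    where
    root : Root 4 6 8 0#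
    root = ≤-refl , zeroˡ 0#
    exact : ∀ r → r ≈ 0# → estimate (+ 4) (+ 6) r ≈ fromℤ (+ 8)
    exact r r≈0 = from-zero (*-cancel-0 (pos⇒≉ (fromℤ-pos 26))
        (trans (excess 4 6 8 r) (trans (+-congʳ (*-congˡ r≈0))
      -- The numerals -3, 3 and -1 are the coefficients `A`, `B` and `C` here: the cubic is (t -
      -- 1)³, for which Q vanishes.
      (solve 0 (con (+ 2) :* con 0ℤ :+
        (con (+ 2) :* con -[1+ 2 ] :* con -[1+ 2 ] :* con -[1+ 2 ] :- con (+ 9) :* con -[1+ 2 ] :* con
            (+ 3) :+ con (+ 27) :* con -1ℤ) := con 0ℤ) refl))))

-- Assembly of the theorem.

open import Data.Integer using (ℤ; +_; -_; _+_; _-_; _*_; _^_; _≤_; 1ℤ)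
open import Data.Integer.DivMod using (_/ℕ_)
open import Data.List using (_∷_; [])
open import Data.Nat using (ℕ)
open import Data.Product using (∃; ∃-syntax; _×_; _,_)
open import Function.Bundles using (_⇔_; mk⇔; Equivalence)
open import Relation.Binary.PropositionalEquality using (_≡_)
open Cells using (Enumeration; cells; count-cells; hasCells; hyperplanes-exist)
open Chambers using (chambers)
open CharPoly using (restriction-formula; χ-factorisation)
open Conditions using (realRoots⇔conditions)
open Example using (coordinate; coordinate-h; coordinate-cells; tight)
open LinearAlgebra using (everything)

theorem1 :
    (em : ExcludedMiddle 0ℓ) (ℝ : RealNumbers) →
    let open Reals ℝ
        open Combinatorics em ℝ
        -ℝ_ = RealNumbers.-_ ℝ
        radicand = λ (n h : ℤ) → fromℤ ((n ^ 2 + n - + 2 - + 3 * h) ^ 3)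
    in
    ( (n : ℕ) (A : Arrangement 4 n) →
      ∃[ f₃ ] HasCells A 3 f₃
      × χ A ≋ (- 1ℤ ∷ 1ℤ ∷ [])
              ⊗ (+ h A + 1ℤ - + f₃ ∷ + h A + 1ℤ - + n ∷ 1ℤ - + n ∷ 1ℤ ∷ [])
      × ( AllRootsReal (χ A)
          ⇔ ( + h A ≡ + restrictionSum A - + g₁ A
            × + h A ≤ ((+ n + + 2) * (+ n - 1ℤ)) /ℕ 3
            × (∃[ s ] IsSqrt (radicand (+ n) (+ h A)) s
                × + f₃ ≤⌊ estimate (+ n) (+ h A) s ⌋)
            × (∃[ s ] IsSqrt (radicand (+ n) (+ h A)) s
                × + f₃ ≥⌈ estimate (+ n) (+ h A) (-ℝ s) ⌉) ) ) )
    ×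
    ( ∃[ n ] ∃[ A ] ∃[ f₃ ] HasCells {4} {n} A 3 f₃
      × + h A ≡ + restrictionSum A - + g₁ A
      × + h A ≡ ((+ n + + 2) * (+ n - 1ℤ)) /ℕ 3
      × (∃[ s ] IsSqrt (radicand (+ n) (+ h A)) s
          × IsFloor (estimate (+ n) (+ h A) s) (+ f₃))
      × (∃[ s ] IsSqrt (radicand (+ n) (+ h A)) s
          × IsCeiling (estimate (+ n) (+ h A) (-ℝ s)) (+ f₃)) )
theorem1 em ℝ = (λ n A → let (f₃ , hasCells-f₃ , count) = count-cells em ℝ A in f₃ , hasCells-f₃ , conclusion n A f₃ count) ,
    4 , A₄ , f₄ , hasCells em ℝ A₄ , restriction-formula em ℝ A₄ ,
    tight em ℝ {h A₄} {f₄} (coordinate-h em ℝ) (coordinate-cells em ℝ)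
  where
  open Reals ℝ
  open Combinatorics em ℝ
  A₄ = coordinate em ℝ 4
  f₄ = Enumeration.size (cells em ℝ A₄)
  conclusion : ∀ n (A : Arrangement 4 n) f₃ → chambers em ℝ (everything em ℝ) (Arrangement.normal A) ≡ + 2 * + f₃ → _
  conclusion n A f₃ count = factorisation ,
    -- The equation between `h`, the restriction sizes and `g₁` is a count of incidences valid for
    -- every arrangement, whatever the roots.
    mk⇔ (λ allReal → restriction-formula em ℝ A , Equivalence.to conditions⇔ allReal)
        (λ (_ , conditions) → Equivalence.from conditions⇔ conditions)
    where
    factorisation = χ-factorisation em ℝ A f₃ (hyperplanes-exist em ℝ A) count
    conditions⇔ = realRoots⇔conditions em ℝ n (h A) f₃ (χ A) factorisation
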